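{- Let $S=\{s_1,\dots,s_u,0,s_{u+1},\dots,s_n\}$ be a centred Catalan set with $s_1<\dots<s_u\le -1$ and $1\le s_{u+1}<\dots<s_n$, and let $l$ be a positive integer. The number $w_l(S)$ of $(n,l)$-AS-trapezoids $A$ with $\mathcal{S}(A)=S$ is equal to the constant term in $x_1,\dots,x_n$ of \[ \prod_{i=1}^n x_i^{ -n-s_i}\prod_{i=u+1}^n x_i^{2-l}(1+x_i)^l\prod_{1\le i<j\le n}(x_j-x_i)(1+x_i+x_ix_j). \]
   Context: A centred Catalan set of size $m$ is an $m$-subset $S$ of $\{ -m+1,\dots,m-1\}$ with $|S\cap\{ -i,\dots,i\}|\ge i+1$ for all $0\le i\le m-1$. Let $n,l$ be positive integers. An $(n,l)$-AS-trapezoid is an array of $n$ centred rows, the $i$-th row from the bottom having $l+2i-1$ entries from $\{ -1,0,1\}$, such that all row sums are $1$, the column sums of the central $l-1$ columns are $0$, the nonzero entries in every row and in every column alternate in sign, and in every column the first nonzero entry from the top is positive. Label the columns $-n+1,\dots,l+n-1$ from left to right. $\mathcal{S}(A)$ is $\{0\}\cup\{c-1: c\le 0,\ \text{column } c\text{ has positive sum}\}\cup\{c-(l-1): c\ge1,\ \text{column } c\text{ has positive sum}\}$, a centred Catalan set of size $n+1$. -}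

module Defs where

open import Data.Bool using (Bool; true; false; _∧_; T)
open import Data.Nat as ℕ using (ℕ; zero; suc; _∸_)
open import Data.Integer as ℤ using (ℤ; +_; -[1+_]; _+_; _*_; -_; _-_)
open import Data.Fin using (Fin; toℕ)
open import Data.Fin.Properties using (_<?_)
open import Data.List as L using (List; []; _∷_; _++_; map; concatMap; filter; length; foldr; allFin; drop; take)
open import Data.List.Relation.Unary.All using (All)
open import Data.List.Relation.Unary.Unique.Propositional using (Unique)
open import Data.Vec as V using (Vec; toList; replicate; updateAt; zipWith)
open import Data.Product using (_×_; _,_; Σ)
open import Relation.Nullary using (does)
open import Relation.Nullary.Decidable using (_×-dec_)
open import Relation.Binary.PropositionalEquality using (_≡_)

infix 4 _==_
_==_ : ℤ → ℤ → Bool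
x == y = does (x ℤ.≟ y)

allᵇ : {A : Set} → (A → Bool) → List A → Bool
allᵇ p []       = true
allᵇ p (x ∷ xs) = p x ∧ allᵇ p xs

anyᵇ : {A : Set} → (A → Bool) → List A → Bool
anyᵇ p []       = false
anyᵇ p (x ∷ xs) = if p x then true else anyᵇ p xs
  where open import Data.Bool using (if_then_else_)

sumℤ : List ℤ → ℤ
sumℤ = foldr _+_ (+ 0)

range : ℤ → ℕ → List ℤ
range a zero    = []
range a (suc k) = a ∷ range (a + + 1) k

_∈ᵇ_ : ℤ → List ℤ → Bool
x ∈ᵇ xs = anyᵇ (x ==_) xs

sameSet : List ℤ → List ℤ → Bool
sameSet xs ys = allᵇ (_∈ᵇ ys) xs ∧ allᵇ (_∈ᵇ xs) ys

-- Centred Catalan sets of size m.  A finite set of integers is given by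
-- a duplicate-free list of its elements.

CentredCatalan : ℕ → List ℤ → Set
CentredCatalan m S =
  Unique S × length S ≡ m ×
  All (λ x → (- (+ m) + + 1 ℤ.≤ x) × (x ℤ.≤ + m - + 1)) S ×
  (∀ i → i ℕ.< m →
     suc i ℕ.≤ length (filter (λ x → (- (+ i) ℤ.≤? x) ×-dec (x ℤ.≤? + i)) S))

data Entry : Set where
  neg zer pos : Entry

val : Entry → ℤ
val neg = - (+ 1)
val zer = + 0
val pos = + 1

-- An array of n centred rows, listed from the TOP row down.
-- The i-th row from the bottom (i = m+1 below) has l + 2i - 1 = l + 2m + 1
-- entries, occupying the columns -m, ..., l+m  (columns labelled
-- -n+1, ..., l+n-1 overall).
data Array (l : ℕ) : ℕ → Set where
  []  : Array l 0
  _∷_ : {m : ℕ} → Vec Entry (l ℕ.+ 2 ℕ.* m ℕ.+ 1) → Array l m → Array l (suc m)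

rowVals : {k : ℕ} → Vec Entry k → List ℤ
rowVals r = map val (toList r)

rows : {l n : ℕ} → Array l n → List (List ℤ)
rows []      = []
rows (r ∷ A) = rowVals r ∷ rows A

-- entry of the row whose leftmost column is -m, in column c (if present)
entryAt : {k : ℕ} → ℕ → Vec Entry k → ℤ → List ℤ
entryAt m r c with c + + m
... | + p      = take 1 (drop p (rowVals r))
... | -[1+ _ ] = []

column : {l n : ℕ} → Array l n → ℤ → List ℤ
column []              c = []
column (_∷_ {m} r A)   c = entryAt m r c ++ column A c

nonzeros : List ℤ → List ℤ
nonzeros = filter (λ x → Relation.Nullary.Decidable.¬? (x ℤ.≟ + 0))
  where import Relation.Nullary.Decidable

alternatesᵇ : List ℤ → Bool
alternatesᵇ xs = go (nonzeros xs)
  where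
  go : List ℤ → Bool
  go (a ∷ b ∷ ys) = (a * b == - (+ 1)) ∧ go (b ∷ ys)
  go _            = true

firstPositiveᵇ : List ℤ → Bool
firstPositiveᵇ xs with nonzeros xs
... | []    = true
... | a ∷ _ = a == + 1

allColumns : ℕ → ℕ → List ℤ
allColumns n l = range (- (+ n) + + 1) (l ℕ.+ 2 ℕ.* n ∸ 1)

centralColumns : ℕ → List ℤ
centralColumns l = range (+ 1) (l ∸ 1)

IsASTrapezoidᵇ : {l n : ℕ} → Array l n → Bool
IsASTrapezoidᵇ {l} {n} A =
  allᵇ (λ r → (sumℤ r == + 1) ∧ alternatesᵇ r) (rows A) ∧
  allᵇ (λ c → alternatesᵇ (column A c) ∧ firstPositiveᵇ (column A c)) (allColumns n l) ∧
  allᵇ (λ c → sumℤ (column A c) == + 0) (centralColumns l)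

positiveSumᵇ : {l n : ℕ} → Array l n → ℤ → Bool
positiveSumᵇ A c = (+ 1) ≤ᵇ sumℤ (column A c)
  where
  _≤ᵇ_ : ℤ → ℤ → Bool
  x ≤ᵇ y = does (x ℤ.≤? y)

𝒮 : {l n : ℕ} → Array l n → List ℤ
𝒮 {l} {n} A =
  + 0 ∷ (map (λ c → c - + 1)
             (filter′ (positiveSumᵇ A) (range (- (+ n) + + 1) n))
      ++ map (λ c → c - + (l ∸ 1))
             (filter′ (positiveSumᵇ A) (range (+ 1) (l ℕ.+ n ∸ 1))))
  where
  filter′ : (ℤ → Bool) → List ℤ → List ℤ
  filter′ p []       = []
  filter′ p (x ∷ xs) with p x
  ... | true  = x ∷ filter′ p xs
  ... | false = filter′ p xs

TrapezoidsWith : ℕ → ℕ → List ℤ → Set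
TrapezoidsWith n l S =
  Σ (Array l n) (λ A → T (IsASTrapezoidᵇ A ∧ sameSet (𝒮 A) S))

-- Laurent polynomials in x₁,…,xₙ with integer coefficients, represented
-- as (unnormalised) formal sums of terms  c · x^e  with e ∈ ℤⁿ.

Laurent : ℕ → Set
Laurent n = List (ℤ × Vec ℤ n)

constL : {n : ℕ} → ℤ → Laurent n
constL c = (c , replicate _ (+ 0)) ∷ []

xpow : {n : ℕ} → Fin n → ℤ → Laurent n
xpow i e = (+ 1 , updateAt (replicate _ (+ 0)) i (λ _ → e)) ∷ []

x : {n : ℕ} → Fin n → Laurent n
x i = xpow i (+ 1)

infixl 6 _⊕_ _⊝_
infixl 7 _⊗_
infixr 8 _^L_
_⊕_ : {n : ℕ} → Laurent n → Laurent n → Laurent n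
p ⊕ q = p ++ q

_⊝_ : {n : ℕ} → Laurent n → Laurent n → Laurent n
p ⊝ q = p ++ map (λ { (c , e) → (- c , e) }) q

_⊗_ : {n : ℕ} → Laurent n → Laurent n → Laurent n
p ⊗ q = concatMap (λ { (a , e) → map (λ { (b , f) → (a * b , zipWith _+_ e f) }) q }) p

prodL : {n : ℕ} → List (Laurent n) → Laurent n
prodL = foldr _⊗_ (constL (+ 1))

_^L_ : {n : ℕ} → Laurent n → ℕ → Laurent n
p ^L zero  = constL (+ 1)
p ^L suc k = p ⊗ (p ^L k)

isZeroVec : {n : ℕ} → Vec ℤ n → Bool
isZeroVec e = allᵇ (_== + 0) (toList e)

constantTerm : {n : ℕ} → Laurent n → ℤ
constantTerm []             = + 0
constantTerm ((c , e) ∷ p) with isZeroVec e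
... | true  = c + constantTerm p
... | false = constantTerm p

pairsLt : (n : ℕ) → List (Fin n × Fin n)
pairsLt n = concatMap (λ i → map (i ,_) (filter (i <?_) (allFin n))) (allFin n)

-- The Laurent polynomial of Theorem 1.3, for S = {s₁,…,s_u,0,s_{u+1},…,s_n}
-- (s given as the vector (s₁,…,s_n)).
theoremPoly : (n l u : ℕ) → Vec ℤ n → Laurent n
theoremPoly n l u s =
  prodL (map (λ i → xpow i (- (+ n) - V.lookup s i)) (allFin n)) ⊗
  (prodL (map (λ i → xpow i (+ 2 - + l) ⊗ ((constL (+ 1) ⊕ x i) ^L l))
              (filter (λ i → u ℕ.≤? toℕ i) (allFin n))) ⊗
   prodL (map (λ { (i , j) → (x j ⊝ x i) ⊗ (constL (+ 1) ⊕ x i ⊕ (x i ⊗ x j)) })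
              (pairsLt n)))

{-# OPTIONS --safe #-}

-- Cut after k rows from the top, a trapezoid is recorded by the columns with partial sum 1. Consecutive
-- records interlace, and a column is frozen once it lies outside all later rows. Without freezing, the
-- number of ways to reach x₁ < … < x_k is [V(Δ) W(Δ) ∏ binom(·, k−1)](x), where V = ∏_{i<j} (Δ_i − Δ_j) and
-- W = ∏_{i<j} (1 + Δ_j + Δ_i Δ_j): adding a row amounts to a Laplace expansion of V, the other terms of the
-- interlacing sum cancelling by antisymmetry. A column frozen for f rows contributes ∇^f in its variable; a
-- column frozen on the left is first moved from the first to the last place while its position drops by k,
-- which is legitimate because symmetric polynomials in Δ without constant term annihilate V(Δ) ∏ binom(·, k−1).
-- Substituting x = E⁻¹ − 1 in the left and x⁻¹ = E − 1 in the right variables (E the shift, Δ = E − 1)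
-- identifies the resulting operator expression with the constant term.

module Submission where

open import Level using (0ℓ)
open import Algebra.Bundles using (CommutativeRing)
import Algebra.Properties.Semiring.Mult.TCOptimised as Mult
open import Algebra.Solver.Ring.AlmostCommutativeRing using (_-Raw-AlmostCommutative⟶_; fromCommutativeRing)
import Algebra.Solver.Ring as RingSolver
import Algebra.Properties.Ring as RingProps
open import Data.Nat as ℕ using (ℕ; zero; suc; _∸_)
import Data.Nat.Properties as ℕₚ
open import Data.Integer as ℤ using (ℤ; +_; -[1+_])
import Data.Integer.Properties as ℤₚ
open import Data.Integer.Tactic.RingSolver using (solve-∀)
open import Data.List as L using (List; []; _∷_; _++_; map; length; drop)
import Data.List.Properties as Lₚ
open import Data.Maybe as Maybe using (Maybe; just; nothing; maybe′; _>>=_; is-just)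
open import Data.Sum using (_⊎_; inj₁; inj₂; [_,_])
open import Relation.Nullary using (yes; no; does)
open import Relation.Binary.PropositionalEquality as ≡ using (_≡_; _≢_; module ≡-Reasoning)

-- The substitution cannot be made by inverting operators: x⁻¹ = E - 1 would require an inverse of E
-- - 1, which kills constants. Instead x and E act side by side on functions of two integers, γL a k
-- = CT x^a (1 + x)^(-k-1) and γR a k = CT x^a (1 + x⁻¹)^k, where CT is the constant term and the
-- second power is expanded in x⁻¹: x shifts a and E shifts k. In the ring of operators modulo those
-- annihilating the product of all the γ's, the substitution is an honest equation. Read with k
-- fixed (-1 on the left, 0 on the right), this product is the constant-term functional in x. Read
-- with a fixed (-(n-1) on the left, n-1 on the right), it is, up to sign and a translation of k,
-- the product of binomials on which the operator formula acts. Both sides of the theorem thus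
-- become values of one functional. The same kind of quotient, by the annihilator of the binomials
-- alone, turns the nilpotency of Δ into an equation, so that the identities for V and W can be
-- proved once, in an arbitrary commutative ring.

-- Vandermonde-type products over raw operations

del : {A : Set} → ℕ → List A → List A
del _       []       = []
del zero    (x ∷ xs) = xs
del (suc i) (x ∷ xs) = x ∷ del i xs

swapAt : {A : Set} → ℕ → List A → List A
swapAt zero    (x ∷ y ∷ xs) = y ∷ x ∷ xs
swapAt zero    xs           = xs
swapAt (suc i) []           = []
swapAt (suc i) (x ∷ xs)     = x ∷ swapAt i xs

-- No laws are required: formal sums of monomials satisfy the ring laws only up to an equality, and
-- several equalities are imposed on the same carrier. `V`, `W` and `VW` have to be the same terms
-- for all of them.
module Ops {C : Set} (_+_ _*_ : C → C → C) (-_ : C → C) (0# 1# : C) where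
  infixr 8 _^_
  _^_ : C → ℕ → C
  x ^ zero  = 1#
  x ^ suc n = x * (x ^ n)

  nth : List C → ℕ → C
  nth []       _       = 0#
  nth (x ∷ xs) zero    = x
  nth (x ∷ xs) (suc i) = nth xs i

  alt : ℕ → (ℕ → C) → C
  alt zero    f = 0#
  alt (suc n) f = f 0 + (- alt n (λ i → f (suc i)))

  ∏ : (C → C) → List C → C
  ∏ f []       = 1#
  ∏ f (x ∷ xs) = f x * ∏ f xs

  lin : C → C → C → C
  lin a b x = a + (b * x)

  -- One product covers three families: the factors a - x of V, and the factors 1 + (1 + y) x and 1
  -- + y + y x of W with one variable y singled out.
  P : C → C → List C → C
  P a b = ∏ (lin a b)

  inc : C → C
  inc x = 1# + x

  w : C → C → C
  w x y = (1# + y) + (x * y)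

  V W VW : List C → C
  V []       = 1#
  V (x ∷ xs) = P x (- 1#) xs * V xs
  W []       = 1#
  W (x ∷ xs) = ∏ (w x) xs * W xs
  VW xs = V xs * W xs

-- Identities for V and W in a commutative ring

module Vandermonde (R : CommutativeRing 0ℓ 0ℓ) where
  open CommutativeRing R
  open Ops _+_ _*_ -_ 0# 1# public
  open RingProps ring using (-0#≈0#; -‿distribˡ-*; -‿distribʳ-*; -‿involutive; -1*x≈-x)
  open import Algebra.Properties.AbelianGroup +-abelianGroup using (⁻¹-∙-comm)
  open import Relation.Binary.Reasoning.Setoid setoid
  open Mult semiring using (_×_; 1+×; ×-homo-+; ×1-homo-*)

  -- Integer coefficients give the ring solver a decidable coefficient equality, whatever the ring.
  fromℤ : ℤ → Carrier
  fromℤ (+ n)    = n × 1#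
  fromℤ -[1+ n ] = - (suc n × 1#)

  private
    fromℤ-neg : ∀ i → fromℤ (ℤ.- i) ≈ - fromℤ i
    fromℤ-neg (+ zero)  = sym -0#≈0#
    fromℤ-neg (+ suc n) = refl
    fromℤ-neg -[1+ n ]  = sym (-‿involutive _)

    fromℤ-⊖ : ∀ m n → fromℤ (m ℤ.⊖ n) ≈ m × 1# + - (n × 1#)
    fromℤ-⊖ zero    zero    = sym (-‿inverseʳ 0#)
    fromℤ-⊖ zero    (suc n) = sym (+-identityˡ _)
    fromℤ-⊖ (suc m) zero    = sym (trans (+-congˡ -0#≈0#) (+-identityʳ _))
    fromℤ-⊖ (suc m) (suc n) = begin
      fromℤ (suc m ℤ.⊖ suc n)             ≡⟨ ≡.cong fromℤ (ℤₚ.[1+m]⊖[1+n]≡m⊖n m n) ⟩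
      fromℤ (m ℤ.⊖ n)                     ≈⟨ fromℤ-⊖ m n ⟩
      m × 1# + - (n × 1#)                 ≈⟨ +-congʳ (+-identityˡ _) ⟨
      0# + m × 1# + - (n × 1#)            ≈⟨ +-congʳ (+-congʳ (-‿inverseʳ 1#)) ⟨
      1# + - 1# + m × 1# + - (n × 1#)     ≈⟨ +-congʳ (trans (+-assoc _ _ _) (trans (+-congˡ (+-comm _ _)) (sym (+-assoc _ _ _)))) ⟩
      1# + m × 1# + - 1# + - (n × 1#)     ≈⟨ trans (+-assoc _ _ _) (+-cong (sym (1+× m 1#)) (trans (⁻¹-∙-comm _ _) (-‿cong (sym (1+× n 1#))))) ⟩
      suc m × 1# + - (suc n × 1#)         ∎

    fromℤ-+ : ∀ i j → fromℤ (i ℤ.+ j) ≈ fromℤ i + fromℤ j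
    fromℤ-+ (+ m)    (+ n)    = ×-homo-+ 1# m n
    fromℤ-+ (+ m)    -[1+ n ] = fromℤ-⊖ m (suc n)
    fromℤ-+ -[1+ m ] (+ n)    = trans (fromℤ-⊖ n (suc m)) (+-comm _ _)
    fromℤ-+ -[1+ m ] -[1+ n ] = trans (-‿cong (trans (reflexive (≡.cong (_× 1#) (≡.sym (≡.cong suc (ℕₚ.+-suc m n))))) (×-homo-+ 1# (suc m) (suc n)))) (sym (⁻¹-∙-comm _ _))

    fromℤ-*⁺ : ∀ m j → fromℤ (+ m ℤ.* j) ≈ fromℤ (+ m) * fromℤ j
    fromℤ-*⁺ m (+ n)    = trans (reflexive (≡.cong fromℤ (≡.sym (ℤₚ.pos-* m n)))) (×1-homo-* m n)
    fromℤ-*⁺ m -[1+ n ] = begin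
      fromℤ (+ m ℤ.* ℤ.- + suc n)     ≡⟨ ≡.cong fromℤ (ℤₚ.neg-distribʳ-* (+ m) (+ suc n)) ⟨
      fromℤ (ℤ.- (+ m ℤ.* + suc n))   ≈⟨ fromℤ-neg (+ m ℤ.* + suc n) ⟩
      - fromℤ (+ m ℤ.* + suc n)       ≈⟨ -‿cong (fromℤ-*⁺ m (+ suc n)) ⟩
      - (fromℤ (+ m) * (suc n × 1#))  ≈⟨ -‿distribʳ-* _ _ ⟩
      fromℤ (+ m) * - (suc n × 1#)    ∎

    fromℤ-* : ∀ i j → fromℤ (i ℤ.* j) ≈ fromℤ i * fromℤ j
    fromℤ-* (+ m)    j = fromℤ-*⁺ m j
    fromℤ-* -[1+ m ] j = begin
      fromℤ (ℤ.- + suc m ℤ.* j)     ≡⟨ ≡.cong fromℤ (ℤₚ.neg-distribˡ-* (+ suc m) j) ⟨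
      fromℤ (ℤ.- (+ suc m ℤ.* j))   ≈⟨ fromℤ-neg (+ suc m ℤ.* j) ⟩
      - fromℤ (+ suc m ℤ.* j)       ≈⟨ -‿cong (fromℤ-*⁺ (suc m) j) ⟩
      - (suc m × 1# * fromℤ j)      ≈⟨ -‿distribˡ-* _ _ ⟩
      - (suc m × 1#) * fromℤ j      ∎

    fromℤ-morphism : CommutativeRing.rawRing ℤₚ.+-*-commutativeRing -Raw-AlmostCommutative⟶ fromCommutativeRing R
    fromℤ-morphism = record
      { ⟦_⟧ = fromℤ ; +-homo = fromℤ-+ ; *-homo = fromℤ-* ; -‿homo = fromℤ-neg ; 0-homo = refl ; 1-homo = refl }

    fromℤ≟ : ∀ i j → Maybe (fromℤ i ≈ fromℤ j)
    fromℤ≟ i j with i ℤ.≟ j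
    ... | yes p = just (reflexive (≡.cong fromℤ p))
    ... | no _  = nothing

  module Sol = RingSolver (CommutativeRing.rawRing ℤₚ.+-*-commutativeRing) (fromCommutativeRing R) fromℤ-morphism fromℤ≟
  open Sol using (solve; _:=_; _:+_; _:*_; :-_; con)

  private C = Carrier

  alt-cong : ∀ n {f g} → (∀ i → i ℕ.< n → f i ≈ g i) → alt n f ≈ alt n g
  alt-cong zero    h = refl
  alt-cong (suc n) h = +-cong (h 0 (ℕ.s≤s ℕ.z≤n)) (-‿cong (alt-cong n (λ i p → h (suc i) (ℕ.s≤s p))))

  alt-* : ∀ a n f → a * alt n f ≈ alt n (λ i → a * f i)
  alt-* a zero    f = zeroʳ a
  alt-* a (suc n) f = trans
    (solve 3 (λ a x y → a :* (x :+ :- y) := a :* x :+ :- (a :* y)) refl a (f 0) (alt n (λ i → f (suc i))))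
    (+-congˡ (-‿cong (alt-* a n (λ i → f (suc i)))))

  alt-+ : ∀ n f g → alt n f + alt n g ≈ alt n (λ i → f i + g i)
  alt-+ zero    f g = +-identityˡ 0#
  alt-+ (suc n) f g = trans
    (solve 4 (λ x a y b → (x :+ :- a) :+ (y :+ :- b) := (x :+ y) :+ :- (a :+ b)) refl (f 0) _ (g 0) _)
    (+-congˡ (-‿cong (alt-+ n (λ i → f (suc i)) (λ i → g (suc i)))))

  ∏-cong : ∀ {f g} → (∀ x → f x ≈ g x) → ∀ xs → ∏ f xs ≈ ∏ g xs
  ∏-cong h []       = refl
  ∏-cong h (x ∷ xs) = *-cong (h x) (∏-cong h xs)

  ∏-++ : ∀ f xs ys → ∏ f (xs ++ ys) ≈ ∏ f xs * ∏ f ys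
  ∏-++ f []       ys = sym (*-identityˡ _)
  ∏-++ f (x ∷ xs) ys = trans (*-congˡ (∏-++ f xs ys)) (sym (*-assoc _ _ _))

  ∏-del : ∀ f xs i → i ℕ.< length xs → ∏ f xs ≈ f (nth xs i) * ∏ f (del i xs)
  ∏-del f (x ∷ xs) zero    _         = refl
  ∏-del f (x ∷ xs) (suc i) (ℕ.s≤s p) = trans (*-congˡ (∏-del f xs i p))
    (solve 3 (λ a b c → a :* (b :* c) := b :* (a :* c)) refl (f x) _ _)

  ∏-swapAt : ∀ f i xs → ∏ f (swapAt i xs) ≈ ∏ f xs
  ∏-swapAt f zero    []           = refl
  ∏-swapAt f zero    (x ∷ [])     = refl
  ∏-swapAt f zero    (x ∷ y ∷ xs) = solve 3 (λ a b c → a :* (b :* c) := b :* (a :* c)) refl (f y) (f x) _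
  ∏-swapAt f (suc i) []           = refl
  ∏-swapAt f (suc i) (x ∷ xs)     = *-congˡ (∏-swapAt f i xs)

  -- Newton interpolation of X^k at the points xs, homogenised (X = − a / b) and cleared of denominators.
  P*V : ∀ a b xs → let k = length xs in
    P a b xs * V xs ≈ a ^ k * V xs + b * alt k (λ i → nth xs i ^ k * (P a b (del i xs) * V (del i xs)))
  P*V a b []       = solve 1 (λ b → con (+ 1) :* con (+ 1) := con (+ 1) :* con (+ 1) :+ b :* con (+ 0)) refl b
  P*V a b (y ∷ ys) = begin
    lin a b y * A * (Y * v)
      ≈⟨ solve 5 (λ a b y A Yv → (a :+ b :* y) :* A :* Yv := a :* (A :* Yv) :+ b :* y :* A :* Yv) refl a b y A (Y * v) ⟩
    a * (A * (Y * v)) + b * y * A * (Y * v)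
      ≈⟨ solve 6 (λ a b y A Y v → a :* (A :* (Y :* v)) :+ b :* y :* A :* (Y :* v) := a :* Y :* (A :* v) :+ b :* y :* A :* (Y :* v)) refl a b y A Y v ⟩
    a * Y * (A * v) + b * y * A * (Y * v)
      -- Two instances of the induction hypothesis: the interpolation at `ys` is evaluated at -a/b
      -- and, with a = y and b = -1, at the new point `y`.
      ≈⟨ +-cong (*-congˡ (P*V a b ys)) (*-congˡ (P*V y (- 1#) ys)) ⟩
    a * Y * (a ^ k * v + b * S₁) + b * y * A * (y ^ k * v + - 1# * S₂)
      ≈⟨ +-congˡ (*-congˡ (+-congˡ (-1*x≈-x S₂))) ⟩
    a * Y * (a ^ k * v + b * S₁) + b * y * A * (y ^ k * v + - S₂)
      ≈⟨ solve 10 (λ a b y A Y v ak yk S₁ S₂ →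
           a :* Y :* (ak :* v :+ b :* S₁) :+ b :* y :* A :* (yk :* v :+ :- S₂)
             := (a :* ak) :* (Y :* v) :+ b :* ((y :* yk) :* (A :* v) :+ :- (y :* A :* S₂ :+ (:- (a :* Y)) :* S₁)))
           refl a b y A Y v (a ^ k) (y ^ k) S₁ S₂ ⟩
    a ^ suc k * (Y * v) + b * (y ^ suc k * (A * v) + - (y * A * S₂ + - (a * Y) * S₁))
      ≈⟨ +-congˡ (*-congˡ (+-congˡ (-‿cong rest))) ⟩
    a ^ suc k * (Y * v) + b * (y ^ suc k * (A * v) + - alt k t) ∎
    where
    k = length ys
    A = P a b ys
    Y = P y (- 1#) ys
    v = V ys
    s₁ s₂ t : ℕ → C
    s₁ i = nth ys i ^ k * (P a b (del i ys) * V (del i ys))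
    s₂ i = nth ys i ^ k * (P y (- 1#) (del i ys) * V (del i ys))
    t i = nth ys i ^ suc k * (lin a b y * P a b (del i ys) * (P y (- 1#) (del i ys) * V (del i ys)))
    S₁ = alt k s₁
    S₂ = alt k s₂
    rest : y * A * S₂ + - (a * Y) * S₁ ≈ alt k t
    rest = begin
      y * A * S₂ + - (a * Y) * S₁
        ≈⟨ +-cong (alt-* _ k s₂) (alt-* _ k s₁) ⟩
      alt k (λ i → y * A * s₂ i) + alt k (λ i → - (a * Y) * s₁ i)
        ≈⟨ alt-+ k _ _ ⟩
      alt k (λ i → y * A * s₂ i + - (a * Y) * s₁ i)
        ≈⟨ alt-cong k (λ i p → begin
             y * A * s₂ i + - (a * Y) * s₁ i
               ≈⟨ +-cong (*-congʳ (*-congˡ (∏-del _ ys i p))) (*-congʳ (-‿cong (*-congˡ (trans (∏-del _ ys i p) (*-congʳ (+-congˡ (-1*x≈-x _))))))) ⟩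
             y * (lin a b (nth ys i) * P a b (del i ys)) * s₂ i
               + - (a * ((y + - nth ys i) * P y (- 1#) (del i ys))) * s₁ i
               ≈⟨ solve 8 (λ a b y x xk A Y v →
                    y :* ((a :+ b :* x) :* A) :* (xk :* (Y :* v)) :+ (:- (a :* ((y :+ :- x) :* Y))) :* (xk :* (A :* v))
                      := (x :* xk) :* ((a :+ b :* y) :* A :* (Y :* v)))
                    refl a b y (nth ys i) (nth ys i ^ k) (P a b (del i ys)) (P y (- 1#) (del i ys)) (V (del i ys)) ⟩
             t i ∎) ⟩
      alt k t ∎

  -- Interpolating X^k at the k points `xs` and evaluating at X = `x` is the expansion of the
  -- Vandermonde determinant along its k-th powers.
  V-laplace : ∀ x xs → V (x ∷ xs) ≈ alt (suc (length xs)) (λ i → nth (x ∷ xs) i ^ length xs * V (del i (x ∷ xs)))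
  V-laplace x xs = trans (P*V x (- 1#) xs) (+-congˡ (-1*x≈-x _))

  alt-zero : ∀ n f → (∀ i → i ℕ.< n → f i ≈ 0#) → alt n f ≈ 0#
  alt-zero zero    f h = refl
  alt-zero (suc n) f h = trans (+-cong (h 0 (ℕ.s≤s ℕ.z≤n)) (trans (-‿cong (alt-zero n _ (λ i p → h (suc i) (ℕ.s≤s p)))) -0#≈0#)) (+-identityˡ 0#)

  -- Every interpolation term contains a vanishing k-th power. As a and b are free, this is the
  -- generating-function form of the fact that elementary symmetric polynomials of positive degree
  -- kill V.
  P*V-nilpotent : ∀ a b xs → (∀ i → i ℕ.< length xs → nth xs i ^ length xs ≈ 0#) →
    P a b xs * V xs ≈ a ^ length xs * V xs
  P*V-nilpotent a b xs nil = trans (P*V a b xs) (trans (+-congˡ (trans (*-congˡ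
    (alt-zero _ _ (λ i p → trans (*-congʳ (nil i p)) (zeroˡ _)))) (zeroʳ b))) (+-identityʳ _))

  1^ : ∀ k → 1# ^ k ≈ 1#
  1^ zero    = refl
  1^ (suc k) = trans (*-identityˡ _) (1^ k)

  V-∷ʳ : ∀ x ys → V (ys ++ x ∷ []) ≈ (- 1#) ^ length ys * V (x ∷ ys)
  V-∷ʳ x []       = sym (*-identityˡ _)
  V-∷ʳ x (y ∷ ys) = begin
    P y (- 1#) (ys ++ x ∷ []) * V (ys ++ x ∷ [])
      ≈⟨ *-cong (∏-++ _ ys (x ∷ [])) (V-∷ʳ x ys) ⟩
    P y (- 1#) ys * ((y + - 1# * x) * 1#) * ((- 1#) ^ length ys * (P x (- 1#) ys * V ys))
      ≈⟨ solve 7 (λ p y x s q v o → p :* ((y :+ o :* x) :* con (+ 1)) :* (s :* (q :* v))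
             := s :* ((y :+ o :* x) :* q) :* (p :* v)) refl _ y x _ _ _ (- 1#) ⟩
    (- 1#) ^ length ys * ((y + - 1# * x) * P x (- 1#) ys) * (P y (- 1#) ys * V ys)
      ≈⟨ *-congʳ (*-congˡ (*-congʳ flip)) ⟩
    (- 1#) ^ length ys * ((- 1# * (x + - 1# * y)) * P x (- 1#) ys) * (P y (- 1#) ys * V ys)
      ≈⟨ solve 5 (λ s o f q r → s :* ((o :* f) :* q) :* r := (o :* s) :* (f :* q :* r)) refl _ (- 1#) _ _ _ ⟩
    (- 1#) ^ suc (length ys) * ((x + - 1# * y) * P x (- 1#) ys * (P y (- 1#) ys * V ys)) ∎
    where
    flip : y + - 1# * x ≈ - 1# * (x + - 1# * y)
    flip = solve 2 (λ x y → y :+ (:- con (+ 1)) :* x := (:- con (+ 1)) :* (x :+ (:- con (+ 1)) :* y)) refl x y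

  W-∷ʳ : ∀ x ys → W (ys ++ x ∷ []) ≈ W ys * ∏ (λ y → w y x) ys
  W-∷ʳ x []       = refl
  W-∷ʳ x (y ∷ ys) = trans (*-cong (∏-++ _ ys (x ∷ [])) (W-∷ʳ x ys))
    (solve 4 (λ a b c d → a :* (b :* con (+ 1)) :* (c :* d) := a :* c :* (b :* d)) refl _ _ _ _)

  -- With z^k = 0 on all variables, both ∏(1 + (1+x) y) and (1+x)^(-k) ∏(1 + x + x y), taken over all
  -- variables y, act on V as 1; comparing them moves x from the first to the last place.
  VW-rotate : ∀ x ys → let k = suc (length ys) in
    (∀ i → i ℕ.< k → nth (x ∷ ys) i ^ k ≈ 0#) →
    (1# + x) ^ k * VW (x ∷ ys) ≈ (- 1#) ^ length ys * VW (ys ++ x ∷ [])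
  VW-rotate x ys nil = begin
    e * (v * (h * W ys))
      ≈⟨ solve 4 (λ e v h u → e :* (v :* (h :* u)) := h :* (e :* v) :* u) refl e v h (W ys) ⟩
    h * (e * v) * W ys
      ≈⟨ *-congʳ (*-congˡ (sym tail)) ⟩
    h * (c * t * v) * W ys
      ≈⟨ solve 5 (λ c h t v u → h :* (c :* t :* v) :* u := t :* (c :* h :* v) :* u) refl c h t v (W ys) ⟩
    t * (c * h * v) * W ys
      ≈⟨ *-congʳ (*-congˡ head) ⟩
    t * v * W ys
      ≈⟨ *-congʳ (*-congˡ vv) ⟩
    t * (s * V (ys ++ x ∷ [])) * W ys
      ≈⟨ solve 4 (λ t s v u → t :* (s :* v) :* u := s :* (v :* (u :* t))) refl t s _ (W ys) ⟩
    s * (V (ys ++ x ∷ []) * (W ys * t))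
      ≈⟨ *-congˡ (*-congˡ (sym (W-∷ʳ x ys))) ⟩
    s * VW (ys ++ x ∷ []) ∎
    where
    k = suc (length ys)
    s = (- 1#) ^ length ys
    e = (1# + x) ^ k
    v = V (x ∷ ys)
    h = ∏ (w x) ys
    t = ∏ (λ y → w y x) ys
    -- This is `w x x`, the variable paired with itself. It extends both `h` and `t` to products
    -- over all of `x ∷ ys`, to which `P*V-nilpotent` applies.
    c = 1# + x + x * x
    head : c * h * v ≈ v
    head = trans (*-congʳ (*-cong
        (solve 1 (λ x → con (+ 1) :+ x :+ x :* x := con (+ 1) :+ (con (+ 1) :+ x) :* x) refl x)
        (∏-cong (λ y → solve 2 (λ x y → con (+ 1) :+ y :+ x :* y := con (+ 1) :+ (con (+ 1) :+ x) :* y) refl x y) ys)))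
      (trans (P*V-nilpotent 1# (1# + x) (x ∷ ys) nil) (trans (*-congʳ (1^ k)) (*-identityˡ _)))
    tail : c * t * v ≈ e * v
    tail = trans (*-congʳ (*-congˡ
        (∏-cong (λ y → solve 2 (λ x y → con (+ 1) :+ x :+ y :* x := con (+ 1) :+ x :+ x :* y) refl x y) ys)))
      (P*V-nilpotent (1# + x) x (x ∷ ys) nil)
    ss : ∀ n → (- 1#) ^ n * (- 1#) ^ n ≈ 1#
    ss zero    = *-identityˡ 1#
    ss (suc n) = trans (solve 1 (λ a → (:- con (+ 1)) :* a :* ((:- con (+ 1)) :* a) := a :* a) refl ((- 1#) ^ n)) (ss n)
    vv : v ≈ s * V (ys ++ x ∷ [])
    vv = sym (trans (*-congˡ (V-∷ʳ x ys)) (trans (sym (*-assoc _ _ _)) (trans (*-congʳ (ss (length ys))) (*-identityˡ _))))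

  -- The only factors of VW not merely permuted when neighbours a, b are exchanged are a - b and w a
  -- b. The extra factor w b a completes the latter to a symmetric product, while the former changes
  -- sign.
  VW-swapAt : ∀ i xs → suc i ℕ.< length xs →
    w (nth xs (suc i)) (nth xs i) * VW xs ≈ - (w (nth xs i) (nth xs (suc i)) * VW (swapAt i xs))
  VW-swapAt zero (x ∷ []) (ℕ.s≤s ())
  VW-swapAt zero (x ∷ y ∷ zs) _ =
    solve 8 (λ x y p q v a b u →
      (con (+ 1) :+ x :+ y :* x) :* (((x :+ (:- con (+ 1)) :* y) :* p) :* (q :* v) :* (((con (+ 1) :+ y :+ x :* y) :* a) :* (b :* u)))
      := :- ((con (+ 1) :+ y :+ x :* y) :* (((y :+ (:- con (+ 1)) :* x) :* q) :* (p :* v) :* (((con (+ 1) :+ x :+ y :* x) :* b) :* (a :* u)))))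
      refl x y _ _ _ _ _ _
  VW-swapAt (suc i) (x ∷ xs) (ℕ.s≤s p) = begin
    k * (P x (- 1#) xs * V xs * (∏ (w x) xs * W xs))
      ≈⟨ solve 5 (λ k a v b u → k :* (a :* v :* (b :* u)) := a :* b :* (k :* (v :* u))) refl k _ _ _ _ ⟩
    P x (- 1#) xs * ∏ (w x) xs * (k * VW xs)
      ≈⟨ *-cong (*-cong (sym (∏-swapAt _ i xs)) (sym (∏-swapAt _ i xs))) (VW-swapAt i xs p) ⟩
    P x (- 1#) xs′ * ∏ (w x) xs′ * - (k′ * VW xs′)
      ≈⟨ solve 5 (λ k a v b u → a :* b :* (:- (k :* (v :* u))) := :- (k :* (a :* v :* (b :* u)))) refl k′ _ _ _ _ ⟩
    - (k′ * (P x (- 1#) xs′ * V xs′ * (∏ (w x) xs′ * W xs′))) ∎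
    where
    xs′ = swapAt i xs
    k = w (nth xs (suc i)) (nth xs i)
    k′ = w (nth xs i) (nth xs (suc i))

  ∏-del-absorb : ∀ q f xs i → i ℕ.< length xs → q * f (nth xs i) ≈ q → q * ∏ f xs ≈ q * ∏ f (del i xs)
  ∏-del-absorb q f xs i p h = trans (*-congˡ (∏-del f xs i p)) (trans (sym (*-assoc _ _ _)) (*-congʳ h))

  ∏-absorb : ∀ q f g xs → (∀ x → q * f x ≈ q * g x) → q * ∏ f xs ≈ q * ∏ g xs
  ∏-absorb q f g []       h = refl
  ∏-absorb q f g (x ∷ xs) h = begin
    q * (f x * ∏ f xs) ≈⟨ *-assoc _ _ _ ⟨
    q * f x * ∏ f xs   ≈⟨ *-congʳ (h x) ⟩
    q * g x * ∏ f xs   ≈⟨ solve 3 (λ a b c → a :* b :* c := b :* (a :* c)) refl q (g x) _ ⟩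
    g x * (q * ∏ f xs) ≈⟨ *-congˡ (∏-absorb q f g xs h) ⟩
    g x * (q * ∏ g xs) ≈⟨ solve 3 (λ a b c → b :* (a :* c) := a :* (b :* c)) refl q (g x) _ ⟩
    q * (g x * ∏ g xs) ∎

  -- In the presence of q the variable z at place i counts as zero: w x z becomes 1 for every
  -- earlier x, and w z y becomes 1 + y for every later y. For z = E - 1 the remaining factors 1 + y
  -- are shifts, so deleting a variable moves all later ones by one.
  W-del : ∀ q xs i → i ℕ.< length xs → q * nth xs i ≈ 0# →
    q * W xs ≈ q * (W (del i xs) * ∏ inc (drop (suc i) xs))
  W-del q (z ∷ ys) zero p h = begin
    q * (∏ (w z) ys * W ys)  ≈⟨ *-assoc _ _ _ ⟨
    q * ∏ (w z) ys * W ys    ≈⟨ *-congʳ (∏-absorb q _ _ ys (λ y → begin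
      q * (1# + y + z * y)     ≈⟨ solve 3 (λ q y z → q :* (con (+ 1) :+ y :+ z :* y) := q :* (con (+ 1) :+ y) :+ q :* z :* y) refl q y z ⟩
      q * (1# + y) + q * z * y ≈⟨ +-congˡ (trans (*-congʳ h) (zeroˡ y)) ⟩
      q * (1# + y) + 0#        ≈⟨ +-identityʳ _ ⟩
      q * (1# + y) ∎)) ⟩
    q * ∏ inc ys * W ys  ≈⟨ solve 3 (λ a b c → a :* b :* c := a :* (c :* b)) refl q _ _ ⟩
    q * (W ys * ∏ inc ys) ∎
  W-del q (x ∷ ys) (suc i) (ℕ.s≤s p) h = begin
    q * (∏ (w x) ys * W ys)  ≈⟨ solve 3 (λ a b c → a :* (b :* c) := a :* b :* c) refl q _ _ ⟩
    q * ∏ (w x) ys * W ys    ≈⟨ *-congʳ (∏-del-absorb q (w x) ys i p one) ⟩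
    q * ∏ (w x) (del i ys) * W ys
      ≈⟨ solve 3 (λ a b c → a :* b :* c := b :* (a :* c)) refl q _ _ ⟩
    ∏ (w x) (del i ys) * (q * W ys)
      ≈⟨ *-congˡ (W-del q ys i p h) ⟩
    ∏ (w x) (del i ys) * (q * (W (del i ys) * ∏ inc (drop (suc i) ys)))
      ≈⟨ solve 4 (λ a b c d → b :* (a :* (c :* d)) := a :* (b :* c :* d)) refl q _ _ _ ⟩
    q * (∏ (w x) (del i ys) * W (del i ys) * ∏ inc (drop (suc i) ys)) ∎
    where
    z = nth ys i
    one : q * (1# + z + x * z) ≈ q
    one = begin
      q * (1# + z + x * z) ≈⟨ solve 3 (λ q z x → q :* (con (+ 1) :+ z :+ x :* z) := q :+ q :* z :* (con (+ 1) :+ x)) refl q z x ⟩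
      q + q * z * (1# + x) ≈⟨ +-congˡ (trans (*-congʳ h) (zeroˡ _)) ⟩
      q + 0#               ≈⟨ +-identityʳ q ⟩
      q ∎

  -- The power z_i^k split off by the expansion of V is killed by one more z_i, so it can serve as
  -- the q of `W-del`.
  VW-laplace : ∀ x xs → let k = length xs; zs = x ∷ xs in
    (∀ i → i ℕ.< suc k → nth zs i ^ suc k ≈ 0#) →
    VW zs ≈ alt (suc k) (λ i → nth zs i ^ k * (VW (del i zs) * ∏ inc (drop (suc i) zs)))
  VW-laplace x xs nil = begin
    V zs * W zs                                            ≈⟨ *-congʳ (V-laplace x xs) ⟩
    alt (suc k) (λ i → nth zs i ^ k * V (del i zs)) * W zs ≈⟨ *-comm _ _ ⟩
    W zs * alt (suc k) (λ i → nth zs i ^ k * V (del i zs)) ≈⟨ alt-* _ (suc k) (λ i → nth zs i ^ k * V (del i zs)) ⟩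
    alt (suc k) (λ i → W zs * (nth zs i ^ k * V (del i zs)))
      ≈⟨ alt-cong (suc k) (λ i p → begin
           W zs * (nth zs i ^ k * V (del i zs))
             ≈⟨ solve 3 (λ a b c → a :* (b :* c) := c :* (b :* a)) refl _ _ _ ⟩
           V (del i zs) * (nth zs i ^ k * W zs)
             ≈⟨ *-congˡ (W-del (nth zs i ^ k) zs i p (trans (*-comm _ _) (nil i p))) ⟩
           V (del i zs) * (nth zs i ^ k * (W (del i zs) * ∏ inc (drop (suc i) zs)))
             ≈⟨ solve 4 (λ a b c d → c :* (b :* (a :* d)) := b :* (c :* a :* d)) refl _ _ _ _ ⟩
           nth zs i ^ k * (VW (del i zs) * ∏ inc (drop (suc i) zs)) ∎) ⟩
    alt (suc k) (λ i → nth zs i ^ k * (VW (del i zs) * ∏ inc (drop (suc i) zs))) ∎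
    where
    k = length xs
    zs = x ∷ xs

-- The source again carries operations without laws; preservation holds up to the equality of the
-- target. Renaming the exponents of formal sums is a map of this kind.
module Hom {C : Set} {_+_ _*_ : C → C → C} { -_ : C → C} {0# 1# : C} (S : CommutativeRing 0ℓ 0ℓ)
  (h : C → CommutativeRing.Carrier S)
  (h-+ : ∀ x y → CommutativeRing._≈_ S (h (x + y)) (CommutativeRing._+_ S (h x) (h y)))
  (h-* : ∀ x y → CommutativeRing._≈_ S (h (x * y)) (CommutativeRing._*_ S (h x) (h y)))
  (h-neg : ∀ x → CommutativeRing._≈_ S (h (- x)) (CommutativeRing.-_ S (h x)))
  (h-1 : CommutativeRing._≈_ S (h 1#) (CommutativeRing.1# S))
  where
  private
    module S = CommutativeRing S
    module A = Ops _+_ _*_ -_ 0# 1#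
    module B = Vandermonde S

  h-∏ : ∀ f g → (∀ x → h (f x) S.≈ g (h x)) → ∀ xs → h (A.∏ f xs) S.≈ B.∏ g (map h xs)
  h-∏ f g e []       = h-1
  h-∏ f g e (x ∷ xs) = S.trans (h-* _ _) (S.*-cong (e x) (h-∏ f g e xs))

  h-inc : ∀ x → h (A.inc x) S.≈ B.inc (h x)
  h-inc x = S.trans (h-+ _ _) (S.+-congʳ h-1)

  h-w : ∀ x y → h (A.w x y) S.≈ B.w (h x) (h y)
  h-w x y = S.trans (h-+ _ _) (S.+-cong (h-inc y) (h-* x y))

  h-V : ∀ xs → h (A.V xs) S.≈ B.V (map h xs)
  h-V []       = h-1
  h-V (x ∷ xs) = S.trans (h-* _ _) (S.*-cong
    (h-∏ _ _ (λ y → S.trans (h-+ _ _) (S.+-congˡ (S.trans (h-* _ _) (S.*-congʳ (S.trans (h-neg _) (S.-‿cong h-1)))))) xs)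
    (h-V xs))

  h-VW : ∀ xs → h (A.VW xs) S.≈ B.VW (map h xs)
  h-VW xs = S.trans (h-* _ _) (S.*-cong (h-V xs) (h-W xs))
    where
    h-W : ∀ xs → h (A.W xs) S.≈ B.W (map h xs)
    h-W []       = h-1
    h-W (x ∷ xs) = S.trans (h-* _ _) (S.*-cong (h-∏ _ _ (h-w x) xs) (h-W xs))

-- Products over pairs of indices, and the substitution in a single pair

module Pairs (R : CommutativeRing 0ℓ 0ℓ) where
  open CommutativeRing R
  open Vandermonde R
  open Sol using (solve; _:=_; _:+_; _:*_; :-_; con)
  open import Relation.Binary.Reasoning.Setoid setoid

  ∏ᵢ : {I : Set} → (I → Carrier) → List I → Carrier
  ∏ᵢ f []       = 1#
  ∏ᵢ f (i ∷ is) = f i * ∏ᵢ f is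

  pairs : {I : Set} → (I → I → Carrier) → List I → Carrier
  pairs q []       = 1#
  pairs q (i ∷ is) = ∏ᵢ (q i) is * pairs q is

  z-pair x-pair : Carrier → Carrier → Carrier
  z-pair a b = (a + - 1# * b) * w a b
  x-pair a b = (b + - a) * (1# + a + a * b)

  module _ {I : Set} where
    ∏ᵢ-cong : ∀ {f g : I → Carrier} → (∀ i → f i ≈ g i) → ∀ is → ∏ᵢ f is ≈ ∏ᵢ g is
    ∏ᵢ-cong h []       = refl
    ∏ᵢ-cong h (i ∷ is) = *-cong (h i) (∏ᵢ-cong h is)

    ∏ᵢ-* : ∀ (f g : I → Carrier) is → ∏ᵢ (λ i → f i * g i) is ≈ ∏ᵢ f is * ∏ᵢ g is
    ∏ᵢ-* f g []       = sym (*-identityˡ 1#)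
    ∏ᵢ-* f g (i ∷ is) = trans (*-congˡ (∏ᵢ-* f g is)) (solve 4 (λ a b c d → a :* b :* (c :* d) := a :* c :* (b :* d)) refl _ _ _ _)

    ∏ᵢ-++ : ∀ (f : I → Carrier) is js → ∏ᵢ f (is ++ js) ≈ ∏ᵢ f is * ∏ᵢ f js
    ∏ᵢ-++ f []       js = sym (*-identityˡ _)
    ∏ᵢ-++ f (i ∷ is) js = trans (*-congˡ (∏ᵢ-++ f is js)) (sym (*-assoc _ _ _))

    ∏ᵢ-const : ∀ c (is : List I) → ∏ᵢ (λ _ → c) is ≈ c ^ length is
    ∏ᵢ-const c []       = refl
    ∏ᵢ-const c (i ∷ is) = *-congˡ (∏ᵢ-const c is)

    pairs-cong : ∀ {q r : I → I → Carrier} → (∀ i j → q i j ≈ r i j) → ∀ is → pairs q is ≈ pairs r is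
    pairs-cong h []       = refl
    pairs-cong h (i ∷ is) = *-cong (∏ᵢ-cong (h i) is) (pairs-cong h is)

    pairs-* : ∀ (q r : I → I → Carrier) is → pairs (λ i j → q i j * r i j) is ≈ pairs q is * pairs r is
    pairs-* q r []       = sym (*-identityˡ 1#)
    pairs-* q r (i ∷ is) = trans (*-cong (∏ᵢ-* (q i) (r i) is) (pairs-* q r is))
      (solve 4 (λ a b c d → a :* b :* (c :* d) := a :* c :* (b :* d)) refl _ _ _ _)

    pairs-++ : ∀ (q : I → I → Carrier) is js → pairs q (is ++ js) ≈ pairs q is * ∏ᵢ (λ i → ∏ᵢ (q i) js) is * pairs q js
    pairs-++ q []       js = sym (trans (*-congʳ (*-identityˡ 1#)) (*-identityˡ _))
    pairs-++ q (i ∷ is) js = trans (*-cong (∏ᵢ-++ (q i) is js) (pairs-++ q is js))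
      (solve 5 (λ a b c d e → a :* b :* (c :* d :* e) := a :* c :* (b :* d) :* e) refl _ _ _ _ _)

    -- Collects per variable the denominators that the substitution clears pair by pair: an index
    -- lies in length - 1 pairs. This is where the exponent n - 1 comes from.
    pairs-degree : ∀ (g : I → Carrier) is → pairs (λ i j → g i * g j) is ≈ ∏ᵢ (λ i → g i ^ (length is ∸ 1)) is
    pairs-degree g []       = refl
    pairs-degree g (i ∷ is) = begin
      ∏ᵢ (λ j → g i * g j) is * pairs (λ i j → g i * g j) is
        ≈⟨ *-cong (trans (∏ᵢ-* (λ _ → g i) g is) (*-congʳ (∏ᵢ-const (g i) is))) (pairs-degree g is) ⟩
      g i ^ length is * ∏ᵢ g is * ∏ᵢ (λ j → g j ^ (length is ∸ 1)) is
        ≈⟨ trans (*-assoc _ _ _) (*-congˡ (sym (∏ᵢ-* g _ is))) ⟩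
      g i ^ length is * ∏ᵢ (λ j → g j * g j ^ (length is ∸ 1)) is
        ≈⟨ *-congˡ (step is) ⟩
      g i ^ length is * ∏ᵢ (λ j → g j ^ length is) is ∎
      where
      step : ∀ is → ∏ᵢ (λ j → g j * g j ^ (length is ∸ 1)) is ≈ ∏ᵢ (λ j → g j ^ length is) is
      step []       = refl
      step (i ∷ is) = refl

  ∏ᵢ-map : ∀ {I J : Set} (f : J → Carrier) (h : I → J) is → ∏ᵢ f (map h is) ≈ ∏ᵢ (λ i → f (h i)) is
  ∏ᵢ-map f h []       = refl
  ∏ᵢ-map f h (i ∷ is) = *-congˡ (∏ᵢ-map f h is)

  pairs-map : ∀ {I J : Set} (q : J → J → Carrier) (h : I → J) is → pairs q (map h is) ≈ pairs (λ i j → q (h i) (h j)) is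
  pairs-map q h []       = refl
  pairs-map q h (i ∷ is) = *-cong (∏ᵢ-map (q (h i)) h is) (pairs-map q h is)

  ∏-∏ᵢ : ∀ f xs → ∏ f xs ≈ ∏ᵢ f xs
  ∏-∏ᵢ f []       = refl
  ∏-∏ᵢ f (x ∷ xs) = *-congˡ (∏-∏ᵢ f xs)

  ∏ᵢ-swap : ∀ {I J : Set} (f : I → J → Carrier) is js → ∏ᵢ (λ i → ∏ᵢ (f i) js) is ≈ ∏ᵢ (λ j → ∏ᵢ (λ i → f i j) is) js
  ∏ᵢ-swap f []       js = sym (ones js)
    where
    ones : ∀ {J : Set} (js : List J) → ∏ᵢ (λ _ → 1#) js ≈ 1#
    ones []       = refl
    ones (j ∷ js) = trans (*-identityˡ _) (ones js)
  ∏ᵢ-swap f (i ∷ is) js = trans (*-congˡ (∏ᵢ-swap f is js)) (sym (∏ᵢ-* (f i) _ js))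

  VW-pairs : ∀ xs → VW xs ≈ pairs z-pair xs
  VW-pairs []       = *-identityˡ 1#
  VW-pairs (x ∷ xs) = begin
    P x (- 1#) xs * V xs * (∏ (w x) xs * W xs)
      ≈⟨ solve 4 (λ a b c d → a :* b :* (c :* d) := a :* c :* (b :* d)) refl _ _ _ _ ⟩
    P x (- 1#) xs * ∏ (w x) xs * VW xs
      ≈⟨ *-cong (trans (*-cong (∏-∏ᵢ _ xs) (∏-∏ᵢ _ xs)) (sym (∏ᵢ-* _ _ xs))) (VW-pairs xs) ⟩
    ∏ᵢ (z-pair x) xs * pairs z-pair xs ∎

  private
    expand : ∀ g h x y → g * g * (h * h) * x-pair x y ≈ (g * (h * y) + - (g * x * h)) * (g * h + g * x * h + g * x * (h * y))
    expand g h x y = solve 4 (λ g h x y →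
      g :* g :* (h :* h) :* ((y :+ :- x) :* (con (+ 1) :+ x :+ x :* y))
        := (g :* (h :* y) :+ :- (g :* x :* h)) :* (g :* h :+ g :* x :* h :+ g :* x :* (h :* y))) refl g h x y

    -- The factor g² h² homogenises the pair factor. Once g x and h y are known as polynomials in g
    -- and h, each of the three cases is a polynomial identity in g and h alone.
    substitute : ∀ {g h x y a b} → g * x ≈ a → h * y ≈ b →
      g * g * (h * h) * x-pair x y ≈ (g * b + - (a * h)) * (g * h + a * h + a * b)
    substitute {g} {h} {x} {y} p q = trans (expand g h x y) (*-cong
      (+-cong (*-congˡ q) (-‿cong (*-congʳ p))) (+-cong (+-congˡ (*-congʳ p)) (*-cong p q)))

    rearrange : ∀ {g x} → g * (1# + x) ≈ 1# → g * x ≈ 1# + - g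
    rearrange {g} {x} p = trans (solve 2 (λ g x → g :* x := g :* (con (+ 1) :+ x) :+ :- g) refl g x) (+-congʳ p)

  -- The substitutions relating a variable x to the shift E and z = E − 1:
  -- E = 1 / (1 + x) on the left, z = 1 / x on the right.
  pair-LL : ∀ {g h x y} → g * (1# + x) ≈ 1# → h * (1# + y) ≈ 1# →
    z-pair (g + - 1#) (h + - 1#) ≈ g * g * (h * h) * x-pair x y
  pair-LL {g} {h} p q = trans
    (solve 2 (λ g h → ((g :+ :- con (+ 1)) :+ (:- con (+ 1)) :* (h :+ :- con (+ 1))) :*
        (con (+ 1) :+ (h :+ :- con (+ 1)) :+ (g :+ :- con (+ 1)) :* (h :+ :- con (+ 1)))
      := (g :* (con (+ 1) :+ :- h) :+ :- ((con (+ 1) :+ :- g) :* h)) :* (g :* h :+ (con (+ 1) :+ :- g) :* h :+ (con (+ 1) :+ :- g) :* (con (+ 1) :+ :- h))) refl g h)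
    (sym (substitute (rearrange p) (rearrange q)))

  pair-RR : ∀ {g h x y} → g * x ≈ 1# → h * y ≈ 1# → z-pair g h ≈ g * g * (h * h) * x-pair x y
  pair-RR {g} {h} p q = trans
    (solve 2 (λ g h → (g :+ (:- con (+ 1)) :* h) :* (con (+ 1) :+ h :+ g :* h)
      := (g :* con (+ 1) :+ :- (con (+ 1) :* h)) :* (g :* h :+ con (+ 1) :* h :+ con (+ 1) :* con (+ 1))) refl g h)
    (sym (substitute p q))

  -- The arguments of `z-pair` are in the opposite order to those of `x-pair`: rotation has carried
  -- the left columns behind the right ones.
  pair-LR : ∀ {g h x y} → g * (1# + x) ≈ 1# → h * y ≈ 1# → z-pair h (g + - 1#) ≈ g * g * (h * h) * x-pair x y
  pair-LR {g} {h} p q = trans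
    (solve 2 (λ g h → (h :+ (:- con (+ 1)) :* (g :+ :- con (+ 1))) :* (con (+ 1) :+ (g :+ :- con (+ 1)) :+ h :* (g :+ :- con (+ 1)))
      := (g :* con (+ 1) :+ :- ((con (+ 1) :+ :- g) :* h)) :* (g :* h :+ (con (+ 1) :+ :- g) :* h :+ (con (+ 1) :+ :- g) :* con (+ 1))) refl g h)
    (sym (substitute (rearrange p) q))

-- From the product in x to an operator expression in shifts

module Convert (R : CommutativeRing 0ℓ 0ℓ) where
  open CommutativeRing R
  open Vandermonde R
  open Pairs R
  open Sol using (solve; _:=_; _:+_; _:*_; :-_; con)
  open import Relation.Binary.Reasoning.Setoid setoid

  -- Integer powers of a unit, indexed by the exponent, so that no inverse operation is needed.
  record Powers (e : ℤ → Carrier) : Set where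
    field
      hom  : ∀ a b → e a * e b ≈ e (a ℤ.+ b)
      unit : e (+ 0) ≈ 1#

    pow : ∀ a k → e a ^ k ≈ e (+ k ℤ.* a)
    pow a zero    = sym unit
    pow a (suc k) = trans (*-congˡ (pow a k)) (trans (hom a _) (reflexive (≡.cong e (lem a (+ k)))))
      where
      lem : ∀ a k → a ℤ.+ k ℤ.* a ≡ (+ 1 ℤ.+ k) ℤ.* a
      lem = solve-∀

  open Powers

  infix 9 _^±
  -- The element (1 - E⁻¹)^f E^a, unfolded by the recursion that `∇^` also follows.
  nab : (ℤ → Carrier) → ℕ → ℤ → Carrier
  nab e zero    a = e a
  nab e (suc f) a = nab e f a + - nab e f (a ℤ.- + 1)

  _^± : ℕ → Carrier
  f ^± = (- 1#) ^ f

  ^-cong : ∀ {a b} k → a ≈ b → a ^ k ≈ b ^ k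
  ^-cong zero    h = refl
  ^-cong (suc k) h = *-cong h (^-cong k h)

  ^-* : ∀ a b k → (a * b) ^ k ≈ a ^ k * b ^ k
  ^-* a b zero    = sym (*-identityˡ 1#)
  ^-* a b (suc k) = trans (*-congˡ (^-* a b k)) (solve 4 (λ a b c d → a :* b :* (c :* d) := a :* c :* (b :* d)) refl a b _ _)

  module _ {e : ℤ → Carrier} (pe : Powers e) where
    nab-left : ∀ f a → (e (ℤ.- + 1) + - 1#) ^ f * e a ≈ f ^± * nab e f a
    nab-left zero    a = refl
    nab-left (suc f) a = begin
      (e (ℤ.- + 1) + - 1#) * p * e a
        ≈⟨ solve 3 (λ m p x → (m :+ :- con (+ 1)) :* p :* x := p :* (m :* x) :+ :- (p :* x)) refl (e (ℤ.- + 1)) p (e a) ⟩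
      p * (e (ℤ.- + 1) * e a) + - (p * e a)
        ≈⟨ +-cong (*-congˡ (trans (hom pe (ℤ.- + 1) a) (reflexive (≡.cong e (ℤₚ.+-comm (ℤ.- + 1) a))))) refl ⟩
      p * e (a ℤ.- + 1) + - (p * e a)
        ≈⟨ +-cong (nab-left f (a ℤ.- + 1)) (-‿cong (nab-left f a)) ⟩
      f ^± * nab e f (a ℤ.- + 1) + - (f ^± * nab e f a)
        ≈⟨ solve 3 (λ s x y → s :* x :+ :- (s :* y) := (:- con (+ 1)) :* s :* (y :+ :- x)) refl (f ^±) _ _ ⟩
      suc f ^± * nab e (suc f) a ∎
      where p = (e (ℤ.- + 1) + - 1#) ^ f

    nab-right : ∀ f a → (e (+ 1) + - 1#) ^ f * e a ≈ nab e f (a ℤ.+ + f)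
    nab-right zero    a = trans (*-identityˡ _) (reflexive (≡.cong e (≡.sym (ℤₚ.+-identityʳ a))))
    nab-right (suc f) a = begin
      (e (+ 1) + - 1#) * p * e a
        ≈⟨ solve 3 (λ m p x → (m :+ :- con (+ 1)) :* p :* x := p :* (m :* x) :+ :- (p :* x)) refl (e (+ 1)) p (e a) ⟩
      p * (e (+ 1) * e a) + - (p * e a)
        ≈⟨ +-congʳ (*-congˡ (hom pe (+ 1) a)) ⟩
      p * e (+ 1 ℤ.+ a) + - (p * e a)
        ≈⟨ +-cong (nab-right f (+ 1 ℤ.+ a)) (-‿cong (nab-right f a)) ⟩
      nab e f (+ 1 ℤ.+ a ℤ.+ + f) + - nab e f (a ℤ.+ + f)
        ≈⟨ reflexive (≡.cong₂ (λ s t → nab e f s + - nab e f t) (lem₁ a (+ f)) (lem₂ a (+ f))) ⟩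
      nab e (suc f) (a ℤ.+ + suc f) ∎
      where
      p = (e (+ 1) + - 1#) ^ f
      lem₁ : ∀ a f → + 1 ℤ.+ a ℤ.+ f ≡ a ℤ.+ (+ 1 ℤ.+ f)
      lem₁ = solve-∀
      lem₂ : ∀ a f → a ℤ.+ f ≡ a ℤ.+ (+ 1 ℤ.+ f) ℤ.- + 1
      lem₂ = solve-∀

  module _ {x e : ℤ → Carrier} (px : Powers x) (pe : Powers e) where
    -- (E⁻²)^N is the share of this variable in the cleared denominators. With x^f = (E⁻¹ - 1)^f,
    -- the remaining E^(-2N) is split as E^(1-N) E^(-N-1): the first power joins the monomial that
    -- does not depend on f, the second is the position -n of a rotated frozen column.
    left-variable : x (+ 1) ≈ e (ℤ.- + 1) + - 1# → ∀ N f a → a ≡ ℤ.- + N ℤ.+ + f →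
      x a * (e (ℤ.- + 1) * e (ℤ.- + 1)) ^ N
        ≈ x (ℤ.- + N) * e (+ 1 ℤ.- + N) * (f ^± * nab e f (ℤ.- + suc N))
    left-variable rel N f a ≡.refl = begin
      x (ℤ.- + N ℤ.+ + f) * (e (ℤ.- + 1) * e (ℤ.- + 1)) ^ N
        ≈⟨ *-cong (sym (hom px (ℤ.- + N) (+ f))) (trans (^-cong N (hom pe _ _)) (pow pe _ N)) ⟩
      x (ℤ.- + N) * x (+ f) * e (+ N ℤ.* (ℤ.- + 1 ℤ.+ ℤ.- + 1))
        ≈⟨ *-cong (*-congˡ xf) (trans (reflexive (≡.cong e (lem (+ N)))) (sym (hom pe (+ 1 ℤ.- + N) (ℤ.- + suc N)))) ⟩
      x (ℤ.- + N) * (e (ℤ.- + 1) + - 1#) ^ f * (e (+ 1 ℤ.- + N) * e (ℤ.- + suc N))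
        ≈⟨ solve 4 (λ a b c d → a :* b :* (c :* d) := a :* c :* (b :* d)) refl _ _ _ _ ⟩
      x (ℤ.- + N) * e (+ 1 ℤ.- + N) * ((e (ℤ.- + 1) + - 1#) ^ f * e (ℤ.- + suc N))
        ≈⟨ *-congˡ (nab-left pe f (ℤ.- + suc N)) ⟩
      x (ℤ.- + N) * e (+ 1 ℤ.- + N) * (f ^± * nab e f (ℤ.- + suc N)) ∎
      where
      lem : ∀ N → N ℤ.* (ℤ.- + 1 ℤ.+ ℤ.- + 1) ≡ + 1 ℤ.- N ℤ.+ ℤ.- (+ 1 ℤ.+ N)
      lem = solve-∀
      xf : x (+ f) ≈ (e (ℤ.- + 1) + - 1#) ^ f
      xf = trans (reflexive (≡.cong x (≡.sym (ℤₚ.*-identityʳ (+ f))))) (trans (sym (pow px (+ 1) f)) (^-cong f rel))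

    -- From x⁻¹ = E - 1 follows 1 + x = x E, so (1 + x)^l supplies E^l. The powers of x add up to N
    -- - f, and x^(-f) = (E - 1)^f = (1 - E⁻¹)^f E^f moves the position from l to l + f.
    right-variable : x (ℤ.- + 1) ≈ e (+ 1) + - 1# → ∀ N l f a → a ≡ ℤ.- + suc N ℤ.- + suc f →
      x a * (x (+ 2 ℤ.- + l) * (1# + x (+ 1)) ^ l) * (x (+ 1) * x (+ 1)) ^ N ≈ x (+ N) * nab e f (+ l ℤ.+ + f)
    right-variable rel N l f a ≡.refl = begin
      x a * (x (+ 2 ℤ.- + l) * (1# + x (+ 1)) ^ l) * (x (+ 1) * x (+ 1)) ^ N
        ≈⟨ *-cong (*-congˡ (*-congˡ (trans (^-cong l factor) (trans (^-* _ _ l) (*-cong (pow px (+ 1) l) (pow pe (+ 1) l))))))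
                  (trans (^-cong N (hom px _ _)) (pow px _ N)) ⟩
      x a * (x (+ 2 ℤ.- + l) * (x (+ l ℤ.* + 1) * e (+ l ℤ.* + 1))) * x (+ N ℤ.* (+ 1 ℤ.+ + 1))
        ≈⟨ solve 5 (λ a b c d f → a :* (b :* (c :* d)) :* f := a :* b :* c :* f :* d) refl _ _ _ _ _ ⟩
      x a * x (+ 2 ℤ.- + l) * x (+ l ℤ.* + 1) * x (+ N ℤ.* (+ 1 ℤ.+ + 1)) * e (+ l ℤ.* + 1)
        ≈⟨ *-congʳ (trans (*-congʳ (trans (*-congʳ (hom px _ _)) (hom px _ _))) (hom px _ _)) ⟩
      x (a ℤ.+ (+ 2 ℤ.- + l) ℤ.+ + l ℤ.* + 1 ℤ.+ + N ℤ.* (+ 1 ℤ.+ + 1)) * e (+ l ℤ.* + 1)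
        ≈⟨ *-cong (trans (reflexive (≡.cong x (lem (+ N) (+ f) (+ l)))) (trans (sym (hom px (+ N) (+ f ℤ.* ℤ.- + 1))) (*-congˡ (trans (sym (pow px (ℤ.- + 1) f)) (^-cong f rel)))))
                  (reflexive (≡.cong e (ℤₚ.*-identityʳ (+ l)))) ⟩
      x (+ N) * (e (+ 1) + - 1#) ^ f * e (+ l)
        ≈⟨ trans (*-assoc _ _ _) (*-congˡ (nab-right pe f (+ l))) ⟩
      x (+ N) * nab e f (+ l ℤ.+ + f) ∎
      where
      lem : ∀ N f l → ℤ.- (+ 1 ℤ.+ N) ℤ.- (+ 1 ℤ.+ f) ℤ.+ (+ 2 ℤ.- l) ℤ.+ l ℤ.* + 1 ℤ.+ N ℤ.* (+ 1 ℤ.+ + 1) ≡ N ℤ.+ f ℤ.* ℤ.- + 1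
      lem = solve-∀
      factor : 1# + x (+ 1) ≈ x (+ 1) * e (+ 1)
      factor = begin
        1# + x (+ 1)                         ≈⟨ +-congʳ (sym (trans (hom px (+ 1) (ℤ.- + 1)) (unit px))) ⟩
        x (+ 1) * x (ℤ.- + 1) + x (+ 1)      ≈⟨ +-congʳ (*-congˡ rel) ⟩
        x (+ 1) * (e (+ 1) + - 1#) + x (+ 1) ≈⟨ solve 2 (λ x e → x :* (e :+ :- con (+ 1)) :+ x := x :* e) refl _ _ ⟩
        x (+ 1) * e (+ 1)                    ∎

  module _ {I J : Set} (xL eL : I → ℤ → Carrier) (xR eR : J → ℤ → Carrier)
    (pxL : ∀ i → Powers (xL i)) (peL : ∀ i → Powers (eL i)) (pxR : ∀ j → Powers (xR j)) (peR : ∀ j → Powers (eR j))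
    (relL : ∀ i → xL i (+ 1) ≈ eL i (ℤ.- + 1) + - 1#) (relR : ∀ j → xR j (ℤ.- + 1) ≈ eR j (+ 1) + - 1#) where

    zL : I → Carrier
    zL i = eL i (+ 1) + - 1#

    zR : J → Carrier
    zR j = eR j (+ 1) + - 1#

    private
      X g g⁻¹ : I ⊎ J → Carrier
      X   = [ (λ i → xL i (+ 1)) , (λ j → xR j (+ 1)) ]
      g   = [ (λ i → eL i (+ 1)) , zR ]
      g⁻¹ = [ (λ i → eL i (ℤ.- + 1)) , (λ j → xR j (+ 1)) ]

      unitL : ∀ i → eL i (+ 1) * (1# + xL i (+ 1)) ≈ 1#
      unitL i = begin
        eL i (+ 1) * (1# + xL i (+ 1))                     ≈⟨ *-congˡ (+-congˡ (relL i)) ⟩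
        eL i (+ 1) * (1# + (eL i (ℤ.- + 1) + - 1#))        ≈⟨ solve 2 (λ a b → a :* (con (+ 1) :+ (b :+ :- con (+ 1))) := a :* b) refl _ _ ⟩
        eL i (+ 1) * eL i (ℤ.- + 1)                        ≈⟨ trans (hom (peL i) (+ 1) (ℤ.- + 1)) (unit (peL i)) ⟩
        1# ∎

      unitR : ∀ j → zR j * xR j (+ 1) ≈ 1#
      unitR j = trans (*-congʳ (sym (relR j))) (trans (hom (pxR j) (ℤ.- + 1) (+ 1)) (unit (pxR j)))

      inverse : ∀ a → g⁻¹ a * g a ≈ 1#
      inverse (inj₁ i) = trans (hom (peL i) (ℤ.- + 1) (+ 1)) (unit (peL i))
      inverse (inj₂ j) = trans (*-comm _ _) (unitR j)

      q : I ⊎ J → I ⊎ J → Carrier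
      q (inj₁ i) (inj₁ i′) = z-pair (zL i) (zL i′)
      q (inj₁ i) (inj₂ j)  = z-pair (zR j) (zL i)
      q (inj₂ j) (inj₂ j′) = z-pair (zR j) (zR j′)
      -- A default value: in `K` no right index precedes a left one. It is chosen to make `q≈` hold
      -- for all pairs.
      q (inj₂ j) (inj₁ i)  = g (inj₂ j) * g (inj₂ j) * (g (inj₁ i) * g (inj₁ i)) * x-pair (X (inj₂ j)) (X (inj₁ i))

      q≈ : ∀ a b → q a b ≈ g a * g a * (g b * g b) * x-pair (X a) (X b)
      q≈ (inj₁ i) (inj₁ i′) = pair-LL (unitL i) (unitL i′)
      q≈ (inj₁ i) (inj₂ j)  = pair-LR (unitL i) (unitR j)
      q≈ (inj₂ j) (inj₂ j′) = pair-RR (unitR j) (unitR j′)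
      q≈ (inj₂ j) (inj₁ i)  = refl

    module _ (is : List I) (js : List J) where
      K : List (I ⊎ J)
      K = map inj₁ is ++ map inj₂ js

      N : ℕ
      N = length is ℕ.+ length js ∸ 1

      private
        ∏-K : ∀ f → ∏ᵢ f K ≈ ∏ᵢ (λ i → f (inj₁ i)) is * ∏ᵢ (λ j → f (inj₂ j)) js
        ∏-K f = trans (∏ᵢ-++ f (map inj₁ is) (map inj₂ js)) (*-cong (∏ᵢ-map f inj₁ is) (∏ᵢ-map f inj₂ js))

        K-length : length K ∸ 1 ≡ N
        K-length = ≡.cong (_∸ 1) (≡.trans (Lₚ.length-++ (map inj₁ is)) (≡.cong₂ ℕ._+_ (Lₚ.length-map inj₁ is) (Lₚ.length-map inj₂ js)))

        VW-q : VW (map zR js ++ map zL is) ≈ pairs q K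
        VW-q = begin
          VW (map zR js ++ map zL is)
            ≈⟨ trans (VW-pairs (map zR js ++ map zL is)) (pairs-++ z-pair (map zR js) (map zL is)) ⟩
          pairs z-pair (map zR js) * ∏ᵢ (λ a → ∏ᵢ (z-pair a) (map zL is)) (map zR js) * pairs z-pair (map zL is)
            ≈⟨ *-cong (*-cong (pairs-map z-pair zR js) (trans (∏ᵢ-map _ zR js) (∏ᵢ-cong (λ j → ∏ᵢ-map _ zL is) js))) (pairs-map z-pair zL is) ⟩
          pairs (λ j j′ → z-pair (zR j) (zR j′)) js * ∏ᵢ (λ j → ∏ᵢ (λ i → z-pair (zR j) (zL i)) is) js * pairs (λ i i′ → z-pair (zL i) (zL i′)) is
            -- The variables z list the right indices first, `K` lists the left ones first; only the
            -- mixed product notices the difference.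
            ≈⟨ *-congʳ (*-congˡ (sym (∏ᵢ-swap (λ i j → z-pair (zR j) (zL i)) is js))) ⟩
          pairs (λ j j′ → z-pair (zR j) (zR j′)) js * ∏ᵢ (λ i → ∏ᵢ (λ j → z-pair (zR j) (zL i)) js) is * pairs (λ i i′ → z-pair (zL i) (zL i′)) is
            ≈⟨ solve 3 (λ a b c → a :* b :* c := c :* b :* a) refl _ _ _ ⟩
          pairs (λ i i′ → z-pair (zL i) (zL i′)) is * ∏ᵢ (λ i → ∏ᵢ (λ j → z-pair (zR j) (zL i)) js) is * pairs (λ j j′ → z-pair (zR j) (zR j′)) js
            ≈⟨ *-cong (*-cong (pairs-map q inj₁ is) (trans (∏ᵢ-map _ inj₁ is) (∏ᵢ-cong (λ i → ∏ᵢ-map (q (inj₁ i)) inj₂ js) is))) (pairs-map q inj₂ js) ⟨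
          pairs q (map inj₁ is) * ∏ᵢ (λ a → ∏ᵢ (q a) (map inj₂ js)) (map inj₁ is) * pairs q (map inj₂ js)
            ≈⟨ pairs-++ q (map inj₁ is) (map inj₂ js) ⟨
          pairs q K ∎

        G G⁻¹ : I ⊎ J → Carrier
        G a = g a * g a
        G⁻¹ a = g⁻¹ a * g⁻¹ a

        GG⁻¹ : ∀ a → G⁻¹ a ^ N * G a ^ N ≈ 1#
        GG⁻¹ a = trans (sym (^-* (G⁻¹ a) (G a) N)) (trans (^-cong N
          (trans (solve 2 (λ a b → a :* a :* (b :* b) := a :* b :* (a :* b)) refl (g⁻¹ a) (g a)) (trans (*-cong (inverse a) (inverse a)) (*-identityˡ 1#)))) (1^ N))

        ∏-1 : ∀ {A : Set} {f : A → Carrier} → (∀ a → f a ≈ 1#) → ∀ as → ∏ᵢ f as ≈ 1#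
        ∏-1 h []       = refl
        ∏-1 h (a ∷ as) = trans (*-cong (h a) (∏-1 h as)) (*-identityˡ 1#)

        X-pairs : pairs (λ a b → x-pair (X a) (X b)) K ≈ ∏ᵢ (λ a → G⁻¹ a ^ N) K * VW (map zR js ++ map zL is)
        X-pairs = sym (begin
          ∏ᵢ (λ a → G⁻¹ a ^ N) K * VW (map zR js ++ map zL is)
            ≈⟨ *-congˡ (trans VW-q (trans (pairs-cong q≈ K) (pairs-* (λ a b → G a * G b) _ K))) ⟩
          ∏ᵢ (λ a → G⁻¹ a ^ N) K * (pairs (λ a b → G a * G b) K * pairs (λ a b → x-pair (X a) (X b)) K)
            ≈⟨ *-congˡ (*-congʳ (trans (pairs-degree G K) (reflexive (≡.cong (λ m → ∏ᵢ (λ a → G a ^ m) K) K-length)))) ⟩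
          ∏ᵢ (λ a → G⁻¹ a ^ N) K * (∏ᵢ (λ a → G a ^ N) K * pairs (λ a b → x-pair (X a) (X b)) K)
            ≈⟨ trans (sym (*-assoc _ _ _)) (*-congʳ (trans (sym (∏ᵢ-* _ _ K)) (∏-1 GG⁻¹ K))) ⟩
          1# * pairs (λ a b → x-pair (X a) (X b)) K
            ≈⟨ *-identityˡ _ ⟩
          pairs (λ a b → x-pair (X a) (X b)) K ∎)

      -- The powers `G⁻¹ a ^ N` released by the pairs are handed out to the single variables. What
      -- remains is a monomial depending on N alone, a sign, and an expression in shifts only.
      convert : ∀ l (aL : I → ℤ) (aR : J → ℤ) (fL : I → ℕ) (fR : J → ℕ) →
        (∀ i → aL i ≡ ℤ.- + N ℤ.+ + fL i) → (∀ j → aR j ≡ ℤ.- + suc N ℤ.- + suc (fR j)) →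
        (∏ᵢ (λ i → xL i (aL i)) is * ∏ᵢ (λ j → xR j (aR j)) js) *
          (∏ᵢ (λ j → xR j (+ 2 ℤ.- + l) * (1# + xR j (+ 1)) ^ l) js * pairs (λ a b → x-pair (X a) (X b)) K)
        ≈ (∏ᵢ (λ i → xL i (ℤ.- + N) * eL i (+ 1 ℤ.- + N)) is * ∏ᵢ (λ j → xR j (+ N)) js) *
          (∏ᵢ (λ i → fL i ^±) is *
            (∏ᵢ (λ j → nab (eR j) (fR j) (+ l ℤ.+ + fR j)) js * ∏ᵢ (λ i → nab (eL i) (fL i) (ℤ.- + suc N)) is * VW (map zR js ++ map zL is)))
      convert l aL aR fL fR hL hR = begin
        (A * B) * (C * pairs (λ a b → x-pair (X a) (X b)) K)
          ≈⟨ *-congˡ (*-congˡ (trans X-pairs (*-congʳ (∏-K (λ a → G⁻¹ a ^ N))))) ⟩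
        (A * B) * (C * (D * E * F))
          ≈⟨ solve 6 (λ a b c d e f → (a :* b) :* (c :* (d :* e :* f)) := (a :* d) :* (b :* c :* e) :* f) refl A B C D E F ⟩
        (A * D) * (B * C * E) * F
          ≈⟨ *-congʳ (*-cong (trans (sym (∏ᵢ-* _ _ is)) (∏ᵢ-cong (λ i → left-variable (pxL i) (peL i) (relL i) N (fL i) (aL i) (hL i)) is))
               (trans (*-congʳ (sym (∏ᵢ-* _ _ js))) (trans (sym (∏ᵢ-* _ _ js)) (∏ᵢ-cong (λ j → right-variable (pxR j) (peR j) (relR j) N l (fR j) (aR j) (hR j)) js)))) ⟩
        ∏ᵢ (λ i → xL i (ℤ.- + N) * eL i (+ 1 ℤ.- + N) * (fL i ^± * nab (eL i) (fL i) (ℤ.- + suc N))) is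
          * ∏ᵢ (λ j → xR j (+ N) * nab (eR j) (fR j) (+ l ℤ.+ + fR j)) js * F
          ≈⟨ *-congʳ (*-cong (trans (∏ᵢ-* _ _ is) (*-congˡ (∏ᵢ-* _ _ is))) (∏ᵢ-* _ _ js)) ⟩
        _ ≈⟨ solve 6 (λ m s n m′ n′ f → m :* (s :* n) :* (m′ :* n′) :* f := (m :* m′) :* (s :* (n′ :* n :* f))) refl _ _ _ _ _ _ ⟩
        _ ∎
        where
        A = ∏ᵢ (λ i → xL i (aL i)) is
        B = ∏ᵢ (λ j → xR j (aR j)) js
        C = ∏ᵢ (λ j → xR j (+ 2 ℤ.- + l) * (1# + xR j (+ 1)) ^ l) js
        D = ∏ᵢ (λ i → G⁻¹ (inj₁ i) ^ N) is
        E = ∏ᵢ (λ j → G⁻¹ (inj₂ j) ^ N) js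
        F = VW (map zR js ++ map zL is)

open import Defs hiding (x)
open import Data.Bool using (Bool; true; false; if_then_else_; not; T; _∧_)
import Data.Bool.Properties as Bₚ
open import Data.Empty using (⊥; ⊥-elim)
open import Data.Fin as Fin using (Fin; zero; suc; toℕ; _↑ˡ_; _↑ʳ_)
import Data.Fin.Properties as Finₚ
open import Data.List using (take; filter; concatMap; allFin; tabulate)
open import Data.List.Membership.Propositional using (_∈_)
open import Data.List.Membership.Propositional.Properties using (∈-++⁻; ∈-++⁺ˡ; ∈-++⁺ʳ; ∈-map⁻; ∈-map⁺; ∈-tabulate⁺; ∈-tabulate⁻)
open import Data.List.Relation.Unary.All as All using (All; []; _∷_)
import Data.List.Relation.Unary.All.Properties as Allₚ
open import Data.List.Relation.Unary.AllPairs using (AllPairs; []; _∷_)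
import Data.List.Relation.Unary.AllPairs.Properties as AllPairsₚ
open import Data.List.Relation.Unary.Any using (here; there)
open import Data.Maybe.Properties using (just-injective)
open import Data.Nat using (_≤_; _<_)
open import Data.Nat.Tactic.RingSolver using () renaming (solve-∀ to solveℕ-∀)
open import Data.Product using (_×_; _,_; ∃; Σ; proj₁; proj₂)
open import Data.Sum.Function.Propositional using (_⊎-↔_)
open import Data.Unit using (⊤; tt)
open import Data.Vec as V using (Vec; []; _∷_; zipWith; replicate; updateAt; lookup; toList; _∷ʳ_)
import Data.Vec.Properties as Vₚ
open import Function using (_∘_; id; _↔_; mk↔ₛ′)
open import Function.Construct.Composition using (_↔-∘_)
open import Relation.Nullary.Decidable using (dec-true; dec-false)
open ≡ using (refl; sym; trans; cong; cong₂; subst)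
open import Data.Integer using (_+_; _*_; -_; _-_)
open Finₚ using (_<?_; +↔⊎)

cong+ˡ : ∀ (a : ℤ) {b c} → b ≡ c → a + b ≡ a + c
cong+ˡ a refl = refl

cong+ʳ : ∀ (c : ℤ) {a b} → a ≡ b → a + c ≡ b + c
cong+ʳ c refl = refl

-- Formal sums acting on functions, and their quotient rings

Poly : Set → Set
Poly A = List (ℤ × A)

-- Terms are never collected or normalised: formal sums are compared only through these values on
-- test functions.
⟪_⟫ : {A : Set} → Poly A → (A → ℤ) → ℤ
⟪ [] ⟫          g = + 0
⟪ (c , e) ∷ p ⟫ g = c * g e + ⟪ p ⟫ g

mapP : {A B : Set} → (A → B) → Poly A → Poly B
mapP h []            = []
mapP h ((c , e) ∷ p) = (c , h e) ∷ mapP h p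

negP : {A : Set} → Poly A → Poly A
negP []            = []
negP ((c , e) ∷ p) = (- c , e) ∷ negP p

module _ {A : Set} where
  ⟪⟫-cong : ∀ (p : Poly A) {g h : A → ℤ} → (∀ e → g e ≡ h e) → ⟪ p ⟫ g ≡ ⟪ p ⟫ h
  ⟪⟫-cong []            eq = refl
  ⟪⟫-cong ((c , e) ∷ p) eq = cong₂ _+_ (cong (c *_) (eq e)) (⟪⟫-cong p eq)

  ⟪⟫-++ : ∀ (p q : Poly A) g → ⟪ p ++ q ⟫ g ≡ ⟪ p ⟫ g + ⟪ q ⟫ g
  ⟪⟫-++ []            q g = sym (ℤₚ.+-identityˡ _)
  ⟪⟫-++ ((c , e) ∷ p) q g = trans (cong+ˡ (c * g e) (⟪⟫-++ p q g)) (sym (ℤₚ.+-assoc (c * g e) _ _))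

  ⟪⟫-neg : ∀ (p : Poly A) g → ⟪ negP p ⟫ g ≡ - ⟪ p ⟫ g
  ⟪⟫-neg []            g = refl
  ⟪⟫-neg ((c , e) ∷ p) g = trans (cong+ˡ (- c * g e) (⟪⟫-neg p g)) (lem c (g e) (⟪ p ⟫ g))
    where
    lem : ∀ c x y → - c * x + - y ≡ - (c * x + y)
    lem = solve-∀

  ⟪⟫-+ : ∀ (p : Poly A) g h → ⟪ p ⟫ (λ e → g e + h e) ≡ ⟪ p ⟫ g + ⟪ p ⟫ h
  ⟪⟫-+ []            g h = refl
  ⟪⟫-+ ((c , e) ∷ p) g h = trans (cong+ˡ (c * (g e + h e)) (⟪⟫-+ p g h)) (lem c (g e) (h e) _ _)
    where
    lem : ∀ c x y a b → c * (x + y) + (a + b) ≡ c * x + a + (c * y + b)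
    lem = solve-∀

  ⟪⟫-* : ∀ (p : Poly A) c g → ⟪ p ⟫ (λ e → c * g e) ≡ c * ⟪ p ⟫ g
  ⟪⟫-* []            c g = sym (ℤₚ.*-zeroʳ c)
  ⟪⟫-* ((d , e) ∷ p) c g = trans (cong+ˡ (d * (c * g e)) (⟪⟫-* p c g)) (lem c d (g e) _)
    where
    lem : ∀ c d x y → d * (c * x) + c * y ≡ c * (d * x + y)
    lem = solve-∀

  ⟪⟫-- : ∀ (p : Poly A) g h → ⟪ p ⟫ (λ e → g e - h e) ≡ ⟪ p ⟫ g - ⟪ p ⟫ h
  ⟪⟫-- p g h = trans (⟪⟫-+ p g (λ e → - h e)) (cong+ˡ (⟪ p ⟫ g)
    (trans (⟪⟫-cong p (λ e → sym (ℤₚ.-1*i≡-i (h e)))) (trans (⟪⟫-* p (- + 1) h) (ℤₚ.-1*i≡-i _))))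

  ⟪⟫-0 : ∀ (p : Poly A) → ⟪ p ⟫ (λ _ → + 0) ≡ + 0
  ⟪⟫-0 []            = refl
  ⟪⟫-0 ((c , e) ∷ p) = cong₂ _+_ (ℤₚ.*-zeroʳ c) (⟪⟫-0 p)

  ⟪⟫-mapP : ∀ {B : Set} (h : B → A) (p : Poly B) g → ⟪ mapP h p ⟫ g ≡ ⟪ p ⟫ (λ e → g (h e))
  ⟪⟫-mapP h []            g = refl
  ⟪⟫-mapP h ((c , e) ∷ p) g = cong+ˡ (c * g (h e)) (⟪⟫-mapP h p g)

⟪⟫-fubini : ∀ {A B : Set} (p : Poly A) (q : Poly B) (g : A → B → ℤ) →
  ⟪ p ⟫ (λ e → ⟪ q ⟫ (λ f → g e f)) ≡ ⟪ q ⟫ (λ f → ⟪ p ⟫ (λ e → g e f))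
⟪⟫-fubini []            q g = sym (⟪⟫-0 q)
⟪⟫-fubini ((c , e) ∷ p) q g = sym (trans (⟪⟫-+ q _ _) (cong₂ _+_ (⟪⟫-* q c _) (sym (⟪⟫-fubini p q g))))

record Exponents : Set₁ where
  infixl 6 _∙_
  field
    A     : Set
    _∙_   : A → A → A
    ε     : A
    assoc : ∀ a b c → (a ∙ b) ∙ c ≡ a ∙ (b ∙ c)
    comm  : ∀ a b → a ∙ b ≡ b ∙ a
    idˡ   : ∀ a → ε ∙ a ≡ a

  idʳ : ∀ a → a ∙ ε ≡ a
  idʳ a = trans (comm a ε) (idˡ a)

module Mul (X : Exponents) where
  open Exponents X

  scaleP : ℤ → A → Poly A → Poly A
  scaleP c e []            = []
  scaleP c e ((d , f) ∷ q) = (c * d , e ∙ f) ∷ scaleP c e q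

  infixl 7 _·_
  _·_ : Poly A → Poly A → Poly A
  []            · q = []
  ((c , e) ∷ p) · q = scaleP c e q ++ (p · q)

  mono : ℤ → A → Poly A
  mono c e = (c , e) ∷ []

  one : Poly A
  one = mono (+ 1) ε

  ⟪⟫-scale : ∀ c e q g → ⟪ scaleP c e q ⟫ g ≡ c * ⟪ q ⟫ (λ f → g (e ∙ f))
  ⟪⟫-scale c e []            g = sym (ℤₚ.*-zeroʳ c)
  ⟪⟫-scale c e ((d , f) ∷ q) g = trans (cong+ˡ (c * d * g (e ∙ f)) (⟪⟫-scale c e q g)) (lem c d (g (e ∙ f)) _)
    where
    lem : ∀ c d x y → c * d * x + c * y ≡ c * (d * x + y)
    lem = solve-∀

  ⟪⟫-· : ∀ p q g → ⟪ p · q ⟫ g ≡ ⟪ p ⟫ (λ e → ⟪ q ⟫ (λ f → g (e ∙ f)))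
  ⟪⟫-· []            q g = refl
  ⟪⟫-· ((c , e) ∷ p) q g = trans (⟪⟫-++ (scaleP c e q) (p · q) g) (cong₂ _+_ (⟪⟫-scale c e q g) (⟪⟫-· p q g))

  ⟪⟫-mono : ∀ e g → ⟪ mono (+ 1) e ⟫ g ≡ g e
  ⟪⟫-mono e g = trans (ℤₚ.+-identityʳ _) (ℤₚ.*-identityˡ (g e))

  ⟪⟫-one : ∀ g → ⟪ one ⟫ g ≡ g ε
  ⟪⟫-one = ⟪⟫-mono ε

  ⟪⟫-mono· : ∀ e p g → ⟪ mono (+ 1) e · p ⟫ g ≡ ⟪ p ⟫ (λ f → g (e ∙ f))
  ⟪⟫-mono· e p g = trans (⟪⟫-· (mono (+ 1) e) p g) (⟪⟫-mono e (λ e → ⟪ p ⟫ (λ f → g (e ∙ f))))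

  -- Laurent polynomials identified when they act equally on a shift-closed family γ of functions on exponents.
  module Quotient {Idx : Set} (γ : Idx → A → ℤ) (shift : Idx → A → Idx)
    (γ-shift : ∀ i d e → γ i (d ∙ e) ≡ γ (shift i d) e) where

    infix 4 _≈_
    record _≈_ (p q : Poly A) : Set where
      constructor mk
      field at : ∀ i → ⟪ p ⟫ (γ i) ≡ ⟪ q ⟫ (γ i)
    open _≈_ public

    private
      ·-comm : ∀ p q → p · q ≈ q · p
      ·-comm p q = mk λ i → trans (⟪⟫-· p q _) (trans (⟪⟫-fubini p q _)
        (trans (⟪⟫-cong q (λ f → ⟪⟫-cong p (λ e → cong (γ i) (comm e f)))) (sym (⟪⟫-· q p _))))

      ·-congˡ : ∀ p {q q′} → q ≈ q′ → p · q ≈ p · q′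
      ·-congˡ p {q} {q′} h = mk λ i → trans (⟪⟫-· p q _) (trans (⟪⟫-cong p (λ e →
        trans (⟪⟫-cong q (γ-shift i e)) (trans (at h (shift i e)) (sym (⟪⟫-cong q′ (γ-shift i e)))))) (sym (⟪⟫-· p q′ _)))

      tr : ∀ {p q r} → p ≈ q → q ≈ r → p ≈ r
      tr a b = mk λ i → trans (at a i) (at b i)

      sy : ∀ {p q} → p ≈ q → q ≈ p
      sy a = mk λ i → sym (at a i)

      ++-comm : ∀ p q → p ++ q ≈ q ++ p
      ++-comm p q = mk λ i → trans (⟪⟫-++ p q _) (trans (ℤₚ.+-comm (⟪ p ⟫ _) _) (sym (⟪⟫-++ q p _)))

      one-· : ∀ p → one · p ≈ p
      one-· p = mk λ i → trans (⟪⟫-mono· ε p _) (⟪⟫-cong p (λ e → cong (γ i) (idˡ e)))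

      ·-distrib : ∀ p q r → p · (q ++ r) ≈ p · q ++ p · r
      ·-distrib p q r = mk λ i → trans (⟪⟫-· p (q ++ r) _) (trans (⟪⟫-cong p (λ e → ⟪⟫-++ q r _))
        (trans (⟪⟫-+ p _ _) (trans (sym (cong₂ _+_ (⟪⟫-· p q _) (⟪⟫-· p r _))) (sym (⟪⟫-++ (p · q) (p · r) _)))))

    ring : CommutativeRing 0ℓ 0ℓ
    ring = record
      { Carrier = Poly A ; _≈_ = _≈_ ; _+_ = _++_ ; _*_ = _·_ ; -_ = negP ; 0# = [] ; 1# = one
      ; isCommutativeRing = record
        { isRing = record
          { +-isAbelianGroup = record
            { isGroup = record
              { isMonoid = record
                { isSemigroup = record
                  { isMagma = record
                    { isEquivalence = record { refl = mk λ _ → refl ; sym = sy ; trans = tr }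
                    ; ∙-cong = λ {p} {p′} {q} {q′} a b → mk λ i →
                        trans (⟪⟫-++ p q _) (trans (cong₂ _+_ (at a i) (at b i)) (sym (⟪⟫-++ p′ q′ _)))
                    }
                  ; assoc = λ p q r → mk λ i → cong (λ s → ⟪ s ⟫ (γ i)) (Lₚ.++-assoc p q r)
                  }
                ; identity = (λ p → mk λ _ → refl) , (λ p → ++-comm p [])
                }
              ; inverse = (λ p → mk λ i → trans (⟪⟫-++ (negP p) p _) (trans (cong+ʳ (⟪ p ⟫ (γ i)) (⟪⟫-neg p _)) (ℤₚ.+-inverseˡ (⟪ p ⟫ (γ i)))))
                        , (λ p → mk λ i → trans (⟪⟫-++ p (negP p) _) (trans (cong+ˡ (⟪ p ⟫ (γ i)) (⟪⟫-neg p _)) (ℤₚ.+-inverseʳ (⟪ p ⟫ (γ i)))))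
              ; ⁻¹-cong = λ {p} {q} a → mk λ i → trans (⟪⟫-neg p _) (trans (cong -_ (at a i)) (sym (⟪⟫-neg q _)))
              }
            ; comm = ++-comm
            }
          ; *-cong = λ {p} {p′} {q} {q′} a b → tr (·-congˡ p b) (tr (·-comm p q′) (tr (·-congˡ q′ a) (·-comm q′ p′)))
          ; *-assoc = λ p q r → mk λ i → trans (⟪⟫-· (p · q) r _) (trans (⟪⟫-· p q _)
              (sym (trans (⟪⟫-· p (q · r) _) (⟪⟫-cong p (λ e → trans (⟪⟫-· q r _)
                (⟪⟫-cong q (λ f → ⟪⟫-cong r (λ h → cong (γ i) (sym (assoc e f h))))))))))
          ; *-identity = one-· , (λ p → tr (·-comm p one) (one-· p))
          ; distrib = ·-distrib , (λ p q r → tr (·-comm (q ++ r) p) (tr (·-distrib p q r)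
              (mk λ i → trans (⟪⟫-++ (p · q) (p · r) _) (trans (cong₂ _+_ (at (·-comm p q) i) (at (·-comm p r) i)) (sym (⟪⟫-++ (q · p) (r · p) _))))))
          }
        ; *-comm = ·-comm
        }
      }

  -- Testing against all functions gives the monoid ring itself. Testing against the translates of
  -- one γ gives its quotient by the annihilator of γ, where facts true only after application to γ
  -- become equations.
  module Free = Quotient {A → ℤ} (λ g → g) (λ g d e → g (d ∙ e)) (λ _ _ _ → refl)
  module Annihilator (γ : A → ℤ) = Quotient {A} (λ d e → γ (d ∙ e)) _∙_ (λ i d e → cong γ (sym (assoc i d e)))

module MapP (X Y : Exponents) (h : Exponents.A X → Exponents.A Y)
  (h-∙ : ∀ a b → h (Exponents._∙_ X a b) ≡ Exponents._∙_ Y (h a) (h b))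
  (h-ε : h (Exponents.ε X) ≡ Exponents.ε Y) where
  private
    module X = Mul X
    module Y = Mul Y
  open Y.Free

  mapP-+ : ∀ p q → mapP h (p ++ q) ≈ mapP h p ++ mapP h q
  mapP-+ p q = mk λ g → trans (⟪⟫-mapP h (p ++ q) g) (trans (⟪⟫-++ p q _)
    (trans (sym (cong₂ _+_ (⟪⟫-mapP h p g) (⟪⟫-mapP h q g))) (sym (⟪⟫-++ (mapP h p) (mapP h q) g))))

  mapP-· : ∀ p q → mapP h (p X.· q) ≈ mapP h p Y.· mapP h q
  mapP-· p q = mk λ g → trans (⟪⟫-mapP h (p X.· q) g) (trans (X.⟪⟫-· p q _)
    (sym (trans (Y.⟪⟫-· (mapP h p) (mapP h q) g) (trans (⟪⟫-mapP h p _) (⟪⟫-cong p (λ e →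
      trans (⟪⟫-mapP h q _) (⟪⟫-cong q (λ f → cong g (sym (h-∙ e f))))))))))

  mapP-neg : ∀ p → mapP h (negP p) ≈ negP (mapP h p)
  mapP-neg p = mk λ g → trans (⟪⟫-mapP h (negP p) g) (trans (⟪⟫-neg p _)
    (trans (cong -_ (sym (⟪⟫-mapP h p g))) (sym (⟪⟫-neg (mapP h p) g))))

  mapP-one : mapP h X.one ≈ Y.one
  mapP-one = mk λ g → cong (λ e → + 1 * g e + + 0) h-ε

  open Hom {_+_ = _++_} {X._·_} {negP} {[]} {X.one} Y.Free.ring (mapP h) mapP-+ mapP-· mapP-neg mapP-one public

-- Binomial coefficients and difference operators

-- The polynomial binom(x, j) at all integers; below 0 Pascal's rule is run backwards from binom(0,
-- j + 1) = 0.
bin : ℕ → ℤ → ℤ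
bin zero    _            = + 1
bin (suc j) (+ zero)     = + 0
bin (suc j) (+ suc n)    = bin (suc j) (+ n) + bin j (+ n)
bin (suc j) -[1+ zero ]  = - bin j -[1+ zero ]
bin (suc j) -[1+ suc n ] = bin (suc j) -[1+ n ] - bin j -[1+ suc n ]

bin-suc : ∀ j x → bin (suc j) (x + + 1) ≡ bin (suc j) x + bin j x
bin-suc j (+ n) rewrite ℕₚ.+-comm n 1 = refl
bin-suc j -[1+ zero ]  = sym (ℤₚ.+-inverseˡ (bin j -[1+ zero ]))
bin-suc j -[1+ suc n ] = lem (bin (suc j) -[1+ n ]) (bin j -[1+ suc n ])
  where
  lem : ∀ a b → a ≡ a - b + b
  lem = solve-∀

Δ : (ℤ → ℤ) → ℤ → ℤ
Δ f x = f (x + + 1) - f x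

Δ-bin : ∀ j x → Δ (bin (suc j)) x ≡ bin j x
Δ-bin j x = trans (cong (_- bin (suc j) x) (bin-suc j x)) (lem (bin (suc j) x) (bin j x))
  where
  lem : ∀ a b → a + b - a ≡ b
  lem = solve-∀

infixl 6 _⊞_
_⊞_ : ∀ {k} → Vec ℤ k → Vec ℤ k → Vec ℤ k
_⊞_ = zipWith _+_

0v : ∀ {k} → Vec ℤ k
0v = replicate _ (+ 0)

ℤ^_ : ℕ → Exponents
ℤ^ k = record
  { A = Vec ℤ k ; _∙_ = _⊞_ ; ε = 0v
  ; assoc = Vₚ.zipWith-assoc ℤₚ.+-assoc ; comm = Vₚ.zipWith-comm ℤₚ.+-comm ; idˡ = Vₚ.zipWith-identityˡ ℤₚ.+-identityˡ }

unit : ∀ {k} → ℕ → Vec ℤ k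
unit {zero}  i       = []
unit {suc k} zero    = + 1 ∷ 0v
unit {suc k} (suc i) = + 0 ∷ unit i

zvar : ∀ {k} → ℕ → Poly (Vec ℤ k)
zvar i = (+ 1 , unit i) ∷ (- + 1 , 0v) ∷ []

lift : ∀ {k} → Poly (Vec ℤ k) → Poly (Vec ℤ (suc k))
lift = mapP (+ 0 ∷_)

zs : ∀ k → List (Poly (Vec ℤ k))
zs zero    = []
zs (suc k) = zvar 0 ∷ map lift (zs k)

length-zs : ∀ k → length (zs k) ≡ k
length-zs zero    = refl
length-zs (suc k) = cong suc (trans (Lₚ.length-map lift (zs k)) (length-zs k))

bs : ∀ {k} → ℕ → Vec ℤ k → ℤ
bs N []      = + 1
bs N (x ∷ v) = bin N x * bs N v

-- A monomial acts on functions of integer vectors as the shift by its exponent vector, so zvar i is a forward difference.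
module Op (k : ℕ) where
  open Mul (ℤ^ k) public
  open Ops {Poly (Vec ℤ k)} _++_ _·_ negP [] one public

VWz : ∀ k → Poly (Vec ℤ k)
VWz k = Op.VW k (zs k)

nth-zs : ∀ k i → i ℕ.< k → Op.nth k (zs k) i ≡ zvar i
nth-zs (suc k) zero    _         = refl
nth-zs (suc k) (suc i) (ℕ.s≤s p) = trans (nth-map (zs k) i) (cong lift (nth-zs k i p))
  where
  nth-map : ∀ xs i → Op.nth (suc k) (map lift xs) i ≡ lift (Op.nth k xs i)
  nth-map []       i       = refl
  nth-map (x ∷ xs) zero    = refl
  nth-map (x ∷ xs) (suc i) = nth-map xs i

⟪zvar⟫ : ∀ {k} i g → ⟪ zvar {k} i ⟫ g ≡ g (unit i) - g 0v
⟪zvar⟫ i g = lem (g (unit i)) (g 0v)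
  where
  lem : ∀ a b → + 1 * a + (- + 1 * b + + 0) ≡ a - b
  lem = solve-∀

-- `bs` with the factor at place i released from `bin N`: differences in coordinate i act on this
-- factor only.
bsAt : ∀ {k} → ℕ → (ℤ → ℤ) → ℕ → Vec ℤ k → ℤ
bsAt i       g N []      = + 1
bsAt zero    g N (x ∷ v) = g x * bs N v
bsAt (suc i) g N (x ∷ v) = bin N x * bsAt i g N v

bsAt-cong : ∀ {k} i N {g h : ℤ → ℤ} → (∀ x → g x ≡ h x) → (v : Vec ℤ k) → bsAt i g N v ≡ bsAt i h N v
bsAt-cong i       N eq []      = refl
bsAt-cong zero    N eq (x ∷ v) = cong (_* bs N v) (eq x)
bsAt-cong (suc i) N eq (x ∷ v) = cong (bin N x *_) (bsAt-cong i N eq v)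

bsAt-bin : ∀ {k} i N (v : Vec ℤ k) → bsAt i (bin N) N v ≡ bs N v
bsAt-bin i       N []      = refl
bsAt-bin zero    N (x ∷ v) = refl
bsAt-bin (suc i) N (x ∷ v) = cong (bin N x *_) (bsAt-bin i N v)

bsAt-zero : ∀ {k} i N (v : Vec ℤ k) → i ℕ.< k → bsAt i (λ _ → + 0) N v ≡ + 0
bsAt-zero zero    N (x ∷ v) _         = ℤₚ.*-zeroˡ (bs N v)
bsAt-zero (suc i) N (x ∷ v) (ℕ.s≤s p) = trans (cong (bin N x *_) (bsAt-zero i N v p)) (ℤₚ.*-zeroʳ (bin N x))

⊞-0 : ∀ {k} (v : Vec ℤ k) → v ⊞ 0v ≡ v
⊞-0 = Vₚ.zipWith-identityʳ ℤₚ.+-identityʳ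

bsAt-Δ : ∀ {k} i N g (v : Vec ℤ k) → i ℕ.< k → bsAt i g N (v ⊞ unit i) - bsAt i g N v ≡ bsAt i (Δ g) N v
bsAt-Δ zero N g (x ∷ v) _ rewrite ⊞-0 v = lem (g (x + + 1)) (g x) (bs N v)
  where
  lem : ∀ a b c → a * c - b * c ≡ (a - b) * c
  lem = solve-∀
bsAt-Δ (suc i) N g (x ∷ v) (ℕ.s≤s p) rewrite ℤₚ.+-identityʳ x =
  trans (lem (bin N x) _ _) (cong (bin N x *_) (bsAt-Δ i N g v p))
  where
  lem : ∀ a b c → a * b - a * c ≡ a * (b - c)
  lem = solve-∀

Δ^ : ℕ → (ℤ → ℤ) → ℤ → ℤ
Δ^ zero    f = f
Δ^ (suc j) f = Δ^ j (Δ f)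

Δ^-cong : ∀ j {f g : ℤ → ℤ} → (∀ x → f x ≡ g x) → ∀ x → Δ^ j f x ≡ Δ^ j g x
Δ^-cong zero    eq = eq
Δ^-cong (suc j) eq = Δ^-cong j (λ x → cong₂ _-_ (eq (x + + 1)) (eq x))

Δ^-bin : ∀ N x → Δ^ N (bin N) x ≡ + 1
Δ^-bin zero    x = refl
Δ^-bin (suc N) x = trans (Δ^-cong N (Δ-bin N) x) (Δ^-bin N x)

Δ^-bin-zero : ∀ N x → Δ^ (suc N) (bin N) x ≡ + 0
Δ^-bin-zero zero    x = refl
Δ^-bin-zero (suc N) x = trans (Δ^-cong (suc N) (Δ-bin N) x) (Δ^-bin-zero N x)

module _ {k : ℕ} where
  open Op k
  open Exponents (ℤ^ k) using (assoc; comm; idˡ)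

  ⟪zvar·⟫ : ∀ i p g → ⟪ zvar i · p ⟫ g ≡ ⟪ p ⟫ (λ f → g (unit i ⊞ f) - g f)
  ⟪zvar·⟫ i p g = trans (⟪⟫-· (zvar i) p g) (trans (⟪zvar⟫ i (λ e → ⟪ p ⟫ (λ f → g (e ⊞ f)))) (trans (sym (⟪⟫-- p (λ f → g (unit i ⊞ f)) (λ f → g (0v ⊞ f))))
    (⟪⟫-cong p (λ f → cong (λ t → g (unit i ⊞ f) - g t) (idˡ f)))))

  ⟪zvar^·⟫-bsAt : ∀ i → i ℕ.< k → ∀ N j p g d →
    ⟪ (zvar i ^ j) · p ⟫ (λ e → bsAt i g N (d ⊞ e)) ≡ ⟪ p ⟫ (λ e → bsAt i (Δ^ j g) N (d ⊞ e))
  ⟪zvar^·⟫-bsAt i i<k N zero    p g d = trans (⟪⟫-mono· 0v p _) (⟪⟫-cong p (λ f → cong (λ t → bsAt i g N (d ⊞ t)) (idˡ f)))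
  ⟪zvar^·⟫-bsAt i i<k N (suc j) p g d = begin
    ⟪ (zvar i · (zvar i ^ j)) · p ⟫ G              ≡⟨ ⟪⟫-· (zvar i · (zvar i ^ j)) p G ⟩
    ⟪ zvar i · (zvar i ^ j) ⟫ (λ e → ⟪ p ⟫ (λ f → G (e ⊞ f)))  ≡⟨ ⟪zvar·⟫ i (zvar i ^ j) _ ⟩
    ⟪ zvar i ^ j ⟫ (λ e → ⟪ p ⟫ (λ f → G (unit i ⊞ e ⊞ f)) - ⟪ p ⟫ (λ f → G (e ⊞ f)))
      ≡⟨ ⟪⟫-cong (zvar i ^ j) (λ e → trans (sym (⟪⟫-- p _ _)) (⟪⟫-cong p (λ f → pt e f))) ⟩
    ⟪ zvar i ^ j ⟫ (λ e → ⟪ p ⟫ (λ f → bsAt i (Δ g) N (d ⊞ (e ⊞ f)))) ≡⟨ ⟪⟫-· (zvar i ^ j) p _ ⟨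
    ⟪ (zvar i ^ j) · p ⟫ (λ e → bsAt i (Δ g) N (d ⊞ e))  ≡⟨ ⟪zvar^·⟫-bsAt i i<k N j p (Δ g) d ⟩
    ⟪ p ⟫ (λ e → bsAt i (Δ^ j (Δ g)) N (d ⊞ e)) ∎
    where
    open ≡-Reasoning
    G : Vec ℤ k → ℤ
    G e = bsAt i g N (d ⊞ e)
    pt : ∀ e f → G (unit i ⊞ e ⊞ f) - G (e ⊞ f) ≡ bsAt i (Δ g) N (d ⊞ (e ⊞ f))
    pt e f = trans (cong (λ t → bsAt i g N t - G (e ⊞ f)) (begin
        d ⊞ (unit i ⊞ e ⊞ f)   ≡⟨ cong (d ⊞_) (trans (assoc (unit i) e f) (comm (unit i) (e ⊞ f))) ⟩
        d ⊞ (e ⊞ f ⊞ unit i)   ≡⟨ assoc d (e ⊞ f) (unit i) ⟨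
        d ⊞ (e ⊞ f) ⊞ unit i   ∎))
      (bsAt-Δ i N g (d ⊞ (e ⊞ f)) i<k)

  ⟪zvar^·⟫ : ∀ i → i ℕ.< k → ∀ N j p d →
    ⟪ (zvar i ^ j) · p ⟫ (λ e → bs N (d ⊞ e)) ≡ ⟪ p ⟫ (λ e → bsAt i (Δ^ j (bin N)) N (d ⊞ e))
  ⟪zvar^·⟫ i i<k N j p d = trans (⟪⟫-cong ((zvar i ^ j) · p) (λ e → sym (bsAt-bin i N (d ⊞ e))))
    (⟪zvar^·⟫-bsAt i i<k N j p (bin N) d)

module BinomialQuotient (N k : ℕ) where
  open Op k public
  open Annihilator (bs {k} N) public
  open Vandermonde ring public using (alt-cong; VW-rotate; VW-laplace)

  -- N + 1 differences kill a polynomial of degree N. For k = N + 1 variables this is exactly the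
  -- nilpotency that `VW-rotate` and `VW-laplace` ask for.
  nilpotent : ∀ i → i ℕ.< k → nth (zs k) i ^ suc N ≈ []
  nilpotent i i<k rewrite nth-zs k i i<k = mk λ d →
    trans (sym (at (CommutativeRing.*-identityʳ ring (zvar i ^ suc N)) d))
    (trans (⟪zvar^·⟫ i i<k N (suc N) one d)
    (trans (⟪⟫-cong one (λ e → trans (bsAt-cong i N (Δ^-bin-zero N) (d ⊞ e)) (bsAt-zero i N (d ⊞ e) i<k))) (⟪⟫-0 one)))

-- The operator formula for monotone triangles

toVec : ∀ k → List ℤ → Maybe (Vec ℤ k)
toVec zero    []       = just []
toVec zero    (x ∷ xs) = nothing
toVec (suc k) []       = nothing
toVec (suc k) (x ∷ xs) = Maybe.map (x ∷_) (toVec k xs)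

toVec-toList : ∀ {k} (v : Vec ℤ k) → toVec k (toList v) ≡ just v
toVec-toList []      = refl
toVec-toList (x ∷ v) = cong (Maybe.map (x ∷_)) (toVec-toList v)

vecView : ∀ k xs → (∃ λ (v : Vec ℤ k) → xs ≡ toList v) ⊎ (length xs ≢ k)
vecView zero    []       = inj₁ ([] , refl)
vecView zero    (x ∷ xs) = inj₂ λ ()
vecView (suc k) []       = inj₂ λ ()
vecView (suc k) (x ∷ xs) with vecView k xs
... | inj₁ (v , eq) = inj₁ (x ∷ v , cong (x ∷_) eq)
... | inj₂ ne       = inj₂ (λ eq → ne (ℕₚ.suc-injective eq))

toVec-≢ : ∀ k xs → length xs ≢ k → toVec k xs ≡ nothing
toVec-≢ zero    []       ne = ⊥-elim (ne refl)
toVec-≢ zero    (x ∷ xs) ne = refl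
toVec-≢ (suc k) []       ne = refl
toVec-≢ (suc k) (x ∷ xs) ne = cong (Maybe.map (x ∷_)) (toVec-≢ k xs (λ eq → ne (cong suc eq)))

-- For N = k - 1 this is Fischer's operator formula, since V(Δ) turns the product of binomials into
-- the product of (v_j - v_i)/(j - i) over i < j. N is a separate parameter because a Laplace
-- expansion removes a variable without lowering the degree.
trianglesV : ℕ → (k : ℕ) → Vec ℤ k → ℤ
trianglesV N k v = ⟪ VWz k ⟫ (λ e → bs N (v ⊞ e))

-- triangles (k ∸ 1) k counts the monotone triangles with a given bottom row of length k; junk value 0 on lists of other lengths.
triangles : ℕ → ℕ → List ℤ → ℤ
triangles N k xs = maybe′ (trianglesV N k) (+ 0) (toVec k xs)

triangles-toList : ∀ N {k} (v : Vec ℤ k) → triangles N k (toList v) ≡ trianglesV N k v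
triangles-toList N {k} v = cong (maybe′ (trianglesV N k) (+ 0)) (toVec-toList v)

triangles-≢ : ∀ N k xs → length xs ≢ k → triangles N k xs ≡ + 0
triangles-≢ N k xs ne = cong (maybe′ (trianglesV N k) (+ 0)) (toVec-≢ k xs ne)

open Ops {ℤ} _+_ _*_ -_ (+ 0) (+ 1) using () renaming (alt to altℤ)
open Vandermonde ℤₚ.+-*-commutativeRing using () renaming (alt-cong to altℤ-cong)

-- Laplace expansion of the operator formula

mapP-∘ : ∀ {A B C : Set} (f : B → C) (g : A → B) p → mapP f (mapP g p) ≡ mapP (f ∘ g) p
mapP-∘ f g []            = refl
mapP-∘ f g ((c , e) ∷ p) = cong ((c , f (g e)) ∷_) (mapP-∘ f g p)

mapP-lift : ∀ {j k} (f : Vec ℤ j → Vec ℤ k) (g : Vec ℤ (suc j) → Vec ℤ (suc k)) →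
  (∀ e → g (+ 0 ∷ e) ≡ + 0 ∷ f e) → ∀ ps → map (mapP g) (map lift ps) ≡ map lift (map (mapP f) ps)
mapP-lift f g eq []       = refl
mapP-lift f g eq (p ∷ ps) = cong₂ _∷_ (go p) (mapP-lift f g eq ps)
  where
  go : ∀ p → mapP g (lift p) ≡ lift (mapP f p)
  go []            = refl
  go ((c , e) ∷ p) = cong₂ _∷_ (cong (c ,_) (eq e)) (go p)

inc1 : ℤ → ℤ
inc1 x = x + + 1

ones : ∀ {k} → Vec ℤ k
ones = replicate _ (+ 1)

-- The alternating sum over the entry to be deleted, all later entries moving up by one. The
-- recursion on the list is made to match the one on column states.
laplace : (List ℤ → ℤ) → List ℤ → ℤ
laplace g []       = + 0
laplace g (x ∷ xs) = g (map inc1 xs) - laplace (λ ls → g (x ∷ ls)) xs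

delShift : ℕ → List ℤ → List ℤ
delShift _       []       = []
delShift zero    (x ∷ xs) = map inc1 xs
delShift (suc i) (x ∷ xs) = x ∷ delShift i xs

laplace-alt : ∀ g xs → laplace g xs ≡ altℤ (length xs) (λ i → g (delShift i xs))
laplace-alt g []       = refl
laplace-alt g (x ∷ xs) = cong (λ t → g (map inc1 xs) - t) (laplace-alt (λ ls → g (x ∷ ls)) xs)

⟪alt⟫ : ∀ {k} n f g → ⟪ Op.alt k n f ⟫ g ≡ altℤ n (λ i → ⟪ f i ⟫ g)
⟪alt⟫ zero    f g = refl
⟪alt⟫ {k} (suc n) f g = trans (⟪⟫-++ (f 0) _ g) (cong+ˡ (⟪ f 0 ⟫ g)
  (trans (⟪⟫-neg (Op.alt k n (λ i → f (suc i))) g) (cong -_ (⟪alt⟫ n (λ i → f (suc i)) g))))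

delV : ∀ {k} → ℕ → Vec ℤ (suc k) → Vec ℤ k
delV         zero    (x ∷ v) = v
delV {zero}  (suc i) v       = []
delV {suc k} (suc i) (x ∷ v) = x ∷ delV i v

delShiftV : ∀ {k} → ℕ → Vec ℤ (suc k) → Vec ℤ k
delShiftV         zero    (x ∷ v) = V.map inc1 v
delShiftV {zero}  (suc i) v       = []
delShiftV {suc k} (suc i) (x ∷ v) = x ∷ delShiftV i v

insV : ∀ {k} → ℕ → Vec ℤ k → Vec ℤ (suc k)
insV zero    v       = + 0 ∷ v
insV (suc i) []      = + 0 ∷ []
insV (suc i) (x ∷ v) = x ∷ insV i v

tailOnes : ∀ {k} → ℕ → Vec ℤ (suc k)
tailOnes         zero    = + 0 ∷ ones
tailOnes {zero}  (suc i) = + 0 ∷ []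
tailOnes {suc k} (suc i) = + 0 ∷ tailOnes i

bsAt-one : ∀ {k} i N (v : Vec ℤ (suc k)) → i ℕ.< suc k → bsAt i (λ _ → + 1) N v ≡ bs N (delV i v)
bsAt-one         zero    N (x ∷ v) _                 = ℤₚ.*-identityˡ (bs N v)
bsAt-one {zero}  (suc i) N (x ∷ v) (ℕ.s≤s ())
bsAt-one {suc k} (suc i) N (x ∷ v) (ℕ.s≤s p)         = cong (bin N x *_) (bsAt-one i N v p)

insV-⊞ : ∀ {k} i (a b : Vec ℤ k) → insV i (a ⊞ b) ≡ insV i a ⊞ insV i b
insV-⊞ zero    a       b       = refl
insV-⊞ (suc i) []      []      = refl
insV-⊞ (suc i) (x ∷ a) (y ∷ b) = cong (x + y ∷_) (insV-⊞ i a b)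

insV-0v : ∀ {k} i → insV {k} i 0v ≡ 0v
insV-0v         zero    = refl
insV-0v {zero}  (suc i) = refl
insV-0v {suc k} (suc i) = cong (+ 0 ∷_) (insV-0v i)

del-map : ∀ {A B : Set} (f : A → B) i xs → del i (map f xs) ≡ map f (del i xs)
del-map f i       []       = refl
del-map f zero    (x ∷ xs) = refl
del-map f (suc i) (x ∷ xs) = cong (f x ∷_) (del-map f i xs)

drop-map : ∀ {A B : Set} (f : A → B) i xs → drop i (map f xs) ≡ map f (drop i xs)
drop-map f zero    xs       = refl
drop-map f (suc i) []       = refl
drop-map f (suc i) (x ∷ xs) = drop-map f i xs

del-zs : ∀ k i → i ℕ.< suc k → del i (zs (suc k)) ≡ map (mapP (insV i)) (zs k)
del-zs k       zero    _         = refl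
del-zs zero    (suc i) (ℕ.s≤s ())
del-zs (suc k) (suc i) (ℕ.s≤s p) = cong₂ _∷_ hd
  (trans (del-map lift i (zs (suc k))) (trans (cong (map lift) (del-zs k i p)) (sym (mapP-lift (insV i) (insV (suc i)) (λ _ → refl) (zs k)))))
  where
  hd : zvar 0 ≡ mapP (insV (suc i)) (zvar 0)
  hd = cong₂ (λ a b → (+ 1 , + 1 ∷ a) ∷ (- + 1 , + 0 ∷ b) ∷ []) (sym (insV-0v i)) (sym (insV-0v i))

∏inc-lift : ∀ {k} ps g → ⟪ Op.∏ (suc k) (Op.inc (suc k)) (map lift ps) ⟫ g ≡ ⟪ Op.∏ k (Op.inc k) ps ⟫ (λ e → g (+ 0 ∷ e))
∏inc-lift {k} ps g = trans (sym (Mul.Free.at (h-∏ _ _ h-inc ps) g)) (⟪⟫-mapP (+ 0 ∷_) (Op.∏ k (Op.inc k) ps) g)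
  where open MapP (ℤ^ k) (ℤ^ suc k) (+ 0 ∷_) (λ _ _ → refl) refl

⟪inc-zvar⟫ : ∀ {k} i g → ⟪ Op.inc k (zvar i) ⟫ g ≡ g (unit i)
⟪inc-zvar⟫ i g = lem (g 0v) (g (unit i))
  where
  lem : ∀ a b → + 1 * a + (+ 1 * b + (- + 1 * a + + 0)) ≡ b
  lem = solve-∀

∏inc-zs : ∀ k g → ⟪ Op.∏ k (Op.inc k) (zs k) ⟫ g ≡ g ones
∏inc-zs zero    g = ⟪⟫-one g where open Mul (ℤ^ 0)
∏inc-zs (suc k) g = trans (⟪⟫-· (inc (zvar 0)) (∏ inc (map lift (zs k))) g)
  (trans (⟪inc-zvar⟫ 0 (λ e → ⟪ ∏ inc (map lift (zs k)) ⟫ (λ f → g (e ⊞ f))))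
  (trans (∏inc-lift (zs k) _) (trans (∏inc-zs k _) (cong (λ t → g (+ 1 ∷ t)) (Vₚ.zipWith-identityˡ ℤₚ.+-identityˡ ones)))))
  where open Op (suc k)

∏inc-drop : ∀ k i → i ℕ.< suc k → ∀ g → ⟪ Op.∏ (suc k) (Op.inc (suc k)) (drop (suc i) (zs (suc k))) ⟫ g ≡ g (tailOnes i)
∏inc-drop k       zero    _ g = trans (∏inc-lift (zs k) g) (∏inc-zs k _)
∏inc-drop zero    (suc i) (ℕ.s≤s ()) g
∏inc-drop (suc k) (suc i) (ℕ.s≤s p) g rewrite drop-map lift (suc i) (zs (suc k)) =
  trans (∏inc-lift (drop (suc i) (zs (suc k))) g) (∏inc-drop k i p _)

delV-shift : ∀ {k} i (v : Vec ℤ (suc k)) e → i ℕ.< suc k → delV i (v ⊞ (insV i e ⊞ tailOnes i)) ≡ delShiftV i v ⊞ e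
delV-shift         zero    (x ∷ v) e       _ = go v e
  where
  lem : ∀ x e → x + (e + + 1) ≡ x + + 1 + e
  lem = solve-∀
  go : ∀ {k} (v e : Vec ℤ k) → v ⊞ (e ⊞ ones) ≡ V.map inc1 v ⊞ e
  go []      []      = refl
  go (x ∷ v) (a ∷ e) = cong₂ _∷_ (lem x a) (go v e)
delV-shift {zero}  (suc i) v       e       (ℕ.s≤s ())
delV-shift {suc k} (suc i) (x ∷ v) (a ∷ e) (ℕ.s≤s p) = cong₂ _∷_ (cong (λ t → x + t) (ℤₚ.+-identityʳ a)) (delV-shift i v e p)

-- `VW-laplace` modulo the annihilator of `bs k`. Applied to it, z_i^k reduces the i-th binomial to
-- 1 and so removes that coordinate, while the factors 1 + z left over from W shift the later
-- coordinates.
trianglesV-laplace : ∀ k v → trianglesV k (suc k) v ≡ altℤ (suc k) (λ i → trianglesV k k (delShiftV i v))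
trianglesV-laplace k v = begin
  ⟪ VW Z ⟫ γ                                    ≡⟨ at (lap k len) v ⟩
  ⟪ alt (suc k) (term k) ⟫ γ                    ≡⟨ ⟪alt⟫ (suc k) (term k) γ ⟩
  altℤ (suc k) (λ i → ⟪ term k i ⟫ γ)           ≡⟨ altℤ-cong (suc k) step ⟩
  altℤ (suc k) (λ i → trianglesV k k (delShiftV i v))        ∎
  where
  open ≡-Reasoning
  open BinomialQuotient k (suc k)
  Z = zs (suc k)
  γ : Vec ℤ (suc k) → ℤ
  γ e = bs k (v ⊞ e)
  len : length (map lift (zs k)) ≡ k
  len = ℕₚ.suc-injective (length-zs (suc k))
  rest : ℕ → Poly (Vec ℤ (suc k))
  rest i = VW (del i Z) · ∏ inc (drop (suc i) Z)
  term : ℕ → ℕ → Poly (Vec ℤ (suc k))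
  term m i = (nth Z i ^ m) · rest i
  -- Generalised over m because the length of the list equals k only propositionally.
  lap : ∀ m → length (map lift (zs k)) ≡ m → VW Z ≈ alt (suc m) (term m)
  lap m refl = VW-laplace (zvar 0) (map lift (zs k)) (subst (λ m → ∀ i → i ℕ.< suc m → nth Z i ^ suc m ≈ []) (sym len) nilpotent)
  step : ∀ i → i ℕ.< suc k → ⟪ term k i ⟫ γ ≡ trianglesV k k (delShiftV i v)
  step i i<k = begin
    ⟪ (nth Z i ^ k) · rest i ⟫ γ
      ≡⟨ cong (λ z → ⟪ (z ^ k) · rest i ⟫ γ) (nth-zs (suc k) i i<k) ⟩
    ⟪ (zvar i ^ k) · rest i ⟫ γ
      ≡⟨ ⟪zvar^·⟫ i i<k k k (rest i) v ⟩
    ⟪ rest i ⟫ (λ e → bsAt i (Δ^ k (bin k)) k (v ⊞ e))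
      ≡⟨ ⟪⟫-cong (rest i) (λ e → trans (bsAt-cong i k (Δ^-bin k) (v ⊞ e)) (bsAt-one i k (v ⊞ e) i<k)) ⟩
    ⟪ rest i ⟫ (λ e → bs k (delV i (v ⊞ e)))
      ≡⟨ ⟪⟫-· (VW (del i Z)) (∏ inc (drop (suc i) Z)) _ ⟩
    ⟪ VW (del i Z) ⟫ (λ e → ⟪ ∏ inc (drop (suc i) Z) ⟫ (λ f → bs k (delV i (v ⊞ (e ⊞ f)))))
      ≡⟨ ⟪⟫-cong (VW (del i Z)) (λ e → ∏inc-drop k i i<k _) ⟩
    ⟪ VW (del i Z) ⟫ (λ e → bs k (delV i (v ⊞ (e ⊞ tailOnes i))))
      ≡⟨ cong (λ Y → ⟪ VW Y ⟫ (λ e → bs k (delV i (v ⊞ (e ⊞ tailOnes i))))) (del-zs k i i<k) ⟩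
    ⟪ VW (map (mapP (insV i)) (zs k)) ⟫ (λ e → bs k (delV i (v ⊞ (e ⊞ tailOnes i))))
      ≡⟨ Mul.Free.at (I.h-VW (zs k)) _ ⟨
    ⟪ mapP (insV i) (VWz k) ⟫ (λ e → bs k (delV i (v ⊞ (e ⊞ tailOnes i))))
      ≡⟨ ⟪⟫-mapP (insV i) (VWz k) _ ⟩
    ⟪ VWz k ⟫ (λ e → bs k (delV i (v ⊞ (insV i e ⊞ tailOnes i))))
      ≡⟨ ⟪⟫-cong (VWz k) (λ e → cong (bs k) (delV-shift i v e i<k)) ⟩
    trianglesV k k (delShiftV i v) ∎
    where
    module I = MapP (ℤ^ k) (ℤ^ suc k) (insV i) (insV-⊞ i) (insV-0v i)

delShift-length : ∀ i xs → i ℕ.< length xs → suc (length (delShift i xs)) ≡ length xs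
delShift-length zero    (x ∷ xs) _         = cong suc (Lₚ.length-map inc1 xs)
delShift-length (suc i) (x ∷ xs) (ℕ.s≤s p) = cong suc (delShift-length i xs p)

delShift-toList : ∀ {k} i (v : Vec ℤ (suc k)) → i ℕ.< suc k → delShift i (toList v) ≡ toList (delShiftV i v)
delShift-toList         zero    (x ∷ v) _ = sym (Vₚ.toList-map inc1 v)
delShift-toList {zero}  (suc i) v       (ℕ.s≤s ())
delShift-toList {suc k} (suc i) (x ∷ v) (ℕ.s≤s p) = cong (x ∷_) (delShift-toList i v p)

altℤ-zero : ∀ n {f} → (∀ i → i ℕ.< n → f i ≡ + 0) → altℤ n f ≡ + 0
altℤ-zero n h = trans (altℤ-cong n h) (z n)
  where
  z : ∀ n → altℤ n (λ _ → + 0) ≡ + 0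
  z zero    = refl
  z (suc n) rewrite z n = refl

triangles-laplace : ∀ k xs → triangles k (suc k) xs ≡ laplace (triangles k k) xs
triangles-laplace k xs with vecView (suc k) xs
... | inj₁ (v , refl) = begin
  triangles k (suc k) (toList v)                              ≡⟨ triangles-toList k v ⟩
  trianglesV k (suc k) v                                      ≡⟨ trianglesV-laplace k v ⟩
  altℤ (suc k) (λ i → trianglesV k k (delShiftV i v))               ≡⟨ altℤ-cong (suc k) (λ i p → trans (sym (triangles-toList k (delShiftV i v))) (cong (triangles k k) (sym (delShift-toList i v p)))) ⟩
  altℤ (suc k) (λ i → triangles k k (delShift i (toList v)))        ≡⟨ cong (λ m → altℤ m (λ i → triangles k k (delShift i (toList v)))) (sym (Vₚ.length-toList v)) ⟩
  altℤ (length (toList v)) (λ i → triangles k k (delShift i (toList v)))  ≡⟨ laplace-alt (triangles k k) (toList v) ⟨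
  laplace (triangles k k) (toList v) ∎
  where open ≡-Reasoning
... | inj₂ ne = trans (triangles-≢ k (suc k) xs ne) (sym (trans (laplace-alt (triangles k k) xs)
  (altℤ-zero (length xs) (λ i p → triangles-≢ k k (delShift i xs) (λ eq → ne (trans (sym (delShift-length i xs p)) (cong suc eq)))))))

-- Cancellation at equal neighbouring arguments

swV : ∀ {k} → ℕ → Vec ℤ k → Vec ℤ k
swV zero    []          = []
swV zero    (x ∷ [])    = x ∷ []
swV zero    (x ∷ y ∷ v) = y ∷ x ∷ v
swV (suc i) []          = []
swV (suc i) (x ∷ v)     = x ∷ swV i v

swV-⊞ : ∀ {k} i (a b : Vec ℤ k) → swV i (a ⊞ b) ≡ swV i a ⊞ swV i b
swV-⊞ zero    []          []            = refl
swV-⊞ zero    (x ∷ [])    (y ∷ [])      = refl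
swV-⊞ zero    (x ∷ _ ∷ a) (y ∷ _ ∷ b)   = refl
swV-⊞ (suc i) []          []            = refl
swV-⊞ (suc i) (x ∷ a)     (y ∷ b)       = cong (x + y ∷_) (swV-⊞ i a b)

swV-0v : ∀ {k} i → swV {k} i 0v ≡ 0v
swV-0v {zero}        zero    = refl
swV-0v {suc zero}    zero    = refl
swV-0v {suc (suc k)} zero    = refl
swV-0v {zero}        (suc i) = refl
swV-0v {suc k}       (suc i) = cong (+ 0 ∷_) (swV-0v i)

bs-swV : ∀ {k} N i (v : Vec ℤ k) → bs N (swV i v) ≡ bs N v
bs-swV N zero    []          = refl
bs-swV N zero    (x ∷ [])    = refl
bs-swV N zero    (x ∷ y ∷ v) = lem (bin N y) (bin N x) (bs N v)
  where
  lem : ∀ a b c → a * (b * c) ≡ b * (a * c)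
  lem = solve-∀
bs-swV N (suc i) []          = refl
bs-swV N (suc i) (x ∷ v)     = cong (bin N x *_) (bs-swV N i v)

swV-unit : ∀ {k} i → suc i ℕ.< k → swV {k} i (unit (suc i)) ≡ unit i
swV-unit {suc (suc k)} zero    _         = refl
swV-unit {suc k}       (suc i) (ℕ.s≤s p) = cong (+ 0 ∷_) (swV-unit i p)
swV-unit {suc zero}    zero    (ℕ.s≤s ())

swV-unit′ : ∀ {k} i → suc i ℕ.< k → swV {k} i (unit i) ≡ unit (suc i)
swV-unit′ {suc (suc k)} zero    _         = refl
swV-unit′ {suc k}       (suc i) (ℕ.s≤s p) = cong (+ 0 ∷_) (swV-unit′ i p)
swV-unit′ {suc zero}    zero    (ℕ.s≤s ())

swapAt-map : ∀ {A B : Set} (f : A → B) i xs → swapAt i (map f xs) ≡ map f (swapAt i xs)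
swapAt-map f zero    []           = refl
swapAt-map f zero    (x ∷ [])     = refl
swapAt-map f zero    (x ∷ y ∷ xs) = refl
swapAt-map f (suc i) []           = refl
swapAt-map f (suc i) (x ∷ xs)     = cong (f x ∷_) (swapAt-map f i xs)

map-swV-zs : ∀ k i → suc i ℕ.< k → map (mapP (swV i)) (zs k) ≡ swapAt i (zs k)
map-swV-zs (suc (suc k)) zero _ = cong₂ _∷_ refl (cong₂ _∷_ refl (go (zs k)))
  where
  go : ∀ ps → map (mapP (swV zero)) (map lift (map lift ps)) ≡ map lift (map lift ps)
  go []       = refl
  go (p ∷ ps) = cong₂ _∷_ (trans (cong (mapP (swV zero)) (mapP-∘ (+ 0 ∷_) (+ 0 ∷_) p))
    (trans (mapP-∘ (swV zero) (λ e → + 0 ∷ + 0 ∷ e) p) (sym (mapP-∘ (+ 0 ∷_) (+ 0 ∷_) p)))) (go ps)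
map-swV-zs (suc k) (suc i) (ℕ.s≤s p) = cong₂ _∷_
  (cong₂ (λ a b → (+ 1 , + 1 ∷ a) ∷ (- + 1 , + 0 ∷ b) ∷ []) (swV-0v i) (swV-0v i))
  (trans (mapP-lift (swV i) (swV (suc i)) (λ _ → refl) (zs k)) (trans (cong (map lift) (map-swV-zs k i p)) (sym (swapAt-map lift i (zs k)))))
map-swV-zs (suc zero) zero (ℕ.s≤s ())

x≡-x⇒x≡0 : ∀ x → x ≡ - x → x ≡ + 0
x≡-x⇒x≡0 (+ zero)  _ = refl
x≡-x⇒x≡0 (+ suc n) ()
x≡-x⇒x≡0 -[1+ n ]  ()

-- The three terms are the operator w z_{i+1} z_i = 1 - E_{i+1} + E_i E_{i+1}. By `VW-swapAt` its
-- product with VW is antisymmetric in the two places, so at a point fixed by the exchange the value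
-- equals its own negative.
trianglesV-cancels : ∀ N k i (v : Vec ℤ k) → suc i ℕ.< k → swV i v ≡ v →
  trianglesV N k v - trianglesV N k (v ⊞ unit (suc i)) + trianglesV N k (v ⊞ (unit (suc i) ⊞ unit i)) ≡ + 0
trianglesV-cancels N k i v p fixed = trans (sym expand) (x≡-x⇒x≡0 _ antisym)
  where
  open ≡-Reasoning
  open Op k
  open Exponents (ℤ^ k) using (assoc; idʳ)
  open Mul.Free (ℤ^ k)
  module F = CommutativeRing ring
  a b q : Poly (Vec ℤ k)
  a = zvar (suc i)
  b = zvar i
  q = w a b · VWz k
  γ : Vec ℤ k → ℤ
  γ e = bs N (v ⊞ e)
  module Sw = MapP (ℤ^ k) (ℤ^ k) (swV i) (swV-⊞ i) (swV-0v i)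
  swap-a : mapP (swV i) a ≡ b
  swap-a = cong₂ (λ s t → (+ 1 , s) ∷ (- + 1 , t) ∷ []) (swV-unit i p) (swV-0v i)
  swap-b : mapP (swV i) b ≡ a
  swap-b = cong₂ (λ s t → (+ 1 , s) ∷ (- + 1 , t) ∷ []) (swV-unit′ i p) (swV-0v i)
  swapped : w b a · VW (swapAt i (zs k)) ≈ mapP (swV i) q
  swapped = F.sym (F.trans (Sw.mapP-· (w a b) (VWz k)) (F.*-cong
    (F.trans (Sw.h-w a b) (F.reflexive (cong₂ w swap-a swap-b)))
    (F.trans (Sw.h-VW (zs k)) (F.reflexive (cong VW (map-swV-zs k i p))))))
  flip : q ≈ negP (mapP (swV i) q)
  flip = F.trans (subst₂ (λ a b → w a b · VWz k ≈ negP (w b a · VW (swapAt i (zs k))))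
      (nth-zs k (suc i) p) (nth-zs k i (ℕₚ.<-trans (ℕₚ.n<1+n i) p))
      (Vandermonde.VW-swapAt ring i (zs k) (subst (suc i ℕ.<_) (sym (length-zs k)) p)))
    (F.-‿cong swapped)
    where open ≡ using (subst₂)
  antisym : ⟪ q ⟫ γ ≡ - ⟪ q ⟫ γ
  antisym = begin
    ⟪ q ⟫ γ                                 ≡⟨ at flip γ ⟩
    ⟪ negP (mapP (swV i) q) ⟫ γ             ≡⟨ ⟪⟫-neg (mapP (swV i) q) γ ⟩
    - ⟪ mapP (swV i) q ⟫ γ                  ≡⟨ cong -_ (⟪⟫-mapP (swV i) q γ) ⟩
    - ⟪ q ⟫ (λ e → bs N (v ⊞ swV i e))      ≡⟨ cong -_ (⟪⟫-cong q (λ e → begin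
      bs N (v ⊞ swV i e)                      ≡⟨ cong (λ t → bs N (t ⊞ swV i e)) fixed ⟨
      bs N (swV i v ⊞ swV i e)                ≡⟨ cong (bs N) (swV-⊞ i v e) ⟨
      bs N (swV i (v ⊞ e))                    ≡⟨ bs-swV N i (v ⊞ e) ⟩
      bs N (v ⊞ e)                            ∎)) ⟩
    - ⟪ q ⟫ γ                               ∎
  ⟪w⟫ : ∀ g → ⟪ w a b ⟫ g ≡ g 0v - g (unit (suc i)) + g (unit (suc i) ⊞ unit i)
  ⟪w⟫ g = begin
    ⟪ (one ++ b) ++ a · b ⟫ g
      ≡⟨ ⟪⟫-++ (one ++ b) (a · b) g ⟩
    ⟪ one ++ b ⟫ g + ⟪ a · b ⟫ g
      ≡⟨ cong₂ _+_ (⟪inc-zvar⟫ i g) (trans (⟪zvar·⟫ (suc i) b g) (⟪zvar⟫ i (λ f → g (unit (suc i) ⊞ f) - g f))) ⟩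
    g (unit i) + (g (unit (suc i) ⊞ unit i) - g (unit i) - (g (unit (suc i) ⊞ 0v) - g 0v))
      ≡⟨ cong (λ t → g (unit i) + (g (unit (suc i) ⊞ unit i) - g (unit i) - (g t - g 0v))) (idʳ (unit (suc i))) ⟩
    g (unit i) + (g (unit (suc i) ⊞ unit i) - g (unit i) - (g (unit (suc i)) - g 0v))
      ≡⟨ lem (g (unit i)) (g (unit (suc i) ⊞ unit i)) (g (unit (suc i))) (g 0v) ⟩
    g 0v - g (unit (suc i)) + g (unit (suc i) ⊞ unit i) ∎
    where
    lem : ∀ x y z o → x + (y - x - (z - o)) ≡ o - z + y
    lem = solve-∀
  H : Vec ℤ k → ℤ
  H e = ⟪ VWz k ⟫ (λ f → γ (e ⊞ f))
  H-triangles : ∀ e → H e ≡ trianglesV N k (v ⊞ e)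
  H-triangles e = ⟪⟫-cong (VWz k) (λ f → cong (bs N) (sym (assoc v e f)))
  expand : ⟪ q ⟫ γ ≡ trianglesV N k v - trianglesV N k (v ⊞ unit (suc i)) + trianglesV N k (v ⊞ (unit (suc i) ⊞ unit i))
  expand = trans (⟪⟫-· (w a b) (VWz k) γ) (trans (⟪w⟫ H)
    (cong₂ _+_ (cong₂ _-_ (trans (H-triangles 0v) (cong (trianglesV N k) (idʳ v))) (H-triangles _)) (H-triangles _)))

-- The only property of the operator formula that the interlacing sum uses; it survives differences
-- in further coordinates, which an induction over columns needs.
Cancels : (List ℤ → ℤ) → Set
Cancels g = ∀ pre c post →
  g (pre ++ c ∷ c ∷ post) - g (pre ++ c ∷ inc1 c ∷ post) + g (pre ++ inc1 c ∷ inc1 c ∷ post) ≡ + 0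

double : ∀ pre c post {k} (v : Vec ℤ k) → pre ++ c ∷ c ∷ post ≡ toList v → let i = length pre in
  suc i ℕ.< k × swV i v ≡ v × pre ++ c ∷ inc1 c ∷ post ≡ toList (v ⊞ unit (suc i))
    × pre ++ inc1 c ∷ inc1 c ∷ post ≡ toList (v ⊞ (unit (suc i) ⊞ unit i))
double [] c post (x ∷ y ∷ v) refl = ℕ.s≤s (ℕ.s≤s ℕ.z≤n) , refl
  , cong₂ _∷_ (sym (ℤₚ.+-identityʳ x)) (cong (inc1 x ∷_) (cong toList (sym (⊞-0 v))))
  , cong (inc1 x ∷_) (cong (inc1 x ∷_) (cong toList (sym (trans (cong (v ⊞_) (⊞-0 0v)) (⊞-0 v)))))
double (p ∷ pre) c post (x ∷ v) eq with Lₚ.∷-injective eq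
... | refl , eq′ with double pre c post v eq′
...   | lt , fx , e₁ , e₂ = ℕ.s≤s lt , cong (x ∷_) fx
      , cong₂ _∷_ (sym (ℤₚ.+-identityʳ x)) e₁ , cong₂ _∷_ (sym (ℤₚ.+-identityʳ x)) e₂

triangles-cancels : ∀ N k → Cancels (triangles N k)
triangles-cancels N k pre c post with vecView k (pre ++ c ∷ c ∷ post)
... | inj₁ (v , eq) with double pre c post v eq
...   | lt , fx , e₁ , e₂ = trans (cong₂ _+_ (cong₂ _-_ (go v eq) (go _ e₁)) (go _ e₂)) (trianglesV-cancels N k (length pre) v lt fx)
  where
  go : ∀ {xs} (v : Vec ℤ k) → xs ≡ toList v → triangles N k xs ≡ trianglesV N k v
  go v refl = triangles-toList N v
triangles-cancels N k pre c post | inj₂ ne = cong₂ _+_ (cong₂ _-_ (zz c c) (zz c (inc1 c))) (zz (inc1 c) (inc1 c))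
  where
  zz : ∀ d e → triangles N k (pre ++ d ∷ e ∷ post) ≡ + 0
  zz d e = triangles-≢ N k _ (λ eq → ne (trans (trans (Lₚ.length-++ pre) (sym (Lₚ.length-++ pre))) eq))

-- Cyclic rotation of the arguments

rotV : ∀ {k} → Vec ℤ (suc k) → Vec ℤ (suc k)
rotV (x ∷ v) = v ∷ʳ x

∷ʳ-⊞ : ∀ {k} (a b : Vec ℤ k) x y → (a ⊞ b) ∷ʳ (x + y) ≡ (a ∷ʳ x) ⊞ (b ∷ʳ y)
∷ʳ-⊞ []      []      x y = refl
∷ʳ-⊞ (u ∷ a) (v ∷ b) x y = cong (u + v ∷_) (∷ʳ-⊞ a b x y)

rotV-⊞ : ∀ {k} (a b : Vec ℤ (suc k)) → rotV (a ⊞ b) ≡ rotV a ⊞ rotV b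
rotV-⊞ (x ∷ a) (y ∷ b) = ∷ʳ-⊞ a b x y

0v-∷ʳ : ∀ k → 0v {k} ∷ʳ + 0 ≡ 0v
0v-∷ʳ zero    = refl
0v-∷ʳ (suc k) = cong (+ 0 ∷_) (0v-∷ʳ k)

bs-∷ʳ : ∀ {k} N x (v : Vec ℤ k) → bs N (v ∷ʳ x) ≡ bin N x * bs N v
bs-∷ʳ N x []      = refl
bs-∷ʳ N x (y ∷ v) = trans (cong (bin N y *_) (bs-∷ʳ N x v)) (lem (bin N y) (bin N x) (bs N v))
  where
  lem : ∀ a b c → a * (b * c) ≡ b * (a * c)
  lem = solve-∀

map-rotV-zs : ∀ k → map (mapP rotV) (map lift (zs k) ++ zvar 0 ∷ []) ≡ zs (suc k)
map-rotV-zs k = trans (Lₚ.map-++ (mapP rotV) (map lift (zs k)) _) (trans (cong (_++ mapP rotV (zvar 0) ∷ []) (fuse (zs k))) (go k))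
  where
  fuse : ∀ {k} ps → map (mapP (rotV {k})) (map lift ps) ≡ map (mapP (_∷ʳ + 0)) ps
  fuse []       = refl
  fuse (p ∷ ps) = cong₂ _∷_ (mapP-∘ rotV (+ 0 ∷_) p) (fuse ps)
  go : ∀ k → map (mapP (_∷ʳ + 0)) (zs k) ++ mapP rotV (zvar 0) ∷ [] ≡ zs (suc k)
  go zero    = refl
  go (suc k) = cong₂ _∷_ (cong₂ (λ a b → (+ 1 , + 1 ∷ a) ∷ (- + 1 , + 0 ∷ b) ∷ []) (0v-∷ʳ k) (0v-∷ʳ k))
    (trans (cong (_++ mapP rotV (zvar 0) ∷ []) (mapP-lift (_∷ʳ + 0) (_∷ʳ + 0) (λ _ → refl) (zs k)))
    (trans (sym (Lₚ.map-++ lift (map (mapP (_∷ʳ + 0)) (zs k)) (mapP rotV (zvar 0) ∷ []))) (cong (map lift) (go k))))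

sgn : ℕ → ℤ
sgn zero    = + 1
sgn (suc k) = - + 1 * sgn k

-- `VW-rotate` read on functions: its factor (1 + z_0)^(k+1) shifts the first coordinate by k + 1,
-- so evaluating at x - (k + 1) restores x on one side and leaves the lowered value on the other.
trianglesV-rotate : ∀ k x (v : Vec ℤ k) → trianglesV k (suc k) (x ∷ v) ≡ sgn k * trianglesV k (suc k) (v ∷ʳ (x - + suc k))
trianglesV-rotate k x v = begin
  ⟪ VW Z ⟫ (λ e → bs k ((x ∷ v) ⊞ e))       ≡⟨ ⟪⟫-cong (VW Z) (λ e → cong (bs k) (sym (shifted e))) ⟩
  ⟪ VW Z ⟫ (λ e → γ ((+ suc k ∷ 0v) ⊞ e))   ≡⟨ pow (suc k) (VW Z) γ ⟨
  ⟪ (inc (zvar 0) ^ suc k) · VW Z ⟫ γ       ≡⟨ at (rot k len) d ⟩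
  ⟪ (negP one ^ k) · q ⟫ γ                  ≡⟨ signs k q γ ⟩
  sgn k * ⟪ q ⟫ γ                           ≡⟨ cong (sgn k *_) back ⟩
  sgn k * trianglesV k (suc k) (v ∷ʳ y)            ∎
  where
  open ≡-Reasoning
  open BinomialQuotient k (suc k)
  open Exponents (ℤ^ suc k) using (assoc; idˡ)
  Z = zs (suc k)
  y = x - + suc k
  d = y ∷ v
  γ : Vec ℤ (suc k) → ℤ
  γ e = bs k (d ⊞ e)
  q = VW (map lift (zs k) ++ zvar 0 ∷ [])
  len : length (map lift (zs k)) ≡ k
  len = ℕₚ.suc-injective (length-zs (suc k))
  shifted : ∀ e → d ⊞ ((+ suc k ∷ 0v) ⊞ e) ≡ (x ∷ v) ⊞ e
  shifted (a ∷ e) = cong₂ _∷_ (lem x (+ suc k) a) (cong (v ⊞_) (Vₚ.zipWith-identityˡ ℤₚ.+-identityˡ e))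
    where
    lem : ∀ x s a → x - s + (s + a) ≡ x + a
    lem = solve-∀
  rot : ∀ m → length (map lift (zs k)) ≡ m → (inc (zvar 0) ^ suc m) · VW Z ≈ (negP one ^ m) · q
  rot m refl = VW-rotate (zvar 0) (map lift (zs k)) (subst (λ m → ∀ i → i ℕ.< suc m → nth Z i ^ suc m ≈ []) (sym len) nilpotent)
  pow : ∀ m p g → ⟪ (inc (zvar 0) ^ m) · p ⟫ g ≡ ⟪ p ⟫ (λ e → g ((+ m ∷ 0v) ⊞ e))
  pow zero    p g = ⟪⟫-mono· 0v p g
  pow (suc m) p g = begin
    ⟪ (inc (zvar 0) · (inc (zvar 0) ^ m)) · p ⟫ g
      ≡⟨ ⟪⟫-· (inc (zvar 0) · (inc (zvar 0) ^ m)) p g ⟩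
    ⟪ inc (zvar 0) · (inc (zvar 0) ^ m) ⟫ (λ e → ⟪ p ⟫ (λ f → g (e ⊞ f)))
      ≡⟨ trans (⟪⟫-· (inc (zvar 0)) (inc (zvar 0) ^ m) _) (⟪inc-zvar⟫ 0 (λ e → ⟪ inc (zvar 0) ^ m ⟫ (λ f → ⟪ p ⟫ (λ h → g (e ⊞ f ⊞ h))))) ⟩
    ⟪ inc (zvar 0) ^ m ⟫ (λ e → ⟪ p ⟫ (λ f → g (unit 0 ⊞ e ⊞ f)))
      ≡⟨ ⟪⟫-cong (inc (zvar 0) ^ m) (λ e → ⟪⟫-cong p (λ f → cong g (assoc (unit 0) e f))) ⟩
    ⟪ inc (zvar 0) ^ m ⟫ (λ e → ⟪ p ⟫ (λ f → g (unit 0 ⊞ (e ⊞ f))))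
      ≡⟨ ⟪⟫-· (inc (zvar 0) ^ m) p _ ⟨
    ⟪ (inc (zvar 0) ^ m) · p ⟫ (λ e → g (unit 0 ⊞ e))
      ≡⟨ pow m p _ ⟩
    ⟪ p ⟫ (λ e → g (unit 0 ⊞ ((+ m ∷ 0v) ⊞ e)))
      ≡⟨ ⟪⟫-cong p (λ e → cong g (trans (sym (assoc (unit 0) (+ m ∷ 0v) e)) (cong (λ t → (+ suc m ∷ t) ⊞ e) (⊞-0 0v)))) ⟩
    ⟪ p ⟫ (λ e → g ((+ suc m ∷ 0v) ⊞ e)) ∎
  signs : ∀ m p g → ⟪ (negP one ^ m) · p ⟫ g ≡ sgn m * ⟪ p ⟫ g
  signs zero    p g = trans (⟪⟫-mono· 0v p g) (trans (⟪⟫-cong p (λ e → cong g (idˡ e))) (sym (ℤₚ.*-identityˡ _)))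
  signs (suc m) p g = begin
    ⟪ (negP one · (negP one ^ m)) · p ⟫ g     ≡⟨ Mul.Free.at (F.*-assoc (negP one) (negP one ^ m) p) g ⟩
    ⟪ negP one · ((negP one ^ m) · p) ⟫ g     ≡⟨ ⟪⟫-· (negP one) ((negP one ^ m) · p) g ⟩
    - + 1 * ⟪ (negP one ^ m) · p ⟫ (λ f → g (0v ⊞ f)) + + 0
      ≡⟨ trans (ℤₚ.+-identityʳ _) (cong (- + 1 *_) (trans (signs m p _) (cong (sgn m *_) (⟪⟫-cong p (λ e → cong g (idˡ e)))))) ⟩
    - + 1 * (sgn m * ⟪ p ⟫ g)                 ≡⟨ ℤₚ.*-assoc (- + 1) (sgn m) _ ⟨
    sgn (suc m) * ⟪ p ⟫ g ∎
    where module F = CommutativeRing (Mul.Free.ring (ℤ^ suc k))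
  module Rt = MapP (ℤ^ suc k) (ℤ^ suc k) rotV rotV-⊞ (0v-∷ʳ k)
  back : ⟪ q ⟫ γ ≡ trianglesV k (suc k) (v ∷ʳ y)
  back = sym (begin
    ⟪ VW Z ⟫ (λ e → bs k ((v ∷ʳ y) ⊞ e))             ≡⟨ cong (λ Y → ⟪ VW Y ⟫ (λ e → bs k ((v ∷ʳ y) ⊞ e))) (map-rotV-zs k) ⟨
    ⟪ VW (map (mapP rotV) (map lift (zs k) ++ zvar 0 ∷ [])) ⟫ (λ e → bs k ((v ∷ʳ y) ⊞ e))
      ≡⟨ Mul.Free.at (Rt.h-VW (map lift (zs k) ++ zvar 0 ∷ [])) _ ⟨
    ⟪ mapP rotV q ⟫ (λ e → bs k ((v ∷ʳ y) ⊞ e))      ≡⟨ ⟪⟫-mapP rotV q _ ⟩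
    ⟪ q ⟫ (λ e → bs k ((v ∷ʳ y) ⊞ rotV e))           ≡⟨ ⟪⟫-cong q (λ e → trans (cong (bs k) (sym (rotV-⊞ d e))) (bs-rotV (d ⊞ e))) ⟩
    ⟪ q ⟫ γ ∎)
    where
    bs-rotV : ∀ u → bs k (rotV u) ≡ bs k u
    bs-rotV (a ∷ u) = bs-∷ʳ k a u

triangles-rotate : ∀ k x xs → triangles k (suc k) (x ∷ xs) ≡ sgn k * triangles k (suc k) (xs ++ x - + suc k ∷ [])
triangles-rotate k x xs with vecView k xs
... | inj₁ (v , refl) = trans (triangles-toList k (x ∷ v)) (trans (trianglesV-rotate k x v)
  (cong (sgn k *_) (sym (trans (cong (triangles k (suc k)) (sym (Vₚ.toList-∷ʳ _ v))) (triangles-toList k (v ∷ʳ (x - + suc k)))))))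
... | inj₂ ne = trans (triangles-≢ k (suc k) (x ∷ xs) (λ eq → ne (ℕₚ.suc-injective eq)))
  (sym (trans (cong (sgn k *_) (triangles-≢ k (suc k) (xs ++ x - + suc k ∷ []) (λ eq → ne (ℕₚ.suc-injective
    (trans (sym (trans (Lₚ.length-++ xs) (ℕₚ.+-comm (length xs) 1))) eq))))) (ℤₚ.*-zeroʳ (sgn k))))

-- Differences in all arguments

Δall : (List ℤ → ℤ) → List ℤ → ℤ
Δall g []       = g []
Δall g (x ∷ xs) = Δall (λ ls → g (inc1 x ∷ ls)) xs - Δall (λ ls → g (x ∷ ls)) xs

ΔV : ∀ {k} → (Vec ℤ k → ℤ) → Vec ℤ k → ℤ
ΔV g []      = g []
ΔV g (x ∷ v) = ΔV (λ u → g (inc1 x ∷ u)) v - ΔV (λ u → g (x ∷ u)) v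

ΔV-cong : ∀ {k} {g h : Vec ℤ k → ℤ} → (∀ u → g u ≡ h u) → ∀ v → ΔV g v ≡ ΔV h v
ΔV-cong eq []      = eq []
ΔV-cong eq (x ∷ v) = cong₂ _-_ (ΔV-cong (λ u → eq _) v) (ΔV-cong (λ u → eq _) v)

ΔV-* : ∀ {k} c (g : Vec ℤ k → ℤ) v → ΔV (λ u → c * g u) v ≡ c * ΔV g v
ΔV-* c g []      = refl
ΔV-* c g (x ∷ v) = trans (cong₂ _-_ (ΔV-* c _ v) (ΔV-* c _ v)) (lem c _ _)
  where
  lem : ∀ c a b → c * a - c * b ≡ c * (a - b)
  lem = solve-∀

ΔV-bs : ∀ {k} N (v : Vec ℤ k) → ΔV (bs (suc N)) v ≡ bs N v
ΔV-bs N []      = refl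
ΔV-bs N (x ∷ v) = begin
  ΔV (λ u → bin (suc N) (inc1 x) * bs (suc N) u) v - ΔV (λ u → bin (suc N) x * bs (suc N) u) v
    ≡⟨ cong₂ _-_ (ΔV-* (bin (suc N) (inc1 x)) (bs (suc N)) v) (ΔV-* (bin (suc N) x) (bs (suc N)) v) ⟩
  bin (suc N) (inc1 x) * ΔV (bs (suc N)) v - bin (suc N) x * ΔV (bs (suc N)) v
    ≡⟨ lem (bin (suc N) (inc1 x)) (bin (suc N) x) _ ⟩
  Δ (bin (suc N)) x * ΔV (bs (suc N)) v
    ≡⟨ cong₂ _*_ (Δ-bin N x) (ΔV-bs N v) ⟩
  bin N x * bs N v ∎
  where
  open ≡-Reasoning
  lem : ∀ a b c → a * c - b * c ≡ (a - b) * c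
  lem = solve-∀

ΔV-shift : ∀ {k} (g : Vec ℤ k → ℤ) e v → ΔV (λ u → g (u ⊞ e)) v ≡ ΔV g (v ⊞ e)
ΔV-shift g []      []      = refl
ΔV-shift g (a ∷ e) (x ∷ v) = cong₂ _-_
  (trans (ΔV-shift (λ u → g (inc1 x + a ∷ u)) e v) (cong (λ t → ΔV (λ u → g (t ∷ u)) (v ⊞ e)) (lem x a)))
  (ΔV-shift (λ u → g (x + a ∷ u)) e v)
  where
  lem : ∀ x a → x + + 1 + a ≡ x + a + + 1
  lem = solve-∀

ΔV-⟪⟫ : ∀ {A : Set} {k} (p : Poly A) (g : Vec ℤ k → A → ℤ) v → ΔV (λ u → ⟪ p ⟫ (g u)) v ≡ ⟪ p ⟫ (λ e → ΔV (λ u → g u e) v)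
ΔV-⟪⟫ p g []      = refl
ΔV-⟪⟫ p g (x ∷ v) = trans (cong₂ _-_ (ΔV-⟪⟫ p (λ u → g (inc1 x ∷ u)) v) (ΔV-⟪⟫ p (λ u → g (x ∷ u)) v)) (sym (⟪⟫-- p _ _))

Δall-toList : ∀ {k} g (v : Vec ℤ k) → Δall g (toList v) ≡ ΔV (λ u → g (toList u)) v
Δall-toList g []      = refl
Δall-toList g (x ∷ v) = cong₂ _-_ (Δall-toList _ v) (Δall-toList _ v)

Δall-zero : ∀ {g} xs → (∀ ys → length ys ≡ length xs → g ys ≡ + 0) → Δall g xs ≡ + 0
Δall-zero []       h = h [] refl
Δall-zero (x ∷ xs) h = cong₂ _-_ (Δall-zero xs (λ ys e → h _ (cong suc e))) (Δall-zero xs (λ ys e → h _ (cong suc e)))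

-- A difference in each coordinate lowers each binomial by one. This bridges the degree k that a
-- Laplace expansion leaves on k variables and the degree k - 1 of the counting formula.
triangles-Δ : ∀ k xs → triangles (ℕ.pred k) k xs ≡ Δall (triangles k k) xs
triangles-Δ k xs with vecView k xs
... | inj₂ ne = trans (triangles-≢ _ k xs ne) (sym (Δall-zero xs (λ ys e → triangles-≢ k k ys (λ e′ → ne (trans (sym e) e′)))))
triangles-Δ zero    xs | inj₁ ([] , refl) = refl
triangles-Δ (suc k) xs | inj₁ (v , refl) = begin
  triangles k (suc k) (toList v)                               ≡⟨ triangles-toList k v ⟩
  ⟪ VWz (suc k) ⟫ (λ e → bs k (v ⊞ e))                  ≡⟨ ⟪⟫-cong (VWz (suc k)) (λ e → trans (sym (ΔV-bs k (v ⊞ e))) (sym (ΔV-shift (bs (suc k)) e v))) ⟩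
  ⟪ VWz (suc k) ⟫ (λ e → ΔV (λ u → bs (suc k) (u ⊞ e)) v) ≡⟨ ΔV-⟪⟫ (VWz (suc k)) (λ u e → bs (suc k) (u ⊞ e)) v ⟨
  ΔV (trianglesV (suc k) (suc k)) v                            ≡⟨ ΔV-cong (λ u → sym (triangles-toList (suc k) u)) v ⟩
  ΔV (λ u → triangles (suc k) (suc k) (toList u)) v            ≡⟨ Δall-toList (triangles (suc k) (suc k)) v ⟨
  Δall (triangles (suc k) (suc k)) (toList v)                  ∎
  where open ≡-Reasoning

-- Linear functionals and frozen columns

record Linear {X : Set} (F : (X → ℤ) → ℤ) : Set where
  field
    ext   : ∀ {g h : X → ℤ} → (∀ x → g x ≡ h x) → F g ≡ F h
    add   : ∀ g h → F (λ x → g x + h x) ≡ F g + F h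
    scale : ∀ c g → F (λ x → c * g x) ≡ c * F g

  sub : ∀ g h → F (λ x → g x - h x) ≡ F g - F h
  sub g h = trans (add g (λ x → - h x)) (cong+ˡ (F g) (trans (ext (λ x → sym (ℤₚ.-1*i≡-i (h x)))) (trans (scale (- + 1) h) (ℤₚ.-1*i≡-i (F h)))))

  null : ∀ {g} → (∀ x → g x ≡ + 0) → F g ≡ + 0
  null {g} h = trans (ext (λ x → trans (h x) (sym (ℤₚ.*-zeroˡ (g x))))) (trans (scale (+ 0) g) (ℤₚ.*-zeroˡ (F g)))

open Linear

∘-linear : ∀ {X Y : Set} {F : (X → ℤ) → ℤ} {T : X → (Y → ℤ) → ℤ} → Linear F → (∀ x → Linear (T x)) → Linear (λ g → F (λ x → T x g))
∘-linear lF lT = record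
  { ext   = λ e → ext lF (λ x → ext (lT x) e)
  ; add   = λ g h → trans (ext lF (λ x → add (lT x) g h)) (add lF _ _)
  ; scale = λ c g → trans (ext lF (λ x → scale (lT x) c g)) (scale lF c _)
  }

pull-linear : ∀ {X Y : Set} {F : (X → ℤ) → ℤ} (f : X → Y) → Linear F → Linear (λ g → F (λ x → g (f x)))
pull-linear f lF = record { ext = λ e → ext lF (λ x → e (f x)) ; add = λ g h → add lF _ _ ; scale = λ c g → scale lF c _ }

sub-linear : ∀ {X : Set} {F G : (X → ℤ) → ℤ} → Linear F → Linear G → Linear (λ g → F g - G g)
sub-linear {F = F} {G} lF lG = record
  { ext   = λ e → cong₂ _-_ (ext lF e) (ext lG e)
  ; add   = λ g h → trans (cong₂ _-_ (add lF g h) (add lG g h)) (lem₁ (F g) (F h) (G g) (G h))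
  ; scale = λ c g → trans (cong₂ _-_ (scale lF c g) (scale lG c g)) (lem₂ c (F g) (G g))
  }
  where
  lem₁ : ∀ a b c d → a + b - (c + d) ≡ a - c + (b - d)
  lem₁ = solve-∀
  lem₂ : ∀ c a b → c * a - c * b ≡ c * (a - b)
  lem₂ = solve-∀

eval-linear : ∀ {X : Set} (x : X) → Linear (λ g → g x)
eval-linear x = record { ext = λ e → e x ; add = λ _ _ → refl ; scale = λ _ _ → refl }

Δall-linear : ∀ xs → Linear (λ g → Δall g xs)
Δall-linear []       = eval-linear []
Δall-linear (x ∷ xs) = sub-linear (pull-linear (inc1 x ∷_) (Δall-linear xs)) (pull-linear (x ∷_) (Δall-linear xs))

laplace-linear : ∀ xs → Linear (λ g → laplace g xs)
laplace-linear []       = record { ext = λ _ → refl ; add = λ _ _ → refl ; scale = λ c _ → sym (ℤₚ.*-zeroʳ c) }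
laplace-linear (x ∷ xs) = sub-linear (eval-linear _) (pull-linear (x ∷_) (laplace-linear xs))

∇^ : ℕ → (ℤ → ℤ) → ℤ → ℤ
∇^ zero    h x = h x
∇^ (suc f) h x = ∇^ f h x - ∇^ f h (x - + 1)

∇^-linear : ∀ f x → Linear (λ h → ∇^ f h x)
∇^-linear zero    x = eval-linear x
∇^-linear (suc f) x = sub-linear (∇^-linear f x) (∇^-linear f (x - + 1))

Spectators : Set
Spectators = List (ℕ × ℤ)

-- A spectator (f , x) is a column whose state has been frozen for f rows.
spect : Spectators → (List ℤ → ℤ) → ℤ
spect []             g = g []
spect ((f , x) ∷ ss) g = ∇^ f (λ y → spect ss (λ ys → g (y ∷ ys))) x

spect-linear : ∀ ss → Linear (spect ss)
spect-linear []             = eval-linear []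
spect-linear ((f , x) ∷ ss) = ∘-linear (∇^-linear f x) (λ y → pull-linear (y ∷_) (spect-linear ss))

bump : Spectators → Spectators
bump = map (λ { (f , x) → suc f , x })

∇^-shift : ∀ f H y → ∇^ f (λ y → H (inc1 y)) y ≡ ∇^ f H (inc1 y)
∇^-shift zero    H y = refl
∇^-shift (suc f) H y = cong₂ _-_ (∇^-shift f H y) (trans (∇^-shift f H (y - + 1)) (cong (∇^ f H) (lem y)))
  where
  lem : ∀ y → y - + 1 + + 1 ≡ y + + 1 - + 1
  lem = solve-∀

∇^-const : ∀ f c x → ∇^ (suc f) (λ _ → c) x ≡ + 0
∇^-const zero    c x = ℤₚ.+-inverseʳ c
∇^-const (suc f) c x = cong₂ _-_ (∇^-const f c x) (∇^-const f c (x - + 1))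

-- Deleting an entry to the left of the spectators moves all of them up by one, and ∇ of the shifted
-- function is Δ of the original one. The extra ∇ of a frozen row thus becomes the Δ that lowers the
-- degree.
spect-bump : ∀ ss h → spect (bump ss) (λ y → h (map inc1 y)) ≡ spect ss (Δall h)
spect-bump []             h = refl
spect-bump ((f , x) ∷ ss) h = begin
  ∇^ (suc f) (λ y → spect (bump ss) (λ ys → h (inc1 y ∷ map inc1 ys))) x
    ≡⟨ ext (∇^-linear (suc f) x) (λ y → spect-bump ss (λ ls → h (inc1 y ∷ ls))) ⟩
  ∇^ f (λ y → H (inc1 y)) x - ∇^ f (λ y → H (inc1 y)) (x - + 1)
    ≡⟨ cong (λ t → ∇^ f (λ y → H (inc1 y)) x - t) (trans (∇^-shift f H (x - + 1)) (cong (∇^ f H) (lem x))) ⟩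
  ∇^ f (λ y → H (inc1 y)) x - ∇^ f H x
    ≡⟨ sub (∇^-linear f x) _ _ ⟨
  ∇^ f (λ y → H (inc1 y) - H y) x
    ≡⟨ ext (∇^-linear f x) (λ y → sym (sub (spect-linear ss) _ _)) ⟩
  ∇^ f (λ y → spect ss (λ ys → Δall h (y ∷ ys))) x ∎
  where
  open ≡-Reasoning
  H : ℤ → ℤ
  H y = spect ss (Δall (λ ls → h (y ∷ ls)))
  lem : ∀ y → y - + 1 + + 1 ≡ y
  lem = solve-∀

-- A term in which a spectator itself is deleted no longer depends on its position and is killed by
-- the additional ∇.
spect-laplace-zero : ∀ ss g → spect (bump ss) (laplace g) ≡ + 0
spect-laplace-zero []             g = refl
spect-laplace-zero ((f , x) ∷ ss) g = trans (ext (∇^-linear (suc f) x) (λ y →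
    trans (sub (spect-linear (bump ss)) _ _) (trans (cong (λ t → spect (bump ss) (λ ys → g (map inc1 ys)) - t)
      (spect-laplace-zero ss (λ ls → g (y ∷ ls)))) (ℤₚ.+-identityʳ _))))
  (∇^-const f (spect (bump ss) (λ ys → g (map inc1 ys))) x)

spect-laplace : ∀ ss g ks → spect (bump ss) (λ y → laplace g (ks ++ y)) ≡ laplace (λ l → spect ss (Δall (λ y → g (l ++ y)))) ks
spect-laplace ss g []       = spect-laplace-zero ss g
spect-laplace ss g (k ∷ ks) = trans (sub (spect-linear (bump ss)) _ _) (cong₂ _-_
  (trans (ext (spect-linear (bump ss)) (λ y → cong g (Lₚ.map-++ inc1 ks y))) (spect-bump ss (λ y → g (map inc1 ks ++ y))))
  (spect-laplace ss (λ ls → g (k ∷ ls)) ks))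

-- The interlacing sum of one row

positions : ℤ → List Bool → List ℤ
positions c []          = []
positions c (true ∷ σ)  = c ∷ positions (inc1 c) σ
positions c (false ∷ σ) = positions (inc1 c) σ

-- Transpose of the row transfer matrix: sums F over the column states from which an alternating row of sum 1
-- leads to the given ones; the Boolean is the sum of the entries already read.
rowAdjoint : Bool → (List Bool → ℤ) → List Bool → ℤ
rowAdjoint h     F []          = if h then F [] else + 0
rowAdjoint false F (false ∷ σ) = rowAdjoint false (λ τ → F (false ∷ τ)) σ
rowAdjoint true  F (false ∷ σ) = rowAdjoint true (λ τ → F (false ∷ τ)) σ + rowAdjoint false (λ τ → F (true ∷ τ)) σ
rowAdjoint false F (true ∷ σ)  = rowAdjoint true (λ τ → F (false ∷ τ)) σ + rowAdjoint false (λ τ → F (true ∷ τ)) σ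
rowAdjoint true  F (true ∷ σ)  = rowAdjoint true (λ τ → F (true ∷ τ)) σ

rowAdjoint-cong : ∀ h σ {F G : List Bool → ℤ} → (∀ τ → F τ ≡ G τ) → rowAdjoint h F σ ≡ rowAdjoint h G σ
rowAdjoint-cong false []          e = refl
rowAdjoint-cong true  []          e = e []
rowAdjoint-cong false (false ∷ σ) e = rowAdjoint-cong false σ (λ τ → e _)
rowAdjoint-cong true  (false ∷ σ) e = cong₂ _+_ (rowAdjoint-cong true σ (λ τ → e _)) (rowAdjoint-cong false σ (λ τ → e _))
rowAdjoint-cong false (true ∷ σ)  e = cong₂ _+_ (rowAdjoint-cong true σ (λ τ → e _)) (rowAdjoint-cong false σ (λ τ → e _))
rowAdjoint-cong true  (true ∷ σ)  e = rowAdjoint-cong true σ (λ τ → e _)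

ΔHead : ℤ → (List ℤ → ℤ) → List ℤ → ℤ
ΔHead c g ls = g (inc1 c ∷ ls) - g (c ∷ ls)

ΔHead-cancels : ∀ c g → Cancels g → Cancels (ΔHead c g)
ΔHead-cancels c g kg pre d post = trans (lem (G (inc1 c) d d) (G c d d) (G (inc1 c) d (inc1 d)) (G c d (inc1 d)) (G (inc1 c) (inc1 d) (inc1 d)) (G c (inc1 d) (inc1 d)))
  (cong₂ _-_ (kg (inc1 c ∷ pre) d post) (kg (c ∷ pre) d post))
  where
  G : ℤ → ℤ → ℤ → ℤ
  G a b c = g (a ∷ pre ++ b ∷ c ∷ post)
  lem : ∀ a b p q x y → a - b - (p - q) + (x - y) ≡ a - p + x - (b - q + y)
  lem = solve-∀

-- In an open interval the earlier entry lies either beyond column c or at c. The difference at c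
-- moves the lower end of the telescoped interval from c + 1 back to c.
begin-row : ∀ c σ g → let ks = positions (inc1 c) σ in
  rowAdjoint true (λ τ → Δall g (positions (inc1 c) τ)) σ ≡ laplace g (inc1 c ∷ ks) →
  rowAdjoint false (λ τ → Δall (ΔHead c g) (positions (inc1 c) τ)) σ ≡ laplace (ΔHead c g) ks →
  rowAdjoint true (λ τ → Δall g (positions (inc1 c) τ)) σ + rowAdjoint false (λ τ → Δall g (c ∷ positions (inc1 c) τ)) σ ≡ laplace g (c ∷ ks)
begin-row c σ g e₁ e₂ = trans (cong₂ _+_ e₁
    (trans (rowAdjoint-cong false σ (λ τ → sym (sub (Δall-linear (positions (inc1 c) τ)) (g ∘ (inc1 c ∷_)) (g ∘ (c ∷_)))))
      (trans e₂ (sub (laplace-linear ks) (g ∘ (inc1 c ∷_)) (g ∘ (c ∷_))))))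
  (lem (g (map inc1 ks)) (laplace (g ∘ (inc1 c ∷_)) ks) (laplace (g ∘ (c ∷_)) ks))
  where
  ks = positions (inc1 c) σ
  lem : ∀ a b c → a - b + (b - c) ≡ a - c
  lem = solve-∀

-- Summing Δ over the interval between consecutive positions p and q telescopes to the values at q +
-- 1 and p. A partial row sum 1 means that an interval is open, which then behaves as if its lower
-- end were the current column c.
interlacing : ∀ h c σ g → Cancels g → rowAdjoint h (λ τ → Δall g (positions c τ)) σ ≡ laplace g (if h then c ∷ positions c σ else positions c σ)
interlacing false c []          g kg = refl
interlacing true  c []          g kg = sym (ℤₚ.+-identityʳ (g []))
interlacing false c (false ∷ σ) g kg = interlacing false (inc1 c) σ g kg
interlacing true  c (false ∷ σ) g kg = begin-row c σ g (interlacing true (inc1 c) σ g kg) (interlacing false (inc1 c) σ (ΔHead c g) (ΔHead-cancels c g kg))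
interlacing false c (true ∷ σ)  g kg = begin-row c σ g (interlacing true (inc1 c) σ g kg) (interlacing false (inc1 c) σ (ΔHead c g) (ΔHead-cancels c g kg))
-- Column c occurs in both records. Its entry closes the open interval, and strict increase makes
-- the next interval start at c + 1 instead of c; the discrepancy is a Laplace sum of expressions
-- that vanish by `Cancels`.
interlacing true  c (true ∷ σ)  g kg = trans (rowAdjoint-cong true σ (λ τ → sym (sub (Δall-linear (positions (inc1 c) τ)) _ _)))
  (trans (interlacing true (inc1 c) σ (ΔHead c g) (ΔHead-cancels c g kg))
  (lem (g (inc1 c ∷ map inc1 ks)) (g (c ∷ map inc1 ks)) (laplace (λ ls → ΔHead c g (inc1 c ∷ ls)) ks) (laplace (λ ls → g (c ∷ c ∷ ls)) ks) cancel))
  where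
  ks = positions (inc1 c) σ
  cancel : laplace (λ ls → ΔHead c g (inc1 c ∷ ls)) ks + laplace (λ ls → g (c ∷ c ∷ ls)) ks ≡ + 0
  cancel = trans (sym (add (laplace-linear ks) _ _)) (null (laplace-linear ks) (λ ls → trans (flip (g (inc1 c ∷ inc1 c ∷ ls)) (g (c ∷ inc1 c ∷ ls)) (g (c ∷ c ∷ ls))) (kg [] c ls)))
    where
    flip : ∀ a b c → a - b + c ≡ c - b + a
    flip = solve-∀
  lem : ∀ a b r s → r + s ≡ + 0 → a - b - r ≡ a - (b - s)
  lem a b r s e = trans (lem₁ a b r s) (trans (cong (λ t → a - (b - s) - t) e) (ℤₚ.+-identityʳ _))
    where
    lem₁ : ∀ a b r s → a - b - r ≡ a - (b - s) - (r + s)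
    lem₁ = solve-∀

Δall-++ : ∀ G a y → Δall G (a ++ y) ≡ Δall (λ l → Δall (λ y′ → G (l ++ y′)) y) a
Δall-++ G []      y = refl
Δall-++ G (x ∷ a) y = cong₂ _-_ (Δall-++ (λ ls → G (inc1 x ∷ ls)) a y) (Δall-++ (λ ls → G (x ∷ ls)) a y)

Δall-spect : ∀ ss (H : List ℤ → List ℤ → ℤ) a → Δall (λ l → spect ss (H l)) a ≡ spect ss (λ y → Δall (λ l → H l y) a)
Δall-spect ss H []      = refl
Δall-spect ss H (x ∷ a) = trans (cong₂ _-_ (Δall-spect ss (λ l → H (inc1 x ∷ l)) a) (Δall-spect ss (λ l → H (x ∷ l)) a))
  (sym (sub (spect-linear ss) _ _))

-- The degree is first raised by writing the formula as `Δall`. The differences in live columns are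
-- summed away by `interlacing`, those in the spectators are paid for by `bump`, and the Laplace sum
-- reassembles to the formula with one more variable.
row-step : ∀ ss k c σ →
  rowAdjoint false (λ τ → spect ss (λ y → triangles (ℕ.pred k) k (positions c τ ++ y))) σ ≡ spect (bump ss) (λ y → triangles k (suc k) (positions c σ ++ y))
row-step ss k c σ = begin
  rowAdjoint false (λ τ → spect ss (λ y → triangles (ℕ.pred k) k (positions c τ ++ y))) σ
    ≡⟨ rowAdjoint-cong false σ (λ τ → trans (ext (spect-linear ss) (λ y → trans (triangles-Δ k (positions c τ ++ y)) (Δall-++ (triangles k k) (positions c τ) y)))
         (sym (Δall-spect ss (λ l y → Δall (λ y′ → triangles k k (l ++ y′)) y) (positions c τ)))) ⟩
  rowAdjoint false (λ τ → Δall g (positions c τ)) σ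
    ≡⟨ interlacing false c σ g kill ⟩
  laplace g (positions c σ)
    ≡⟨ spect-laplace ss (triangles k k) (positions c σ) ⟨
  spect (bump ss) (λ y → laplace (triangles k k) (positions c σ ++ y))
    ≡⟨ ext (spect-linear (bump ss)) (λ y → sym (triangles-laplace k (positions c σ ++ y))) ⟩
  spect (bump ss) (λ y → triangles k (suc k) (positions c σ ++ y)) ∎
  where
  open ≡-Reasoning
  g : List ℤ → ℤ
  g l = spect ss (Δall (λ y → triangles k k (l ++ y)))
  lin : Linear (λ h → spect ss (Δall h))
  lin = ∘-linear (spect-linear ss) Δall-linear
  kill : Cancels g
  kill pre c post = trans (sym (trans (add lin _ _) (cong+ʳ _ (sub lin _ _)))) (null lin (λ y → begin
    triangles k k ((pre ++ c ∷ c ∷ post) ++ y) - triangles k k ((pre ++ c ∷ inc1 c ∷ post) ++ y) + triangles k k ((pre ++ inc1 c ∷ inc1 c ∷ post) ++ y)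
      ≡⟨ cong₂ _+_ (cong₂ _-_ (cong (triangles k k) (Lₚ.++-assoc pre _ y)) (cong (triangles k k) (Lₚ.++-assoc pre _ y))) (cong (triangles k k) (Lₚ.++-assoc pre _ y)) ⟩
    triangles k k (pre ++ c ∷ c ∷ (post ++ y)) - triangles k k (pre ++ c ∷ inc1 c ∷ (post ++ y)) + triangles k k (pre ++ inc1 c ∷ inc1 c ∷ (post ++ y))
      ≡⟨ triangles-cancels k k pre c (post ++ y) ⟩
    + 0 ∎))

-- Pairing the operator formula with the completions below a cut

sumB : ℕ → (List Bool → ℤ) → ℤ
sumB zero    F = F []
sumB (suc L) F = sumB L (λ σ → F (false ∷ σ)) + sumB L (λ σ → F (true ∷ σ))

sumB-cong : ∀ L {F G : List Bool → ℤ} → (∀ σ → length σ ≡ L → F σ ≡ G σ) → sumB L F ≡ sumB L G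
sumB-cong zero    e = e [] refl
sumB-cong (suc L) e = cong₂ _+_ (sumB-cong L (λ σ p → e _ (cong suc p))) (sumB-cong L (λ σ p → e _ (cong suc p)))

sumB-+ : ∀ L F G → sumB L (λ σ → F σ + G σ) ≡ sumB L F + sumB L G
sumB-+ zero    F G = refl
sumB-+ (suc L) F G = trans (cong₂ _+_ (sumB-+ L _ _) (sumB-+ L _ _)) (lem (sumB L (F ∘ (false ∷_))) (sumB L (G ∘ (false ∷_))) (sumB L (F ∘ (true ∷_))) (sumB L (G ∘ (true ∷_))))
  where
  lem : ∀ a b c d → a + b + (c + d) ≡ a + c + (b + d)
  lem = solve-∀

sumB-* : ∀ L c F → sumB L (λ σ → c * F σ) ≡ c * sumB L F
sumB-* zero    c F = refl
sumB-* (suc L) c F = trans (cong₂ _+_ (sumB-* L c _) (sumB-* L c _)) (sym (ℤₚ.*-distribˡ-+ c _ _))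

-- The transfer matrix itself: H is summed over the column states that one row can produce from σ,
-- the Boolean being the partial row sum.
rowsum : Bool → List Bool → (List Bool → ℤ) → ℤ
rowsum h     []          H = if h then H [] else + 0
rowsum false (false ∷ σ) H = rowsum false σ (λ τ → H (false ∷ τ)) + rowsum true σ (λ τ → H (true ∷ τ))
rowsum true  (false ∷ σ) H = rowsum true σ (λ τ → H (false ∷ τ))
rowsum false (true ∷ σ)  H = rowsum false σ (λ τ → H (true ∷ τ))
rowsum true  (true ∷ σ)  H = rowsum false σ (λ τ → H (false ∷ τ)) + rowsum true σ (λ τ → H (true ∷ τ))

rowsum-adjoint : ∀ L h F H → sumB L (λ σ → F σ * rowsum h σ H) ≡ sumB L (λ σ → rowAdjoint h F σ * H σ)
rowsum-adjoint zero    false F H = ℤₚ.*-zeroʳ (F [])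
rowsum-adjoint zero    true  F H = refl
rowsum-adjoint (suc L) h F H = go h
  where
  open ≡-Reasoning
  Ff Ft Hf Ht : List Bool → ℤ
  Ff σ = F (false ∷ σ)
  Ft σ = F (true ∷ σ)
  Hf σ = H (false ∷ σ)
  Ht σ = H (true ∷ σ)
  splitʳ : ∀ (A B C : List Bool → ℤ) → sumB L (λ σ → A σ * (B σ + C σ)) ≡ sumB L (λ σ → A σ * B σ) + sumB L (λ σ → A σ * C σ)
  splitʳ A B C = trans (sumB-cong L (λ σ _ → ℤₚ.*-distribˡ-+ (A σ) (B σ) (C σ))) (sumB-+ L _ _)
  splitˡ : ∀ (A B C : List Bool → ℤ) → sumB L (λ σ → (A σ + B σ) * C σ) ≡ sumB L (λ σ → A σ * C σ) + sumB L (λ σ → B σ * C σ)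
  splitˡ A B C = trans (sumB-cong L (λ σ _ → ℤₚ.*-distribʳ-+ (C σ) (A σ) (B σ))) (sumB-+ L _ _)
  Sᵣ Tᵣ : Bool → (List Bool → ℤ) → (List Bool → ℤ) → ℤ
  Sᵣ h F H = sumB L (λ σ → F σ * rowsum h σ H)
  Tᵣ h F H = sumB L (λ σ → rowAdjoint h F σ * H σ)
  ih : ∀ h F H → Sᵣ h F H ≡ Tᵣ h F H
  ih = rowsum-adjoint L
  go : ∀ h → sumB (suc L) (λ σ → F σ * rowsum h σ H) ≡ sumB (suc L) (λ σ → rowAdjoint h F σ * H σ)
  go false = begin
    sumB L (λ σ → Ff σ * (rowsum false σ Hf + rowsum true σ Ht)) + Sᵣ false Ft Ht
      ≡⟨ cong+ʳ (Sᵣ false Ft Ht) (splitʳ Ff _ _) ⟩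
    Sᵣ false Ff Hf + Sᵣ true Ff Ht + Sᵣ false Ft Ht
      ≡⟨ ℤₚ.+-assoc (Sᵣ false Ff Hf) (Sᵣ true Ff Ht) (Sᵣ false Ft Ht) ⟩
    Sᵣ false Ff Hf + (Sᵣ true Ff Ht + Sᵣ false Ft Ht)
      ≡⟨ cong₂ _+_ (ih false Ff Hf) (cong₂ _+_ (ih true Ff Ht) (ih false Ft Ht)) ⟩
    Tᵣ false Ff Hf + (Tᵣ true Ff Ht + Tᵣ false Ft Ht)
      ≡⟨ cong+ˡ (Tᵣ false Ff Hf) (sym (splitˡ (rowAdjoint true Ff) (rowAdjoint false Ft) Ht)) ⟩
    Tᵣ false Ff Hf + sumB L (λ σ → (rowAdjoint true Ff σ + rowAdjoint false Ft σ) * Ht σ) ∎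
  go true = begin
    Sᵣ true Ff Hf + sumB L (λ σ → Ft σ * (rowsum false σ Hf + rowsum true σ Ht))
      ≡⟨ cong+ˡ (Sᵣ true Ff Hf) (splitʳ Ft _ _) ⟩
    Sᵣ true Ff Hf + (Sᵣ false Ft Hf + Sᵣ true Ft Ht)
      ≡⟨ ℤₚ.+-assoc (Sᵣ true Ff Hf) (Sᵣ false Ft Hf) (Sᵣ true Ft Ht) ⟨
    Sᵣ true Ff Hf + Sᵣ false Ft Hf + Sᵣ true Ft Ht
      ≡⟨ cong₂ _+_ (cong₂ _+_ (ih true Ff Hf) (ih false Ft Hf)) (ih true Ft Ht) ⟩
    Tᵣ true Ff Hf + Tᵣ false Ft Hf + Tᵣ true Ft Ht
      ≡⟨ cong+ʳ (Tᵣ true Ft Ht) (sym (splitˡ (rowAdjoint true Ff) (rowAdjoint false Ft) Hf)) ⟩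
    sumB L (λ σ → (rowAdjoint true Ff σ + rowAdjoint false Ft σ) * Hf σ) + Tᵣ true Ft Ht ∎

eqB : Bool → Bool → Bool
eqB false b = not b
eqB true  b = b

matchLast : Bool → List Bool → Maybe (List Bool)
matchLast e []          = nothing
matchLast e (b ∷ [])    = if eqB b e then just [] else nothing
matchLast e (b ∷ c ∷ σ) = Maybe.map (b ∷_) (matchLast e (c ∷ σ))

-- The next row is shorter by one column at each end, so the states of the two end columns are final
-- and are compared with the prescribed column sums.
trimEnds : Bool → Bool → List Bool → Maybe (List Bool)
trimEnds d e []      = nothing
trimEnds d e (b ∷ σ) = if eqB b d then matchLast e σ else nothing

maybe-map : ∀ {A B C : Set} (H : B → C) (z : C) (f : A → B) m → maybe′ H z (Maybe.map f m) ≡ maybe′ (λ x → H (f x)) z m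
maybe-map H z f (just x) = refl
maybe-map H z f nothing  = refl

sumB-matchLast : ∀ L e (F H : List Bool → ℤ) → sumB (suc L) (λ σ → F σ * maybe′ H (+ 0) (matchLast e σ)) ≡ sumB L (λ σ → F (σ ++ e ∷ []) * H σ)
sumB-matchLast zero    false F H = lem (F (false ∷ [])) (F (true ∷ [])) (H [])
  where
  lem : ∀ a b c → a * c + b * + 0 ≡ a * c
  lem = solve-∀
sumB-matchLast zero    true  F H = lem (F (false ∷ [])) (F (true ∷ [])) (H [])
  where
  lem : ∀ a b c → a * + 0 + b * c ≡ b * c
  lem = solve-∀
sumB-matchLast (suc L) e F H = cong₂ _+_ (go false) (go true)
  where
  unfold : ∀ b σ → length σ ≡ suc L → matchLast e (b ∷ σ) ≡ Maybe.map (b ∷_) (matchLast e σ)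
  unfold b (c ∷ σ) _ = refl
  go : ∀ b → sumB (suc L) (λ σ → F (b ∷ σ) * maybe′ H (+ 0) (matchLast e (b ∷ σ))) ≡ sumB L (λ σ → F (b ∷ σ ++ e ∷ []) * H (b ∷ σ))
  go b = trans (sumB-cong (suc L) (λ σ p → cong (F (b ∷ σ) *_)
      (trans (cong (maybe′ H (+ 0)) (unfold b σ p)) (maybe-map H (+ 0) (b ∷_) (matchLast e σ)))))
    (sumB-matchLast L e (λ σ → F (b ∷ σ)) (λ σ → H (b ∷ σ)))

sumB-0 : ∀ L {F} → (∀ σ → F σ ≡ + 0) → sumB L F ≡ + 0
sumB-0 zero    e = e []
sumB-0 (suc L) e = cong₂ _+_ (sumB-0 L (λ σ → e _)) (sumB-0 L (λ σ → e _))

sumB-trimEnds : ∀ L d e (F H : List Bool → ℤ) → sumB (suc (suc L)) (λ σ → F σ * maybe′ H (+ 0) (trimEnds d e σ)) ≡ sumB L (λ σ → F (d ∷ σ ++ e ∷ []) * H σ)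
sumB-trimEnds L false e F H = trans (cong₂ _+_ (sumB-matchLast L e (λ σ → F (false ∷ σ)) H)
  (sumB-0 (suc L) (λ σ → ℤₚ.*-zeroʳ (F (true ∷ σ))))) (ℤₚ.+-identityʳ _)
sumB-trimEnds L true  e F H = trans (cong₂ _+_ (sumB-0 (suc L) (λ σ → ℤₚ.*-zeroʳ (F (false ∷ σ))))
  (sumB-matchLast L e (λ σ → F (true ∷ σ)) H)) (ℤₚ.+-identityˡ _)

bit : Bool → ℤ
bit b = if b then + 1 else + 0

sumB-allFalse : ∀ L F → sumB L (λ σ → F σ * bit (allᵇ not σ)) ≡ F (L.replicate L false)
sumB-allFalse zero    F = ℤₚ.*-identityʳ (F [])
sumB-allFalse (suc L) F = trans (cong₂ _+_ (sumB-allFalse L (λ σ → F (false ∷ σ))) (sumB-0 L (λ σ → ℤₚ.*-zeroʳ (F (true ∷ σ))))) (ℤₚ.+-identityʳ _)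

positions-false : ∀ c L → positions c (L.replicate L false) ≡ []
positions-false c zero    = refl
positions-false c (suc L) = positions-false (inc1 c) L

positions-++ : ∀ c σ τ → positions c (σ ++ τ) ≡ positions c σ ++ positions (c + + length σ) τ
positions-++ c []          τ = cong (λ t → positions t τ) (sym (ℤₚ.+-identityʳ c))
positions-++ c (b ∷ σ)     τ = go b (trans (positions-++ (inc1 c) σ τ) (cong (λ t → positions (inc1 c) σ ++ positions t τ) (ℤₚ.+-assoc c (+ 1) (+ length σ))))
  where
  go : ∀ b → positions (inc1 c) (σ ++ τ) ≡ positions (inc1 c) σ ++ positions (c + + suc (length σ)) τ →
    positions c (b ∷ σ ++ τ) ≡ positions c (b ∷ σ) ++ positions (c + + suc (length σ)) τ
  go false e = e
  go true  e = cong (c ∷_) e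

spect-∷ʳ : ∀ ss x g → spect (ss ++ (0 , x) ∷ []) g ≡ spect ss (λ y → g (y ++ x ∷ []))
spect-∷ʳ []             x g = refl
spect-∷ʳ ((f , z) ∷ ss) x g = ext (∇^-linear f z) (λ y → spect-∷ʳ ss x (λ ys → g (y ∷ ys)))

module Count (l : ℕ) (1≤l : 1 ℕ.≤ l) (tgt : ℤ → Bool) where

  completions : ℕ → List Bool → ℤ
  completions zero    σ = bit (allᵇ not σ)
  completions (suc m) σ = rowsum false σ (λ σ′ → maybe′ (completions m) (+ 0) (trimEnds (tgt (- + m)) (tgt (+ (l ℕ.+ m))) σ′))

  width : ℕ → ℕ
  -- Below the last row only the central columns are left, whose sums `completions` requires to be
  -- 0.
  width zero    = l ℕ.∸ 1
  width (suc m) = l ℕ.+ 2 ℕ.* m ℕ.+ 1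

  width-suc : ∀ m → width (suc m) ≡ suc (suc (width m))
  width-suc zero    = trans (cong (ℕ._+ 1) (ℕₚ.+-identityʳ l)) (trans (ℕₚ.+-comm l 1) (cong suc (sym (ℕₚ.m+[n∸m]≡n 1≤l))))
  width-suc (suc m) = lem l m
    where
    lem : ∀ l m → l ℕ.+ 2 ℕ.* suc m ℕ.+ 1 ≡ suc (suc (l ℕ.+ 2 ℕ.* m ℕ.+ 1))
    lem = solveℕ-∀

  start : ℕ → ℤ
  start zero    = + 1
  start (suc m) = - + m

  inc-start : ∀ m → inc1 (start (suc m)) ≡ start m
  inc-start zero    = refl
  inc-start (suc m) = lem (+ m)
    where
    lem : ∀ x → - (+ 1 + x) + + 1 ≡ - x
    lem = solve-∀

  start+width : ∀ m → start m + + width m ≡ + (l ℕ.+ m)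
  start+width zero    = cong +_ (trans (ℕₚ.m+[n∸m]≡n 1≤l) (sym (ℕₚ.+-identityʳ l)))
  start+width (suc m) = trans (cong (λ t → - + m + t) (cong +_ (lem₁ l m))) (lem₂ (+ m) (+ (l ℕ.+ suc m)))
    where
    lem₁ : ∀ l m → l ℕ.+ 2 ℕ.* m ℕ.+ 1 ≡ m ℕ.+ (l ℕ.+ suc m)
    lem₁ = solveℕ-∀
    lem₂ : ∀ x y → - x + (x + y) ≡ y
    lem₂ = solve-∀

  freezeR freezeL : Bool → ℤ → Spectators → Spectators
  freezeR b x ss = if b then (0 , x) ∷ ss else ss
  freezeL b x ss = if b then ss ++ (0 , x) ∷ [] else ss

  -- A right end is the last live position, hence already adjacent to the spectators. A left end is
  -- the first position and must be rotated past everything, spectators included, which costs the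
  -- shift by `suc k`.
  final : ℕ → ℕ → Spectators → Spectators
  final zero    k ss = ss
  final (suc m) k ss = final m (suc k) (freezeR (tgt (+ (l ℕ.+ m))) (+ (l ℕ.+ m)) (freezeL (tgt (- + m)) (- + m - + suc k) (bump ss)))

  rotationSign : ℕ → ℕ → ℤ
  rotationSign zero    k = + 1
  rotationSign (suc m) k = (if tgt (- + m) then sgn k else + 1) * rotationSign m (suc k)

  freeze-right : ∀ ss (g : List ℤ → ℤ) b c σ → length σ ≡ width c →
    spect ss (λ y → g (positions (start c) (σ ++ b ∷ []) ++ y)) ≡ spect (freezeR b (+ (l ℕ.+ c)) ss) (λ y → g (positions (start c) σ ++ y))
  freeze-right ss g b m σ len = go b
    where
    last : ∀ b → positions (start m) (σ ++ b ∷ []) ≡ positions (start m) σ ++ positions (+ (l ℕ.+ m)) (b ∷ [])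
    last b = trans (positions-++ (start m) σ (b ∷ [])) (cong (λ t → positions (start m) σ ++ positions t (b ∷ []))
      (trans (cong (λ t → start m + + t) len) (start+width m)))
    go : ∀ b → spect ss (λ y → g (positions (start m) (σ ++ b ∷ []) ++ y)) ≡ spect (freezeR b (+ (l ℕ.+ m)) ss) (λ y → g (positions (start m) σ ++ y))
    go false = ext (spect-linear ss) (λ y → cong (λ t → g (t ++ y)) (trans (last false) (Lₚ.++-identityʳ _)))
    go true  = ext (spect-linear ss) (λ y → cong g (trans (cong (_++ y) (last true)) (Lₚ.++-assoc (positions (start m) σ) _ y)))

  freeze-left : ∀ ss k b m τ →
    spect ss (λ y → triangles k (suc k) (positions (- + m) (b ∷ τ) ++ y)) ≡
    (if b then sgn k else + 1) * spect (freezeL b (- + m - + suc k) ss) (λ y → triangles k (suc k) (positions (start m) τ ++ y))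
  freeze-left ss k false m τ = trans (ext (spect-linear ss) (λ y → cong (λ c → triangles k (suc k) (positions c τ ++ y)) (inc-start m))) (sym (ℤₚ.*-identityˡ _))
  freeze-left ss k true  m τ = trans (ext (spect-linear ss) (λ y → trans (cong (λ c → triangles k (suc k) (- + m ∷ positions c τ ++ y)) (inc-start m))
        (trans (triangles-rotate k (- + m) (positions (start m) τ ++ y)) (cong (λ t → sgn k * triangles k (suc k) t) (Lₚ.++-assoc (positions (start m) τ) y _)))))
      (trans (scale (spect-linear ss) (sgn k) _) (cong (sgn k *_) (sym (spect-∷ʳ ss (- + m - + suc k) _))))

  -- Adjointness moves the transfer of one row from the completions to the formula, where `row-step`
  -- evaluates it; `trimEnds` then fixes the two outer states, and these columns join the
  -- spectators.
  pairing : ∀ m k ss →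
    sumB (width m) (λ σ → spect ss (λ y → triangles (ℕ.pred k) k (positions (start m) σ ++ y)) * completions m σ)
      ≡ rotationSign m k * spect (final m k ss) (triangles (ℕ.pred (k ℕ.+ m)) (k ℕ.+ m))
  pairing zero k ss rewrite ℕₚ.+-identityʳ k = trans (sumB-allFalse (l ℕ.∸ 1) (λ σ → spect ss (λ y → triangles (ℕ.pred k) k (positions (+ 1) σ ++ y))))
    (trans (ext (spect-linear ss) (λ y → cong (λ t → triangles (ℕ.pred k) k (t ++ y)) (positions-false (+ 1) (l ℕ.∸ 1)))) (sym (ℤₚ.*-identityˡ _)))
  pairing (suc m) k ss rewrite ℕₚ.+-suc k m = begin
    sumB (width (suc m)) (λ σ → F σ * rowsum false σ H)
      ≡⟨ rowsum-adjoint (width (suc m)) false F H ⟩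
    sumB (width (suc m)) (λ σ → rowAdjoint false F σ * H σ)
      ≡⟨ sumB-cong (width (suc m)) (λ σ _ → cong (_* H σ) (row-step ss k (- + m) σ)) ⟩
    sumB (width (suc m)) (λ σ → F′ σ * H σ)
      ≡⟨ cong (λ L → sumB L (λ σ → F′ σ * H σ)) (width-suc m) ⟩
    sumB (suc (suc (width m))) (λ σ → F′ σ * H σ)
      ≡⟨ sumB-trimEnds (width m) dL dR F′ (completions m) ⟩
    sumB (width m) (λ σ → F′ (dL ∷ σ ++ dR ∷ []) * completions m σ)
      ≡⟨ sumB-cong (width m) (λ σ len → trans (cong (_* completions m σ) (frozen σ len)) (ℤₚ.*-assoc s _ (completions m σ))) ⟩
    sumB (width m) (λ σ → s * (spect ss′ (λ y → triangles k (suc k) (positions (start m) σ ++ y)) * completions m σ))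
      ≡⟨ sumB-* (width m) s _ ⟩
    s * sumB (width m) (λ σ → spect ss′ (λ y → triangles k (suc k) (positions (start m) σ ++ y)) * completions m σ)
      ≡⟨ cong (s *_) (pairing m (suc k) ss′) ⟩
    s * (rotationSign m (suc k) * spect (final m (suc k) ss′) (triangles (k ℕ.+ m) (suc k ℕ.+ m)))
      ≡⟨ ℤₚ.*-assoc s (rotationSign m (suc k)) _ ⟨
    s * rotationSign m (suc k) * spect (final m (suc k) ss′) (triangles (k ℕ.+ m) (suc k ℕ.+ m)) ∎
    where
    open ≡-Reasoning
    dL dR : Bool
    dL = tgt (- + m)
    dR = tgt (+ (l ℕ.+ m))
    s = if dL then sgn k else + 1
    F F′ H : List Bool → ℤ
    F σ = spect ss (λ y → triangles (ℕ.pred k) k (positions (- + m) σ ++ y))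
    F′ σ = spect (bump ss) (λ y → triangles k (suc k) (positions (- + m) σ ++ y))
    H σ = maybe′ (completions m) (+ 0) (trimEnds dL dR σ)
    ss₁ = freezeL dL (- + m - + suc k) (bump ss)
    ss′ = freezeR dR (+ (l ℕ.+ m)) ss₁
    frozen : ∀ σ → length σ ≡ width m → F′ (dL ∷ σ ++ dR ∷ []) ≡ s * spect ss′ (λ y → triangles k (suc k) (positions (start m) σ ++ y))
    frozen σ len = trans (freeze-left (bump ss) k dL m (σ ++ dR ∷ []))
      (cong (s *_) (freeze-right ss₁ (triangles k (suc k)) dR m σ len))

  completions-total : ∀ n → completions n (L.replicate (width n) false) ≡ rotationSign n 0 * spect (final n 0 []) (triangles (ℕ.pred n) n)
  completions-total n = trans (sym (trans (sumB-cong (width n) (λ σ _ → cong (_* completions n σ) (cong (triangles 0 0) (Lₚ.++-identityʳ (positions (start n) σ))))) (go (width n) (start n) (completions n)))) (pairing n 0 [])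
    where
    -- `triangles 0 0` is 1 on the empty list and 0 elsewhere: above the top row every column sum is
    -- 0.
    go : ∀ L c G → sumB L (λ σ → triangles 0 0 (positions c σ) * G σ) ≡ G (L.replicate L false)
    go zero    c G = ℤₚ.*-identityˡ (G [])
    go (suc L) c G = trans (cong₂ _+_ (go L (inc1 c) (λ σ → G (false ∷ σ))) (sumB-0 L (λ σ → ℤₚ.*-zeroˡ (G (true ∷ σ))))) (ℤₚ.+-identityʳ _)

-- Counting arrays by a state automaton

-- Alternation with a positive first nonzero entry says that the partial sums never leave {0, 1};
-- the Boolean is this partial sum.
step1 : Bool → Entry → Maybe Bool
step1 β     zer = just β
step1 false pos = just true
step1 true  pos = nothing
step1 false neg = nothing
step1 true  neg = just false

run : Bool → List Entry → Maybe Bool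
run β []       = just β
run β (e ∷ es) = step1 β e >>= λ β′ → run β′ es

-- A single pass tests the row horizontally and advances all column sums vertically.
stepRow : Bool → List Bool → List Entry → Maybe (List Bool)
stepRow h []      []       = if h then just [] else nothing
stepRow h []      (e ∷ es) = nothing
stepRow h (β ∷ σ) []       = nothing
stepRow h (β ∷ σ) (e ∷ es) = step1 h e >>= λ h′ → step1 β e >>= λ β′ → Maybe.map (β′ ∷_) (stepRow h′ σ es)

indicator : Bool → ℕ
indicator b = if b then 1 else 0

-- Cardinalities are sums of indicators over all arrays. A bijection with `Fin` is then built once
-- for a general predicate, and everything else is an equation between numbers.
sumVec : ∀ k → (Vec Entry k → ℕ) → ℕ
sumVec zero    f = f []
sumVec (suc k) f = sumVec k (f ∘ (neg ∷_)) ℕ.+ (sumVec k (f ∘ (zer ∷_)) ℕ.+ sumVec k (f ∘ (pos ∷_)))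

sumArr : ∀ {l} n → (Array l n → ℕ) → ℕ
sumArr zero    f = f []
sumArr (suc m) f = sumVec _ (λ r → sumArr m (λ A → f (r ∷ A)))

sumVec-cong : ∀ k {f g : Vec Entry k → ℕ} → (∀ r → f r ≡ g r) → sumVec k f ≡ sumVec k g
sumVec-cong zero    e = e []
sumVec-cong (suc k) e = cong₂ ℕ._+_ (sumVec-cong k (λ r → e _)) (cong₂ ℕ._+_ (sumVec-cong k (λ r → e _)) (sumVec-cong k (λ r → e _)))

sumArr-cong : ∀ {l} n {f g : Array l n → ℕ} → (∀ A → f A ≡ g A) → sumArr n f ≡ sumArr n g
sumArr-cong zero    e = e []
sumArr-cong {l} (suc m) e = sumVec-cong (l ℕ.+ 2 ℕ.* m ℕ.+ 1) (λ r → sumArr-cong m (λ A → e (r ∷ A)))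

sumVec-0 : ∀ k {f : Vec Entry k → ℕ} → (∀ r → f r ≡ 0) → sumVec k f ≡ 0
sumVec-0 zero    e = e []
sumVec-0 (suc k) e = cong₂ ℕ._+_ (sumVec-0 k (λ r → e _)) (cong₂ ℕ._+_ (sumVec-0 k (λ r → e _)) (sumVec-0 k (λ r → e _)))

sumArr-0 : ∀ {l} n → sumArr {l} n (λ _ → 0) ≡ 0
sumArr-0 zero    = refl
sumArr-0 {l} (suc m) = sumVec-0 (l ℕ.+ 2 ℕ.* m ℕ.+ 1) (λ r → sumArr-0 m)

card-Vec : ∀ k (P : Vec Entry k → Set) f → (∀ v → Fin (f v) ↔ P v) → Fin (sumVec k f) ↔ Σ (Vec Entry k) P
card-Vec zero    P f h = mk↔ₛ′ (λ p → [] , p) (λ { ([] , p) → p }) (λ { ([] , p) → refl }) (λ _ → refl) ↔-∘ h []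
card-Vec (suc k) P f h = split ↔-∘ ((card neg ⊎-↔ ((card zer ⊎-↔ card pos) ↔-∘ +↔⊎)) ↔-∘ +↔⊎)
  where
  Q : Entry → Set
  Q e = Σ (Vec Entry k) (λ v → P (e ∷ v))
  card : ∀ e → Fin (sumVec k (f ∘ (e ∷_))) ↔ Q e
  card e = card-Vec k (P ∘ (e ∷_)) (f ∘ (e ∷_)) (λ v → h (e ∷ v))
  split : (Q neg ⊎ (Q zer ⊎ Q pos)) ↔ Σ (Vec Entry (suc k)) P
  split = mk↔ₛ′
    (λ { (inj₁ (v , p)) → neg ∷ v , p ; (inj₂ (inj₁ (v , p))) → zer ∷ v , p ; (inj₂ (inj₂ (v , p))) → pos ∷ v , p })
    (λ { (neg ∷ v , p) → inj₁ (v , p) ; (zer ∷ v , p) → inj₂ (inj₁ (v , p)) ; (pos ∷ v , p) → inj₂ (inj₂ (v , p)) })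
    (λ { (neg ∷ v , p) → refl ; (zer ∷ v , p) → refl ; (pos ∷ v , p) → refl })
    (λ { (inj₁ (v , p)) → refl ; (inj₂ (inj₁ (v , p))) → refl ; (inj₂ (inj₂ (v , p))) → refl })

card-Array : ∀ {l} n (P : Array l n → Set) f → (∀ A → Fin (f A) ↔ P A) → Fin (sumArr n f) ↔ Σ (Array l n) P
card-Array zero    P f h = mk↔ₛ′ (λ p → [] , p) (λ { ([] , p) → p }) (λ { ([] , p) → refl }) (λ _ → refl) ↔-∘ h []
card-Array {l} (suc m) P f h = split
  ↔-∘ card-Vec _ Q _ (λ r → card-Array m (λ A → P (r ∷ A)) _ (λ A → h (r ∷ A)))
  where
  Q : Vec Entry (l ℕ.+ 2 ℕ.* m ℕ.+ 1) → Set
  Q r = Σ (Array l m) (λ A → P (r ∷ A))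
  split : Σ _ Q ↔ Σ (Array l (suc m)) P
  split = mk↔ₛ′ (λ { (r , A , p) → r ∷ A , p }) (λ { (r ∷ A , p) → r , A , p }) (λ { (r ∷ A , p) → refl }) (λ { (r , A , p) → refl })

card-T : ∀ b → Fin (indicator b) ↔ T b
card-T true  = mk↔ₛ′ (λ _ → tt) (λ _ → Fin.zero) (λ _ → refl) (λ { Fin.zero → refl ; (Fin.suc ()) })
card-T false = mk↔ₛ′ (λ ()) (λ ()) (λ ()) (λ ())

rowsum-Vec : ∀ k h σ H (G : Vec Entry k → ℕ) → length σ ≡ k →
  (∀ r → + G r ≡ maybe′ H (+ 0) (stepRow h σ (toList r))) → + sumVec k G ≡ rowsum h σ H
rowsum-Vec zero    false []      H G len e = e []
rowsum-Vec zero    true  []      H G len e = e []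
rowsum-Vec (suc k) h     (β ∷ σ) H G len e = trans (cong₂ _+_ (part neg) (cong₂ _+_ (part zer) (part pos))) (combine h β)
  where
  value : Bool → Bool → Entry → ℤ
  value h β e = maybe′ (λ h′ → maybe′ (λ β′ → rowsum h′ σ (λ τ → H (β′ ∷ τ))) (+ 0) (step1 β e)) (+ 0) (step1 h e)
  ih : ∀ h′ β′ G → (∀ r → + G r ≡ maybe′ H (+ 0) (Maybe.map (β′ ∷_) (stepRow h′ σ (toList r)))) → + sumVec k G ≡ rowsum h′ σ (λ τ → H (β′ ∷ τ))
  ih h′ β′ G e = rowsum-Vec k h′ σ (λ τ → H (β′ ∷ τ)) G (ℕₚ.suc-injective len) (λ r → trans (e r) (maybe-map H (+ 0) (β′ ∷_) (stepRow h′ σ (toList r))))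
  none : ∀ G → (∀ r → + G r ≡ + 0) → + sumVec k G ≡ + 0
  none G e = cong +_ (sumVec-0 k (λ r → ℤₚ.+-injective (e r)))
  part : ∀ d → + sumVec k (G ∘ (d ∷_)) ≡ value h β d
  part d = go (step1 h d) (step1 β d) (λ r → e (d ∷ r))
    where
    go : ∀ a b → (∀ r → + G (d ∷ r) ≡ maybe′ H (+ 0) (a >>= λ h′ → b >>= λ β′ → Maybe.map (β′ ∷_) (stepRow h′ σ (toList r)))) →
      + sumVec k (G ∘ (d ∷_)) ≡ maybe′ (λ h′ → maybe′ (λ β′ → rowsum h′ σ (λ τ → H (β′ ∷ τ))) (+ 0) b) (+ 0) a
    go (just h′) (just β′) e = ih h′ β′ _ e
    go (just h′) nothing   e = none _ e
    go nothing   b         e = none _ e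
  combine : ∀ h β → value h β neg + (value h β zer + value h β pos) ≡ rowsum h (β ∷ σ) H
  combine false false = ℤₚ.+-identityˡ _
  combine true  false = trans (ℤₚ.+-identityˡ _) (ℤₚ.+-identityʳ _)
  combine false true  = trans (ℤₚ.+-identityˡ _) (ℤₚ.+-identityʳ _)
  combine true  true  = cong+ˡ (rowsum false σ (λ τ → H (false ∷ τ))) (ℤₚ.+-identityʳ _)

stepRow-length : ∀ h σ es {σ′} → stepRow h σ es ≡ just σ′ → length σ′ ≡ length σ
stepRow-length true  []      []       refl = refl
stepRow-length false []      []       ()
stepRow-length h     (β ∷ σ) []       ()
stepRow-length h     (β ∷ σ) (e ∷ es) eq with step1 h e
... | just h′ with step1 β e
...   | just β′ with stepRow h′ σ es in eq′
stepRow-length h (β ∷ σ) (e ∷ es) refl | just h′ | just β′ | just τ = cong suc (stepRow-length h′ σ es eq′)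

eqB-≡ : ∀ {a b} → eqB a b ≡ true → a ≡ b
eqB-≡ {false} {false} _ = refl
eqB-≡ {true}  {true}  _ = refl

eqB-refl : ∀ a → eqB a a ≡ true
eqB-refl false = refl
eqB-refl true  = refl

matchLast-just : ∀ e σ {τ} → matchLast e σ ≡ just τ → σ ≡ τ ++ e ∷ []
matchLast-just e (b ∷ [])    eq with eqB b e in eb
matchLast-just e (b ∷ [])    refl | true = cong (_∷ []) (eqB-≡ eb)
matchLast-just e (b ∷ c ∷ σ) eq with matchLast e (c ∷ σ) in eq′
matchLast-just e (b ∷ c ∷ σ) refl | just τ = cong (b ∷_) (matchLast-just e (c ∷ σ) eq′)

matchLast-++ : ∀ e τ → matchLast e (τ ++ e ∷ []) ≡ just τ
matchLast-++ e []          rewrite eqB-refl e = refl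
matchLast-++ e (b ∷ [])    = cong (Maybe.map (b ∷_)) (matchLast-++ e [])
matchLast-++ e (b ∷ c ∷ τ) = cong (Maybe.map (b ∷_)) (matchLast-++ e (c ∷ τ))

trimEnds-just : ∀ d e σ {τ} → trimEnds d e σ ≡ just τ → σ ≡ d ∷ τ ++ e ∷ []
trimEnds-just d e (b ∷ σ) eq with eqB b d in eb
... | true = cong₂ _∷_ (eqB-≡ eb) (matchLast-just e σ eq)

trimEnds-++ : ∀ d e τ → trimEnds d e (d ∷ τ ++ e ∷ []) ≡ just τ
trimEnds-++ d e τ rewrite eqB-refl d = matchLast-++ e τ

nthB : List Bool → ℕ → Bool
nthB []      _       = false
nthB (b ∷ σ) zero    = b
nthB (b ∷ σ) (suc p) = nthB σ p

nthB-++ˡ : ∀ σ τ p → p ℕ.< length σ → nthB (σ ++ τ) p ≡ nthB σ p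
nthB-++ˡ (b ∷ σ) τ zero    _         = refl
nthB-++ˡ (b ∷ σ) τ (suc p) (ℕ.s≤s q) = nthB-++ˡ σ τ p q

nthB-last : ∀ σ e → nthB (σ ++ e ∷ []) (length σ) ≡ e
nthB-last []      e = refl
nthB-last (b ∷ σ) e = nthB-last σ e

nthB-allFalse : ∀ σ → T (allᵇ not σ) → ∀ p → nthB σ p ≡ false
nthB-allFalse []          _ p       = refl
nthB-allFalse (false ∷ σ) t zero    = refl
nthB-allFalse (false ∷ σ) t (suc p) = nthB-allFalse σ t p

allFalse-nthB : ∀ σ → (∀ p → p ℕ.< length σ → nthB σ p ≡ false) → T (allᵇ not σ)
allFalse-nthB []          h = tt
allFalse-nthB (false ∷ σ) h = allFalse-nthB σ (λ p q → h (suc p) (ℕ.s≤s q))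
allFalse-nthB (true ∷ σ)  h with h 0 (ℕ.s≤s ℕ.z≤n)
... | ()

snoc-view : ∀ σ n → length σ ≡ suc n → ∃ λ τ → length τ ≡ n × σ ≡ τ ++ nthB σ n ∷ []
snoc-view (b ∷ [])    zero    refl = [] , refl , refl
snoc-view (b ∷ c ∷ σ) (suc n) len with snoc-view (c ∷ σ) n (ℕₚ.suc-injective len)
... | τ , lτ , eq = b ∷ τ , cong suc lτ , cong (b ∷_) eq

run-++ : ∀ β xs ys → run β (xs ++ ys) ≡ (run β xs >>= λ β′ → run β′ ys)
run-++ β []       ys = refl
run-++ β (x ∷ xs) ys with step1 β x
... | just β′ = run-++ β′ xs ys
... | nothing = refl

stepRow-sound : ∀ h σ es {σ′} → stepRow h σ es ≡ just σ′ →
  run h es ≡ just true × (∀ p → p ℕ.< length σ → run (nthB σ p) (take 1 (drop p es)) ≡ just (nthB σ′ p))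
stepRow-sound true []      []       refl = refl , λ _ ()
stepRow-sound false []     []       ()
stepRow-sound h    (β ∷ σ) []       ()
stepRow-sound h    (β ∷ σ) (e ∷ es) eq with step1 h e
... | just h′ with step1 β e in eβ
...   | just β′ with stepRow h′ σ es in eq′
stepRow-sound h (β ∷ σ) (e ∷ es) refl | just h′ | just β′ | just τ with stepRow-sound h′ σ es eq′
... | r , c = r , λ { zero _ → cong (_>>= just) eβ ; (suc p) (ℕ.s≤s q) → c p q }

stepRow-complete : ∀ h σ es → length σ ≡ length es → run h es ≡ just true →
  (∀ p → p ℕ.< length σ → ∃ λ β → run (nthB σ p) (take 1 (drop p es)) ≡ just β) →
  ∃ λ σ′ → stepRow h σ es ≡ just σ′
stepRow-complete true  []      []       len r c = [] , refl
stepRow-complete h     (β ∷ σ) (e ∷ es) len r c with step1 h e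
... | just h′ with step1 β e | c 0 (ℕ.s≤s ℕ.z≤n)
...   | just β′ | _ with stepRow-complete h′ σ es (ℕₚ.suc-injective len) r (λ p q → c (suc p) (ℕ.s≤s q))
...     | σ′ , eq rewrite eq = β′ ∷ σ′ , refl

-- Columns of an array and correctness of the automaton

mutual
  -- Places are counted from the left end of the topmost row. The row below starts one column
  -- further right, whence the shift in `below`.
  colN : ∀ {l n} → Array l n → ℕ → List Entry
  colN []      p = []
  colN (r ∷ A) p = take 1 (drop p (toList r)) ++ below A p

  below : ∀ {l n} → Array l n → ℕ → List Entry
  below A zero    = []
  below A (suc p) = colN A p

RowsOK : ∀ {l n} → Array l n → Set
RowsOK []      = ⊤
RowsOK (r ∷ A) = run false (toList r) ≡ just true × RowsOK A

module Valid (l : ℕ) (1≤l : 1 ℕ.≤ l) (tgt : ℤ → Bool) (tgt-central : ∀ p → p ℕ.< l ∸ 1 → tgt (+ 1 + + p) ≡ false) where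
  open Count l 1≤l tgt

  valid : ∀ {m} → List Bool → Array l m → Bool
  valid σ []              = allᵇ not σ
  valid σ (_∷_ {m} r A) = maybe′ (λ σ′ → maybe′ (λ τ → valid τ A) false (trimEnds (tgt (- + m)) (tgt (+ (l ℕ.+ m))) σ′)) false (stepRow false σ (toList r))

  completions-valid : ∀ m σ → length σ ≡ width m → + sumArr m (λ A → indicator (valid σ A)) ≡ completions m σ
  completions-valid zero    σ len with allᵇ not σ
  ... | true  = refl
  ... | false = refl
  completions-valid (suc m) σ len = rowsum-Vec (width (suc m)) false σ _ _ len row
    where
    dL = tgt (- + m)
    dR = tgt (+ (l ℕ.+ m))
    row : ∀ r → + sumArr m (λ A → indicator (valid σ (r ∷ A))) ≡ maybe′ (λ σ′ → maybe′ (completions m) (+ 0) (trimEnds dL dR σ′)) (+ 0) (stepRow false σ (toList r))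
    row r with stepRow false σ (toList r) in e₁
    ... | nothing = cong +_ (sumArr-0 m)
    ... | just σ′ with trimEnds dL dR σ′ in e₂
    ...   | nothing = cong +_ (sumArr-0 m)
    ...   | just τ  = completions-valid m τ (ℕₚ.suc-injective (ℕₚ.suc-injective (begin
      suc (suc (length τ))         ≡⟨ cong suc (trans (ℕₚ.+-comm 1 (length τ)) (sym (Lₚ.length-++ τ))) ⟩
      length (dL ∷ τ ++ dR ∷ [])   ≡⟨ cong length (trimEnds-just dL dR σ′ e₂) ⟨
      length σ′                    ≡⟨ stepRow-length false σ (toList r) e₁ ⟩
      length σ                     ≡⟨ trans len (width-suc m) ⟩
      suc (suc (width m))          ∎)))
      where open ≡-Reasoning

  ColsOK : ∀ {m} → List Bool → Array l m → Set
  ColsOK {m} σ A = ∀ p → p ℕ.< width m → run (nthB σ p) (colN A p) ≡ just (tgt (start m + + p))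

  colN-out : ∀ {m} (A : Array l m) p → width m ℕ.≤ p → colN A p ≡ []
  colN-out []            p       q = refl
  colN-out (_∷_ {m} r A) p       q = cong₂ _++_ (cong (take 1) (Lₚ.drop-all p (toList r) (subst (ℕ._≤ p) (sym (Vₚ.length-toList r)) q))) (lower p (subst (ℕ._≤ p) (width-suc m) q))
    where
    lower : ∀ p → suc (suc (width m)) ℕ.≤ p → below A p ≡ []
    lower (suc p) (ℕ.s≤s q) = colN-out A p (ℕₚ.<⇒≤ q)

  start-suc : ∀ m p → start (suc m) + + suc p ≡ start m + + p
  start-suc m p = trans (sym (ℤₚ.+-assoc (start (suc m)) (+ 1) (+ p))) (cong (λ t → t + + p) (inc-start m))

  valid-sound : ∀ {m} σ (A : Array l m) → length σ ≡ width m → T (valid σ A) → RowsOK A × ColsOK σ A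
  valid-sound σ [] len t = tt , λ p q → cong just (trans (nthB-allFalse σ t p) (sym (tgt-central p q)))
  valid-sound σ (_∷_ {m} r A) len t with stepRow false σ (toList r) in e₁
  ... | just σ′ with trimEnds (tgt (- + m)) (tgt (+ (l ℕ.+ m))) σ′ in e₂
  ...   | just τ with trimEnds-just (tgt (- + m)) (tgt (+ (l ℕ.+ m))) σ′ e₂ | stepRow-sound false σ (toList r) e₁
  ...     | refl | rok , cok = (rok , proj₁ ih) , cols
    where
    dL = tgt (- + m)
    dR = tgt (+ (l ℕ.+ m))
    lenτ : length τ ≡ width m
    lenτ = ℕₚ.suc-injective (ℕₚ.suc-injective (trans (cong suc (trans (ℕₚ.+-comm 1 (length τ)) (sym (Lₚ.length-++ τ))))
      (trans (stepRow-length false σ (toList r) e₁) (trans len (width-suc m)))))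
    ih = valid-sound τ A lenτ t
    lower : ∀ p → p ℕ.< suc (suc (width m)) → run (nthB (dL ∷ τ ++ dR ∷ []) p) (below A p) ≡ just (tgt (start (suc m) + + p))
    lower zero    q = cong (just ∘ tgt) (sym (ℤₚ.+-identityʳ (- + m)))
    lower (suc p) (ℕ.s≤s q) with p ℕ.<? width m
    ... | yes p<w = trans (cong (λ b → run b (colN A p)) (nthB-++ˡ τ _ p (subst (p ℕ.<_) (sym lenτ) p<w)))
      (trans (proj₂ ih p p<w) (cong (just ∘ tgt) (sym (start-suc m p))))
    -- The right end column: it has no entries in the lower rows, so its present state is its final
    -- one.
    ... | no p≮w = trans (cong (run (nthB (τ ++ dR ∷ []) p)) (colN-out A p (ℕₚ.≮⇒≥ p≮w)))
      (cong just (trans (cong (nthB (τ ++ dR ∷ [])) (trans p≡w (sym lenτ))) (trans (nthB-last τ dR)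
        (cong tgt (sym (trans (start-suc m p) (trans (cong (λ t → start m + + t) p≡w) (start+width m))))))))
      where
      p≡w : p ≡ width m
      p≡w = ℕₚ.≤-antisym (ℕₚ.≤-pred q) (ℕₚ.≮⇒≥ p≮w)
    cols : ColsOK σ (r ∷ A)
    cols p q = trans (run-++ (nthB σ p) (take 1 (drop p (toList r))) (below A p))
      (trans (cong (_>>= λ β → run β (below A p)) (cok p (subst (p ℕ.<_) (sym len) q)))
      (lower p (subst (p ℕ.<_) (width-suc m) q)))

  bind-just : ∀ {A B : Set} (m : Maybe A) (f : A → Maybe B) {b} → (m >>= f) ≡ just b → ∃ λ a → m ≡ just a
  bind-just (just a) f eq = a , refl

  valid-complete : ∀ {m} σ (A : Array l m) → length σ ≡ width m → RowsOK A → ColsOK σ A → T (valid σ A)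
  valid-complete σ [] len rows cols = allFalse-nthB σ (λ p q → just-injective (trans (cols p (subst (p ℕ.<_) len q)) (cong just (tgt-central p (subst (p ℕ.<_) len q)))))
  valid-complete σ (_∷_ {m} r A) len (rok , rows) cols with stepRow-complete false σ (toList r) (trans len (sym (Vₚ.length-toList r))) rok
      (λ p q → bind-just (run (nthB σ p) (take 1 (drop p (toList r)))) _ (trans (sym (run-++ (nthB σ p) (take 1 (drop p (toList r))) (below A p))) (cols p (subst (p ℕ.<_) len q))))
  ... | σ′ , e₁ rewrite e₁ = subst (λ M → T (maybe′ (λ τ → valid τ A) false M)) (sym trimmed) (valid-complete τ A lenτ rows cols′)
    where
    dL = tgt (- + m)
    dR = tgt (+ (l ℕ.+ m))
    len′ : length σ′ ≡ suc (suc (width m))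
    len′ = trans (stepRow-length false σ (toList r) e₁) (trans len (width-suc m))
    lower : ∀ p → p ℕ.< suc (suc (width m)) → run (nthB σ′ p) (below A p) ≡ just (tgt (start (suc m) + + p))
    lower p q = trans (sym (trans (run-++ (nthB σ p) (take 1 (drop p (toList r))) (below A p))
        (cong (_>>= λ β → run β (below A p)) (proj₂ (stepRow-sound false σ (toList r) e₁) p (subst (p ℕ.<_) (sym (trans len (width-suc m))) q)))))
      (cols p (subst (p ℕ.<_) (sym (width-suc m)) q))
    ends : ∀ σ′ → length σ′ ≡ suc (suc (width m)) → (∀ p → p ℕ.< suc (suc (width m)) → run (nthB σ′ p) (below A p) ≡ just (tgt (start (suc m) + + p))) →
      ∃ λ τ → length τ ≡ width m × σ′ ≡ dL ∷ τ ++ dR ∷ []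
    ends (b ∷ ρ) ln lw with snoc-view ρ (width m) (ℕₚ.suc-injective ln)
    ... | τ , lτ , eq = τ , lτ , cong₂ _∷_
      (just-injective (trans (lw 0 (ℕ.s≤s ℕ.z≤n)) (cong (just ∘ tgt) (ℤₚ.+-identityʳ (- + m)))))
      (trans eq (cong (λ d → τ ++ d ∷ []) (just-injective (trans (sym (cong (run (nthB ρ (width m))) (colN-out A (width m) ℕₚ.≤-refl)))
        (trans (lw (suc (width m)) ℕₚ.≤-refl) (cong (just ∘ tgt) (trans (start-suc m (width m)) (start+width m))))))))
    E = ends σ′ len′ lower
    τ = proj₁ E
    lenτ : length τ ≡ width m
    lenτ = proj₁ (proj₂ E)
    trimmed : trimEnds dL dR σ′ ≡ just τ
    trimmed = trans (cong (trimEnds dL dR) (proj₂ (proj₂ E))) (trimEnds-++ dL dR τ)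
    cols′ : ColsOK τ A
    cols′ p q = trans (sym (trans (cong (λ s → run (nthB s (suc p)) (colN A p)) (proj₂ (proj₂ E))) (cong (λ b → run b (colN A p)) (nthB-++ˡ τ _ p (subst (p ℕ.<_) (sym lenτ) q)))))
      (trans (lower (suc p) (ℕ.s≤s (ℕₚ.m≤n⇒m≤1+n q))) (cong (just ∘ tgt) (start-suc m p)))

-- The Boolean conditions of the definition as runs of the automaton

∧-intro : ∀ {a b} → T a → T b → T (a ∧ b)
∧-intro {true} _ t = t

∧-elim : ∀ {a b} → T (a ∧ b) → T a × T b
∧-elim {true} t = tt , t

T-ext : ∀ {a b} → (T a → T b) → (T b → T a) → a ≡ b
T-ext {false} {false} f g = refl
T-ext {false} {true}  f g = ⊥-elim (g tt)
T-ext {true}  {false} f g = ⊥-elim (f tt)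
T-ext {true}  {true}  f g = refl

==-sound : ∀ x y → T (x == y) → x ≡ y
==-sound x y t with x ℤ.≟ y
... | yes p = p

∈ᵇ⇒∈ : ∀ x xs → T (x ∈ᵇ xs) → x ∈ xs
∈ᵇ⇒∈ x (y ∷ ys) t with x ℤ.≟ y
... | yes p = here p
... | no _  = there (∈ᵇ⇒∈ x ys t)

∈⇒∈ᵇ : ∀ x xs → x ∈ xs → T (x ∈ᵇ xs)
∈⇒∈ᵇ x (y ∷ ys) m with x ℤ.≟ y
∈⇒∈ᵇ x (y ∷ ys) m         | yes p = tt
∈⇒∈ᵇ x (y ∷ ys) (here p)  | no ne = ⊥-elim (ne p)
∈⇒∈ᵇ x (y ∷ ys) (there m) | no _  = ∈⇒∈ᵇ x ys m

allᵇ-elim : ∀ {A : Set} (p : A → Bool) xs → T (allᵇ p xs) → ∀ {x} → x ∈ xs → T (p x)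
allᵇ-elim p (x ∷ xs) t (here refl) = proj₁ (∧-elim t)
allᵇ-elim p (x ∷ xs) t (there m)   = allᵇ-elim p xs (proj₂ (∧-elim {p x} t)) m

allᵇ-intro : ∀ {A : Set} (p : A → Bool) xs → (∀ {x} → x ∈ xs → T (p x)) → T (allᵇ p xs)
allᵇ-intro p []       h = tt
allᵇ-intro p (x ∷ xs) h = ∧-intro (h (here refl)) (allᵇ-intro p xs (h ∘ there))

∈-range⁺ : ∀ a k p → p ℕ.< k → a + + p ∈ range a k
∈-range⁺ a (suc k) zero    _         = here (ℤₚ.+-identityʳ a)
∈-range⁺ a (suc k) (suc p) (ℕ.s≤s q) = there (subst (_∈ range (a + + 1) k) (ℤₚ.+-assoc a (+ 1) (+ p)) (∈-range⁺ (a + + 1) k p q))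

∈-range⁻ : ∀ a k {x} → x ∈ range a k → ∃ λ p → p ℕ.< k × x ≡ a + + p
∈-range⁻ a (suc k) (here eq) = 0 , ℕ.s≤s ℕ.z≤n , trans eq (sym (ℤₚ.+-identityʳ a))
∈-range⁻ a (suc k) (there m) with ∈-range⁻ (a + + 1) k m
... | p , q , eq = suc p , ℕ.s≤s q , trans eq (ℤₚ.+-assoc a (+ 1) (+ p))

alternates-pos : ∀ es → alternatesᵇ (map val (pos ∷ es)) ≡ is-just (run true es)
alternates-neg : ∀ es → alternatesᵇ (map val (neg ∷ es)) ≡ is-just (run false es)
alternates-pos []         = refl
alternates-pos (zer ∷ es) = alternates-pos es
alternates-pos (pos ∷ es) = refl
alternates-pos (neg ∷ es) = alternates-neg es
alternates-neg []         = refl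
alternates-neg (zer ∷ es) = alternates-neg es
alternates-neg (pos ∷ es) = alternates-pos es
alternates-neg (neg ∷ es) = refl

alternates-first : ∀ es → (alternatesᵇ (map val es) ∧ firstPositiveᵇ (map val es)) ≡ is-just (run false es)
alternates-first []         = refl
alternates-first (zer ∷ es) = alternates-first es
alternates-first (pos ∷ es) = trans (Bₚ.∧-identityʳ _) (alternates-pos es)
alternates-first (neg ∷ es) = Bₚ.∧-zeroʳ _

is-just-run : ∀ {β es} → T (is-just (run β es)) → ∃ λ β′ → run β es ≡ just β′
is-just-run {β} {es} t with run β es
... | just β′ = β′ , refl

run-sum : ∀ β es {β′} → run β es ≡ just β′ → bit β + sumℤ (map val es) ≡ bit β′
run-sum β     []         refl = ℤₚ.+-identityʳ (bit β)
run-sum β     (zer ∷ es) eq   = trans (cong+ˡ (bit β) (ℤₚ.+-identityˡ _)) (run-sum β es eq)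
run-sum false (pos ∷ es) eq   = trans (ℤₚ.+-identityˡ _) (run-sum true es eq)
run-sum true  (neg ∷ es) eq   = trans (sym (ℤₚ.+-assoc (+ 1) (- + 1) (sumℤ (map val es)))) (run-sum false es eq)

-- An alternating row that starts with -1 has sum -1 or 0. Row sum 1 therefore forces a positive
-- start, and rows can be read by the same automaton as columns.
alternates-cases : ∀ es → T (alternatesᵇ (map val es)) →
  (∃ λ β → run false es ≡ just β) ⊎ (∃ λ β → sumℤ (map val es) ≡ - + 1 + bit β)
alternates-cases []         t = inj₁ (false , refl)
alternates-cases (zer ∷ es) t with alternates-cases es t
... | inj₁ r        = inj₁ r
... | inj₂ (β , eq) = inj₂ (β , trans (ℤₚ.+-identityˡ _) eq)
alternates-cases (pos ∷ es) t = inj₁ (is-just-run {true} {es} (subst T (alternates-pos es) t))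
alternates-cases (neg ∷ es) t with is-just-run {false} {es} (subst T (alternates-neg es) t)
... | β , eq = inj₂ (β , cong+ˡ (- + 1) (trans (sym (ℤₚ.+-identityˡ (sumℤ (map val es)))) (run-sum false es eq)))

row-sound : ∀ es → T ((sumℤ (map val es) == + 1) ∧ alternatesᵇ (map val es)) → run false es ≡ just true
row-sound es t with ∧-elim t
... | t₁ , t₂ with ==-sound (sumℤ (map val es)) (+ 1) t₁ | alternates-cases es t₂
...   | s≡1 | inj₁ (true , eq)  = eq
...   | s≡1 | inj₁ (false , eq) with trans (sym (run-sum false es eq)) (trans (ℤₚ.+-identityˡ _) s≡1)
...     | ()
row-sound es t | t₁ , t₂ | s≡1 | inj₂ (true , eq) with trans (sym eq) s≡1
... | ()
row-sound es t | t₁ , t₂ | s≡1 | inj₂ (false , eq) with trans (sym eq) s≡1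
... | ()

row-complete : ∀ es → run false es ≡ just true → T ((sumℤ (map val es) == + 1) ∧ alternatesᵇ (map val es))
row-complete es eq = ∧-intro {sumℤ (map val es) == + 1}
  (subst (λ s → T (s == + 1)) (sym (trans (sym (ℤₚ.+-identityˡ (sumℤ (map val es)))) (run-sum false es eq))) tt)
  (proj₁ (∧-elim {alternatesᵇ (map val es)} (subst T (sym (trans (alternates-first es) (cong is-just eq))) tt)))

take-map : ∀ {A B : Set} (f : A → B) i xs → take i (map f xs) ≡ map f (take i xs)
take-map f zero    xs       = refl
take-map f (suc i) []       = refl
take-map f (suc i) (x ∷ xs) = cong (f x ∷_) (take-map f i xs)

entryAt-+ : ∀ {k} m (r : Vec Entry k) c p → c + + m ≡ + p → entryAt m r c ≡ map val (take 1 (drop p (toList r)))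
entryAt-+ m r c p eq with c + + m
entryAt-+ m r c p refl | .(+ p) = trans (cong (take 1) (drop-map val p (toList r))) (take-map val 1 (drop p (toList r)))

column-left : ∀ {l m} (A : Array l m) c → c ℤ.≤ - + m → column A c ≡ []
column-left []            c c≤ = refl
column-left (_∷_ {m} r A) c c≤ = cong₂ _++_ ent (column-left A c (ℤₚ.≤-trans c≤ (ℤₚ.neg-mono-≤ (ℤ.+≤+ (ℕₚ.n≤1+n m)))))
  where
  lem : ∀ x → - (+ 1 + x) + x ≡ - + 1
  lem = solve-∀
  bound : c + + m ℤ.≤ - + 1
  bound = subst (c + + m ℤ.≤_) (lem (+ m)) (ℤₚ.+-monoˡ-≤ (+ m) c≤)
  ent : entryAt m r c ≡ []
  ent with c + + m | bound
  ... | -[1+ _ ] | _ = refl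

indicator-cong : ∀ {a b} → (T a → T b) → (T b → T a) → indicator a ≡ indicator b
indicator-cong f g = cong indicator (T-ext f g)

-- The condition on the positive columns as prescribed column sums

module Cond (n l : ℕ) (1≤l : 1 ℕ.≤ l) (S : List ℤ) where

  -- Inverts the relabelling in `𝒮`: a column c ≤ 0 stands for the element c - 1, a column c ≥ l for
  -- c - (l - 1), and the central columns between them have sum 0.
  tgt : ℤ → Bool
  tgt (+ zero)  = (- + 1) ∈ᵇ S
  tgt -[1+ m ]  = -[1+ suc m ] ∈ᵇ S
  tgt (+ suc q) = if does (l ℕ.≤? suc q) then (+ suc q - + (l ∸ 1)) ∈ᵇ S else false

  tgt-left : ∀ j → tgt (- + j) ≡ -[1+ j ] ∈ᵇ S
  tgt-left zero    = refl
  tgt-left (suc j) = refl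

  tgt-right : ∀ j → tgt (+ (l ℕ.+ j)) ≡ (+ suc j) ∈ᵇ S
  tgt-right j = go l 1≤l refl
    where
    go : ∀ l′ → 1 ℕ.≤ l′ → l ≡ l′ → tgt (+ (l′ ℕ.+ j)) ≡ (+ suc j) ∈ᵇ S
    go (suc l′) _ refl = trans
      (cong (λ b → if b then (+ suc (l′ ℕ.+ j) - + l′) ∈ᵇ S else false) (dec-true (suc l′ ℕ.≤? suc (l′ ℕ.+ j)) (ℕ.s≤s (ℕₚ.m≤m+n l′ j))))
      (cong (_∈ᵇ S) (lem (+ l′) (+ j)))
      where
      lem : ∀ a b → + 1 + (a + b) - a ≡ + 1 + b
      lem = solve-∀

  tgt-central : ∀ q → q ℕ.< l ∸ 1 → tgt (+ 1 + + q) ≡ false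
  tgt-central q q<l = cong (λ b → if b then (+ suc q - + (l ∸ 1)) ∈ᵇ S else false)
    (dec-false (l ℕ.≤? suc q) (λ l≤ → ℕₚ.<⇒≱ q<l (ℕₚ.∸-monoˡ-≤ 1 l≤)))

  open Count l 1≤l tgt
  open Valid l 1≤l tgt tgt-central

  column-colN : ∀ {m} (A : Array l m) p → column A (start m + + p) ≡ map val (colN A p)
  column-colN []            p = refl
  column-colN (_∷_ {m} r A) p = trans (cong₂ _++_ (entryAt-+ m r (- + m + + p) p (lem (+ m) (+ p))) (lower p))
    (sym (Lₚ.map-++ val (take 1 (drop p (toList r))) (below A p)))
    where
    lem : ∀ x y → - x + y + x ≡ y
    lem = solve-∀
    lower : ∀ p → column A (- + m + + p) ≡ map val (below A p)
    lower zero    = column-left A _ (ℤₚ.≤-reflexive (ℤₚ.+-identityʳ (- + m)))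
    lower (suc p) = trans (cong (column A) (start-suc m p)) (column-colN A p)

  start≡ : ∀ m → start m ≡ - + m + + 1
  start≡ zero    = refl
  start≡ (suc m) = lem (+ m)
    where
    lem : ∀ x → - x ≡ - (+ 1 + x) + + 1
    lem = solve-∀

  width≡ : ∀ m → width m ≡ l ℕ.+ 2 ℕ.* m ∸ 1
  width≡ zero    = cong (_∸ 1) (sym (ℕₚ.+-identityʳ l))
  width≡ (suc m) = cong (_∸ 1) (lem l m)
    where
    lem : ∀ l m → suc (l ℕ.+ 2 ℕ.* m ℕ.+ 1) ≡ l ℕ.+ 2 ℕ.* suc m
    lem = solveℕ-∀

  data Column : ℤ → Set where
    left    : ∀ j → j ℕ.< n → Column (- + j)
    central : ∀ q → q ℕ.< l ∸ 1 → Column (+ 1 + + q)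
    right   : ∀ j → j ℕ.< n → Column (+ (l ℕ.+ j))

  column-left′ : ∀ p → p ℕ.< n → Column (- + n + + 1 + + p)
  column-left′ p p<n = subst Column eq (left (n ∸ suc p) (ℕₚ.∸-monoʳ-< {o = 0} (ℕ.s≤s ℕ.z≤n) p<n))
    where
    lem : ∀ a b → - a ≡ - (+ 1 + b + a) + + 1 + b
    lem = solve-∀
    eq : - + (n ∸ suc p) ≡ - + n + + 1 + + p
    eq = trans (lem (+ (n ∸ suc p)) (+ p)) (cong (λ t → - + t + + 1 + + p) (ℕₚ.m+[n∸m]≡n p<n))

  l≡ : suc (l ∸ 1) ≡ l
  l≡ = ℕₚ.m+[n∸m]≡n 1≤l

  column-right′ : ∀ q → q ℕ.< l ℕ.+ n ∸ 1 → Column (+ 1 + + q)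
  column-right′ q q< with q ℕ.<? l ∸ 1
  ... | yes q<l = central q q<l
  ... | no q≮l  = subst Column (cong +_ eq) (right j j<n)
    where
    j = q ∸ (l ∸ 1)
    q≡ : l ∸ 1 ℕ.+ j ≡ q
    q≡ = ℕₚ.m+[n∸m]≡n (ℕₚ.≮⇒≥ q≮l)
    eq : l ℕ.+ j ≡ suc q
    eq = trans (cong (ℕ._+ j) (sym l≡)) (cong suc q≡)
    j<n : j ℕ.< n
    j<n = ℕₚ.+-cancelˡ-< (l ∸ 1) j n (subst (ℕ._< l ∸ 1 ℕ.+ n) (sym q≡) (subst (q ℕ.<_) (cong (λ t → t ℕ.+ n ∸ 1) (sym l≡)) q<))

  width-n : width n ≡ n ℕ.+ (l ∸ 1 ℕ.+ n)
  width-n = trans (width≡ n) (trans (cong (λ t → t ℕ.+ 2 ℕ.* n ∸ 1) (sym l≡)) (arith (l ∸ 1) n))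
    where
    arith : ∀ l′ n → l′ ℕ.+ 2 ℕ.* n ≡ n ℕ.+ (l′ ℕ.+ n)
    arith = solveℕ-∀

  l+n∸1 : l ℕ.+ n ∸ 1 ≡ l ∸ 1 ℕ.+ n
  l+n∸1 = cong (λ t → t ℕ.+ n ∸ 1) (sym l≡)

  start-n+ : ∀ q → start n + + (n ℕ.+ q) ≡ + 1 + + q
  start-n+ q = trans (cong (λ s → s + + (n ℕ.+ q)) (start≡ n)) (lem (+ n) (+ q))
    where
    lem : ∀ a b → - a + + 1 + (a + b) ≡ + 1 + b
    lem = solve-∀

  classify : ∀ p → p ℕ.< width n → Column (start n + + p)
  classify p p<w with p ℕ.<? n
  ... | yes p<n = subst Column (cong (λ s → s + + p) (sym (start≡ n))) (column-left′ p p<n)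
  ... | no p≮n  = subst Column (trans (sym (start-n+ (p ∸ n))) (cong (λ t → start n + + t) p≡)) (column-right′ (p ∸ n) q<)
    where
    p≡ : n ℕ.+ (p ∸ n) ≡ p
    p≡ = ℕₚ.m+[n∸m]≡n (ℕₚ.≮⇒≥ p≮n)
    q< : p ∸ n ℕ.< l ℕ.+ n ∸ 1
    q< = subst (p ∸ n ℕ.<_) (sym l+n∸1) (ℕₚ.+-cancelˡ-< n _ _ (≡.subst₂ ℕ._<_ (sym p≡) width-n p<w))

  index-right : ∀ q → q ℕ.< l ∸ 1 ℕ.+ n → ∃ λ p → p ℕ.< width n × + 1 + + q ≡ start n + + p
  index-right q q< = n ℕ.+ q , subst (n ℕ.+ q ℕ.<_) (sym width-n) (ℕₚ.+-monoʳ-< n q<) , sym (start-n+ q)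

  index : ∀ {c} → Column c → ∃ λ p → p ℕ.< width n × c ≡ start n + + p
  index (left j j<n) = n ∸ suc j
    , ℕₚ.<-≤-trans (ℕₚ.∸-monoʳ-< {o = 0} (ℕ.s≤s ℕ.z≤n) j<n) (subst (n ℕ.≤_) (sym width-n) (ℕₚ.m≤m+n n _))
    , trans (lem (+ j) (+ (n ∸ suc j))) (cong (λ s → s + + (n ∸ suc j)) (trans (cong (λ t → - + t + + 1) (ℕₚ.m+[n∸m]≡n j<n)) (sym (start≡ n))))
    where
    lem : ∀ a b → - a ≡ - (+ 1 + a + b) + + 1 + b
    lem = solve-∀
  index (central q q<) = index-right q (ℕₚ.<-≤-trans q< (ℕₚ.m≤m+n _ n))
  index (right j j<n) with index-right (l ∸ 1 ℕ.+ j) (ℕₚ.+-monoʳ-< (l ∸ 1) j<n)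
  ... | p , p< , eq = p , p< , trans (cong +_ (cong (ℕ._+ j) (sym l≡))) eq

  -- 𝒮 filters with a function local to its definition; unification in select-unify gives it a name.
  mutual
    select : {l n : ℕ} (A : Array l n) → List ℤ → List ℤ
    select A xs = _

    select-unify : {l n : ℕ} (A : Array l n) → range (- (+ n) + + 1) n ≡ [] → 𝒮 A ≡ + 0 ∷ map (λ c → c - + (l ∸ 1)) (select A (range (+ 1) (l ℕ.+ n ∸ 1)))
    select-unify {l} {n} A with range (- (+ n) + + 1) n | range (+ 1) (l ℕ.+ n ∸ 1)
    ... | []    | ys = λ _ → refl
    ... | _ ∷ _ | ys = λ ()

  module _ (A : Array l n) where
    private
      pb : ℤ → Bool
      pb = positiveSumᵇ A

    ∈-select⁺ : ∀ {c} xs → c ∈ xs → T (pb c) → c ∈ select A xs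
    ∈-select⁺ (x ∷ xs) m t with positiveSumᵇ A x in eq
    ∈-select⁺ (x ∷ xs) (here refl) t | true  = here refl
    ∈-select⁺ (x ∷ xs) (there m)   t | true  = there (∈-select⁺ xs m t)
    ∈-select⁺ (x ∷ xs) (here refl) t | false = ⊥-elim (subst T eq t)
    ∈-select⁺ (x ∷ xs) (there m)   t | false = ∈-select⁺ xs m t

    ∈-select⁻ : ∀ {c} xs → c ∈ select A xs → c ∈ xs × T (pb c)
    ∈-select⁻ (x ∷ xs) m with positiveSumᵇ A x in eq
    ∈-select⁻ (x ∷ xs) (here refl) | true = here refl , subst T (sym eq) tt
    ∈-select⁻ (x ∷ xs) (there m)   | true with ∈-select⁻ xs m
    ... | i , t = there i , t
    ∈-select⁻ (x ∷ xs) m           | false with ∈-select⁻ xs m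
    ... | i , t = there i , t

    leftRange rightRange : List ℤ
    leftRange = range (- (+ n) + + 1) n
    rightRange = range (+ 1) (l ℕ.+ n ∸ 1)

    ∈𝒮-left : ∀ j → j ℕ.< n → T (pb (- + j)) → -[1+ j ] ∈ 𝒮 A
    ∈𝒮-left j j<n t = there (∈-++⁺ˡ (subst (_∈ map (λ c → c - + 1) (select A leftRange)) (lem (+ j))
        (∈-map⁺ (λ c → c - + 1) (∈-select⁺ leftRange mem t))))
      where
      lem : ∀ x → - x - + 1 ≡ - (+ 1 + x)
      lem = solve-∀
      lem′ : ∀ a b → - (+ 1 + a + b) + + 1 + b ≡ - a
      lem′ = solve-∀
      mem : - + j ∈ leftRange
      mem = subst (_∈ leftRange) (trans (cong (λ t → - + t + + 1 + + (n ∸ suc j)) (sym (ℕₚ.m+[n∸m]≡n j<n))) (lem′ (+ j) (+ (n ∸ suc j))))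
        (∈-range⁺ (- (+ n) + + 1) n (n ∸ suc j) (ℕₚ.∸-monoʳ-< {o = 0} (ℕ.s≤s ℕ.z≤n) j<n))

    ∈𝒮-right : ∀ j → j ℕ.< n → T (pb (+ (l ℕ.+ j))) → + suc j ∈ 𝒮 A
    ∈𝒮-right j j<n t = there (∈-++⁺ʳ (map (λ c → c - + 1) (select A leftRange)) (subst (_∈ map (λ c → c - + (l ∸ 1)) (select A rightRange))
        (trans (cong (λ t → + t - + (l ∸ 1)) (cong (ℕ._+ j) (sym l≡))) (lem (+ (l ∸ 1)) (+ j)))
        (∈-map⁺ (λ c → c - + (l ∸ 1)) (∈-select⁺ rightRange mem t))))
      where
      lem : ∀ a b → + 1 + a + b - a ≡ + 1 + b
      lem = solve-∀
      mem : + (l ℕ.+ j) ∈ rightRange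
      mem = subst (_∈ rightRange) (cong +_ (cong (ℕ._+ j) l≡))
        (∈-range⁺ (+ 1) (l ℕ.+ n ∸ 1) (l ∸ 1 ℕ.+ j) (subst (l ∸ 1 ℕ.+ j ℕ.<_) (sym l+n∸1) (ℕₚ.+-monoʳ-< (l ∸ 1) j<n)))

    data Shape : ℤ → Set where
      zeroᶜ    : Shape (+ 0)
      leftᶜ    : ∀ j → j ℕ.< n → T (pb (- + j)) → Shape -[1+ j ]
      -- The element is left free: a central column of positive sum is refuted wherever this case is
      -- met.
      centralᶜ : ∀ q → q ℕ.< l ∸ 1 → T (pb (+ 1 + + q)) → ∀ {x} → Shape x
      rightᶜ   : ∀ j → j ℕ.< n → T (pb (+ (l ℕ.+ j))) → Shape (+ suc j)

    ∈𝒮⁻ : ∀ {x} → x ∈ 𝒮 A → Shape x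
    ∈𝒮⁻ (here refl) = zeroᶜ
    ∈𝒮⁻ (there m) with ∈-++⁻ (map (λ c → c - + 1) (select A leftRange)) m
    ∈𝒮⁻ (there m) | inj₁ m₁ with ∈-map⁻ (λ c → c - + 1) m₁
    ... | c , c∈ , refl with ∈-select⁻ leftRange c∈
    ... | c∈r , t with ∈-range⁻ (- (+ n) + + 1) n c∈r
    ... | p , p<n , refl = go (column-left′ p p<n) t (cz p p<n)
      where
      lem : ∀ x → - (+ 1 + x) ≡ - x - + 1
      lem = solve-∀
      cz : ∀ p → p ℕ.< n → - + n + + 1 + + p ℤ.≤ + 0
      cz p p<n = subst (- + n + + 1 + + p ℤ.≤_) (lem′ (+ n)) (subst (ℤ._≤ - + n + + n) (sym (ℤₚ.+-assoc (- + n) (+ 1) (+ p))) (ℤₚ.+-monoʳ-≤ (- + n) (ℤ.+≤+ p<n)))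
        where
        lem′ : ∀ x → - x + x ≡ + 0
        lem′ = solve-∀
      go : ∀ {c} → Column c → T (pb c) → c ℤ.≤ + 0 → Shape (c - + 1)
      go (left j j<n)    t _ = subst Shape (lem (+ j)) (leftᶜ j j<n t)
      go (central q q<l) t _ = centralᶜ q q<l t
      go (right j j<n)   t c≤0 = ⊥-elim (ℕₚ.<⇒≱ (ℕₚ.<-≤-trans (ℕ.s≤s ℕ.z≤n) 1≤l) (ℕₚ.≤-trans (ℕₚ.m≤m+n l j) (ℤₚ.drop‿+≤+ c≤0)))
    ∈𝒮⁻ (there m) | inj₂ m₂ with ∈-map⁻ (λ c → c - + (l ∸ 1)) m₂
    ... | c , c∈ , refl with ∈-select⁻ rightRange c∈
    ... | c∈r , t with ∈-range⁻ (+ 1) (l ℕ.+ n ∸ 1) c∈r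
    ... | q , q< , refl with q ℕ.<? l ∸ 1
    ...   | yes q<l = centralᶜ q q<l t
    ...   | no q≮l  = subst Shape (trans (lem (+ (l ∸ 1)) (+ j)) (cong (λ t → + 1 + + t - + (l ∸ 1)) q≡)) (rightᶜ j j<n (subst (T ∘ pb) (cong +_ (trans (cong suc (sym q≡)) (cong (ℕ._+ j) l≡))) t))
      where
      j = q ∸ (l ∸ 1)
      lem : ∀ a b → + 1 + b ≡ + 1 + (a + b) - a
      lem = solve-∀
      q≡ : l ∸ 1 ℕ.+ j ≡ q
      q≡ = ℕₚ.m+[n∸m]≡n (ℕₚ.≮⇒≥ q≮l)
      j<n : j ℕ.< n
      j<n = ℕₚ.+-cancelˡ-< (l ∸ 1) j n (subst (ℕ._< l ∸ 1 ℕ.+ n) (sym q≡) (subst (q ℕ.<_) l+n∸1 q<))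

    pb-run : ∀ {c} p {β} → c ≡ start n + + p → run false (colN A p) ≡ just β → pb c ≡ β
    pb-run p {β} refl eq rewrite column-colN A p | trans (sym (ℤₚ.+-identityˡ (sumℤ (map val (colN A p))))) (run-sum false (colN A p) eq) = go β
      where
      go : ∀ β → does (+ 1 ℤ.≤? bit β) ≡ β
      go false = refl
      go true  = refl

    nthB-replicate : ∀ k p → nthB (L.replicate k false) p ≡ false
    nthB-replicate zero    p       = refl
    nthB-replicate (suc k) zero    = refl
    nthB-replicate (suc k) (suc p) = nthB-replicate k p

    module _ (0∈S : + 0 ∈ S)
      (S-bound : ∀ {x} → x ∈ S → x ≡ + 0 ⊎ (∃ λ j → j ℕ.< n × x ≡ -[1+ j ]) ⊎ (∃ λ j → j ℕ.< n × x ≡ + suc j)) where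

      σ₀ : List Bool
      σ₀ = L.replicate (width n) false

      rows⇒ : ∀ {m} (A : Array l m) → T (allᵇ (λ r → (sumℤ r == + 1) ∧ alternatesᵇ r) (rows A)) → RowsOK A
      rows⇒ []      t = tt
      rows⇒ (r ∷ A) t with ∧-elim {(sumℤ (rowVals r) == + 1) ∧ alternatesᵇ (rowVals r)} t
      ... | t₁ , t₂ = row-sound (toList r) t₁ , rows⇒ A t₂

      rows⇐ : ∀ {m} (A : Array l m) → RowsOK A → T (allᵇ (λ r → (sumℤ r == + 1) ∧ alternatesᵇ r) (rows A))
      rows⇐ []      _         = tt
      rows⇐ (r ∷ A) (ok , oks) = ∧-intro (row-complete (toList r) ok) (rows⇐ A oks)

      column-mem : ∀ p → p ℕ.< width n → start n + + p ∈ allColumns n l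
      column-mem p q = subst (_∈ allColumns n l) (cong (λ s → s + + p) (sym (start≡ n))) (∈-range⁺ _ _ p (subst (p ℕ.<_) (width≡ n) q))

      cond⇒valid : T (IsASTrapezoidᵇ A ∧ sameSet (𝒮 A) S) → T (valid σ₀ A)
      cond⇒valid t with ∧-elim {IsASTrapezoidᵇ A} t
      ... | t₀ , tS with ∧-elim {allᵇ (λ r → (sumℤ r == + 1) ∧ alternatesᵇ r) (rows A)} t₀ | ∧-elim {allᵇ (_∈ᵇ S) (𝒮 A)} tS
      ... | tR , t₁ | 𝒮⊆S , S⊆𝒮 with ∧-elim {allᵇ (λ c → alternatesᵇ (column A c) ∧ firstPositiveᵇ (column A c)) (allColumns n l)} t₁
      ... | tC , tZ = valid-complete σ₀ A (Lₚ.length-replicate (width n)) (rows⇒ A tR)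
          (λ p q → trans (cong (λ b → run b (colN A p)) (nthB-replicate (width n) p)) (trans (proj₂ (runs p q)) (cong just (agree p q))))
        where
        runs : ∀ p → p ℕ.< width n → ∃ λ β → run false (colN A p) ≡ just β
        runs p q = is-just-run {false} {colN A p} (subst T (trans (cong (λ xs → alternatesᵇ xs ∧ firstPositiveᵇ xs) (column-colN A p)) (alternates-first (colN A p)))
          (allᵇ-elim _ (allColumns n l) tC (column-mem p q)))
        no-central : ∀ q → q ℕ.< l ∸ 1 → pb (+ 1 + + q) ≡ false
        no-central q q< = cong (λ s → does (+ 1 ℤ.≤? s)) (==-sound (sumℤ (column A (+ 1 + + q))) (+ 0)
          (allᵇ-elim (λ c → sumℤ (column A c) == + 0) (centralColumns l) tZ (∈-range⁺ (+ 1) (l ∸ 1) q q<)))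
        left-inv : ∀ {x} j → x ≡ -[1+ j ] → Shape x → T (pb (- + j))
        left-inv j refl (leftᶜ .j _ t)    = t
        left-inv j refl (centralᶜ q q< t) = ⊥-elim (subst T (no-central q q<) t)
        right-inv : ∀ {x} j → x ≡ + suc j → Shape x → T (pb (+ (l ℕ.+ j)))
        right-inv j refl (rightᶜ .j _ t)   = t
        right-inv j refl (centralᶜ q q< t) = ⊥-elim (subst T (no-central q q<) t)
        pb≡tgt : ∀ {c} → Column c → pb c ≡ tgt c
        pb≡tgt (left j j<n)    = T-ext
          (λ t → subst T (sym (tgt-left j)) (allᵇ-elim (_∈ᵇ S) (𝒮 A) 𝒮⊆S (∈𝒮-left j j<n t)))
          (λ t → left-inv j refl (∈𝒮⁻ (∈ᵇ⇒∈ _ _ (allᵇ-elim (_∈ᵇ 𝒮 A) S S⊆𝒮 (∈ᵇ⇒∈ -[1+ j ] S (subst T (tgt-left j) t))))))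
        pb≡tgt (central q q<)  = trans (no-central q q<) (sym (tgt-central q q<))
        pb≡tgt (right j j<n)   = T-ext
          (λ t → subst T (sym (tgt-right j)) (allᵇ-elim (_∈ᵇ S) (𝒮 A) 𝒮⊆S (∈𝒮-right j j<n t)))
          (λ t → right-inv j refl (∈𝒮⁻ (∈ᵇ⇒∈ _ _ (allᵇ-elim (_∈ᵇ 𝒮 A) S S⊆𝒮 (∈ᵇ⇒∈ (+ suc j) S (subst T (tgt-right j) t))))))
        agree : ∀ p q → proj₁ (runs p q) ≡ tgt (start n + + p)
        agree p q = trans (sym (pb-run p refl (proj₂ (runs p q)))) (pb≡tgt (classify p q))

      valid⇒cond : T (valid σ₀ A) → T (IsASTrapezoidᵇ A ∧ sameSet (𝒮 A) S)
      valid⇒cond t with valid-sound σ₀ A (Lₚ.length-replicate (width n)) t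
      ... | rok , cok = ∧-intro (∧-intro (rows⇐ A rok) (∧-intro (allᵇ-intro _ (allColumns n l) cols) (allᵇ-intro _ (centralColumns l) centrals)))
          (∧-intro (allᵇ-intro (_∈ᵇ S) (𝒮 A) (λ m → sub₁ (∈𝒮⁻ m))) (allᵇ-intro (_∈ᵇ 𝒮 A) S (λ {x} m → sub₂ x m (S-bound m))))
        where
        runs : ∀ p → p ℕ.< width n → run false (colN A p) ≡ just (tgt (start n + + p))
        runs p q = trans (cong (λ b → run b (colN A p)) (sym (nthB-replicate (width n) p))) (cok p q)
        cols : ∀ {c} → c ∈ allColumns n l → T (alternatesᵇ (column A c) ∧ firstPositiveᵇ (column A c))
        cols m with ∈-range⁻ _ _ m
        ... | p , q , refl = subst T (sym (trans (cong (λ s → alternatesᵇ (column A (s + + p)) ∧ firstPositiveᵇ (column A (s + + p))) (sym (start≡ n)))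
          (trans (cong (λ xs → alternatesᵇ xs ∧ firstPositiveᵇ xs) (column-colN A p)) (trans (alternates-first (colN A p)) (cong is-just (runs p (subst (p ℕ.<_) (sym (width≡ n)) q))))))) tt
        pb≡tgt : ∀ {c} → Column c → pb c ≡ tgt c
        pb≡tgt {c} C with index C
        ... | p , q , eq = trans (pb-run p eq (runs p q)) (cong tgt (sym eq))
        centrals : ∀ {c} → c ∈ centralColumns l → T (sumℤ (column A c) == + 0)
        centrals m with ∈-range⁻ (+ 1) (l ∸ 1) m
        ... | q , q< , refl with index (central q q<)
        ...   | p , p< , eq = subst (λ s → T (s == + 0)) (sym sum≡0) tt
          where
          sum≡0 : sumℤ (column A (+ 1 + + q)) ≡ + 0
          sum≡0 = trans (cong (sumℤ ∘ column A) eq) (trans (cong sumℤ (column-colN A p)) (trans (sym (ℤₚ.+-identityˡ _))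
            (run-sum false (colN A p) (trans (runs p p<) (cong just (trans (cong tgt (sym eq)) (tgt-central q q<)))))))
        sub₁ : ∀ {x} → Shape x → T (x ∈ᵇ S)
        sub₁ zeroᶜ             = ∈⇒∈ᵇ (+ 0) S 0∈S
        sub₁ (leftᶜ j j<n t)   = subst T (trans (pb≡tgt (left j j<n)) (tgt-left j)) t
        sub₁ (centralᶜ q q< t) = ⊥-elim (subst T (trans (pb≡tgt (central q q<)) (tgt-central q q<)) t)
        sub₁ (rightᶜ j j<n t)  = subst T (trans (pb≡tgt (right j j<n)) (tgt-right j)) t
        sub₂ : ∀ x → x ∈ S → x ≡ + 0 ⊎ (∃ λ j → j ℕ.< n × x ≡ -[1+ j ]) ⊎ (∃ λ j → j ℕ.< n × x ≡ + suc j) → T (x ∈ᵇ 𝒮 A)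
        sub₂ x m (inj₁ refl)                    = ∈⇒∈ᵇ (+ 0) (𝒮 A) (here refl)
        sub₂ x m (inj₂ (inj₁ (j , j<n , refl))) = ∈⇒∈ᵇ x (𝒮 A) (∈𝒮-left j j<n
          (subst T (sym (trans (pb≡tgt (left j j<n)) (tgt-left j))) (∈⇒∈ᵇ x S m)))
        sub₂ x m (inj₂ (inj₂ (j , j<n , refl))) = ∈⇒∈ᵇ x (𝒮 A) (∈𝒮-right j j<n
          (subst T (sym (trans (pb≡tgt (right j j<n)) (tgt-right j))) (∈⇒∈ᵇ x S m)))

-- The constant term as an operator expression

infixr 3 _×ᴱ_
_×ᴱ_ : Exponents → Exponents → Exponents
X ×ᴱ Y = record
  { A = X.A × Y.A
  ; _∙_ = λ { (a , b) (c , d) → a X.∙ c , b Y.∙ d }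
  ; ε = X.ε , Y.ε
  ; assoc = λ { (a , b) (c , d) (e , f) → cong₂ _,_ (X.assoc a c e) (Y.assoc b d f) }
  ; comm = λ { (a , b) (c , d) → cong₂ _,_ (X.comm a c) (Y.comm b d) }
  ; idˡ = λ { (a , b) → cong₂ _,_ (X.idˡ a) (Y.idˡ b) }
  }
  where
  module X = Exponents X
  module Y = Exponents Y

takeV : ∀ m {k} → Vec ℤ (m ℕ.+ k) → Vec ℤ m
takeV zero    v       = []
takeV (suc m) (a ∷ v) = a ∷ takeV m v

dropV : ∀ m {k} → Vec ℤ (m ℕ.+ k) → Vec ℤ k
dropV zero    v       = v
dropV (suc m) (a ∷ v) = dropV m v

takeV-⊞ : ∀ m {k} (a b : Vec ℤ (m ℕ.+ k)) → takeV m (a ⊞ b) ≡ takeV m a ⊞ takeV m b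
takeV-⊞ zero    a       b       = refl
takeV-⊞ (suc m) (x ∷ a) (y ∷ b) = cong (x + y ∷_) (takeV-⊞ m a b)

dropV-⊞ : ∀ m {k} (a b : Vec ℤ (m ℕ.+ k)) → dropV m (a ⊞ b) ≡ dropV m a ⊞ dropV m b
dropV-⊞ zero    a       b       = refl
dropV-⊞ (suc m) (x ∷ a) (y ∷ b) = dropV-⊞ m a b

takeV-0v : ∀ m {k} → takeV m {k} 0v ≡ 0v
takeV-0v zero    = refl
takeV-0v (suc m) = cong (+ 0 ∷_) (takeV-0v m)

dropV-0v : ∀ m {k} → dropV m {k} 0v ≡ 0v
dropV-0v zero    = refl
dropV-0v (suc m) = dropV-0v m

atF : ∀ {k} → Fin k → ℤ → Vec ℤ k
atF i e = updateAt (replicate _ (+ 0)) i (λ _ → e)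

atF-⊞ : ∀ {k} (i : Fin k) a b → atF i a ⊞ atF i b ≡ atF i (a + b)
atF-⊞ zero    a b = cong (a + b ∷_) (⊞-0 0v)
atF-⊞ (suc i) a b = cong (+ 0 ∷_) (atF-⊞ i a b)

atF-0 : ∀ {k} (i : Fin k) → atF i (+ 0) ≡ 0v
atF-0 zero    = refl
atF-0 (suc i) = cong (+ 0 ∷_) (atF-0 i)

takeV-↑ˡ : ∀ m {k} (i : Fin m) e → takeV m {k} (atF (i ↑ˡ k) e) ≡ atF i e
takeV-↑ˡ (suc m) zero    e = cong (e ∷_) (takeV-0v m)
takeV-↑ˡ (suc m) (suc i) e = cong (+ 0 ∷_) (takeV-↑ˡ m i e)

dropV-↑ˡ : ∀ m {k} (i : Fin m) e → dropV m {k} (atF (i ↑ˡ k) e) ≡ 0v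
dropV-↑ˡ (suc m) zero    e = dropV-0v m
dropV-↑ˡ (suc m) (suc i) e = dropV-↑ˡ m i e

takeV-↑ʳ : ∀ m {k} (i : Fin k) e → takeV m {k} (atF (m ↑ʳ i) e) ≡ 0v
takeV-↑ʳ zero    i e = refl
takeV-↑ʳ (suc m) i e = cong (+ 0 ∷_) (takeV-↑ʳ m i e)

dropV-↑ʳ : ∀ m {k} (i : Fin k) e → dropV m {k} (atF (m ↑ʳ i) e) ≡ atF i e
dropV-↑ʳ zero    i e = refl
dropV-↑ʳ (suc m) i e = dropV-↑ʳ m i e

allFin-suc : ∀ k → allFin (suc k) ≡ zero ∷ map suc (allFin k)
allFin-suc k = cong (zero ∷_) (sym (Lₚ.map-tabulate id suc))

allFin-+ : ∀ m k → allFin (m ℕ.+ k) ≡ map (_↑ˡ k) (allFin m) ++ map (m ↑ʳ_) (allFin k)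
allFin-+ zero    k = sym (Lₚ.map-id (allFin k))
allFin-+ (suc m) k = begin
  allFin (suc (m ℕ.+ k))                                  ≡⟨ allFin-suc (m ℕ.+ k) ⟩
  zero ∷ map suc (allFin (m ℕ.+ k))                       ≡⟨ cong (λ is → zero ∷ map suc is) (allFin-+ m k) ⟩
  zero ∷ map suc (map (_↑ˡ k) (allFin m) ++ map (m ↑ʳ_) (allFin k))
    ≡⟨ cong (zero ∷_) (Lₚ.map-++ suc (map (_↑ˡ k) (allFin m)) _) ⟩
  zero ∷ map suc (map (_↑ˡ k) (allFin m)) ++ map suc (map (m ↑ʳ_) (allFin k))
    ≡⟨ cong₂ (λ is js → zero ∷ is ++ js) (trans (sym (Lₚ.map-∘ (allFin m))) (Lₚ.map-∘ (allFin m))) (sym (Lₚ.map-∘ (allFin k))) ⟩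
  map (_↑ˡ k) (zero ∷ map suc (allFin m)) ++ map (suc m ↑ʳ_) (allFin k)
    ≡⟨ cong (λ is → map (_↑ˡ k) is ++ map (suc m ↑ʳ_) (allFin k)) (allFin-suc m) ⟨
  map (_↑ˡ k) (allFin (suc m)) ++ map (suc m ↑ʳ_) (allFin k) ∎
  where open ≡-Reasoning

zs-allFin : ∀ k → zs k ≡ map (λ i → (+ 1 , atF i (+ 1)) ∷ (- + 1 , 0v) ∷ []) (allFin k)
zs-allFin zero    = refl
zs-allFin (suc k) = trans (cong₂ _∷_ refl (trans (cong (map lift) (zs-allFin k)) (trans (sym (Lₚ.map-∘ (allFin k))) (Lₚ.map-∘ (allFin k)))))
  (cong (map _) (sym (allFin-suc k)))

scaleU : ∀ {k} → ℤ → ℤ → Poly (Vec ℤ k) → Poly (Vec ℤ (suc k))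
scaleU c a []            = []
scaleU c a ((d , e) ∷ q) = (c * d , a ∷ e) ∷ scaleU c a q

_⊠_ : ∀ {k} → Poly ℤ → Poly (Vec ℤ k) → Poly (Vec ℤ (suc k))
[]            ⊠ q = []
((c , a) ∷ p) ⊠ q = scaleU c a q ++ (p ⊠ q)

⟪⊠⟫ : ∀ {k} p (q : Poly (Vec ℤ k)) g → ⟪ p ⊠ q ⟫ g ≡ ⟪ p ⟫ (λ a → ⟪ q ⟫ (λ e → g (a ∷ e)))
⟪⊠⟫ []            q g = refl
⟪⊠⟫ ((c , a) ∷ p) q g = trans (⟪⟫-++ (scaleU c a q) (p ⊠ q) g) (cong₂ _+_ (go q) (⟪⊠⟫ p q g))
  where
  lem : ∀ c d x y → c * d * x + c * y ≡ c * (d * x + y)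
  lem = solve-∀
  go : ∀ q → ⟪ scaleU c a q ⟫ g ≡ c * ⟪ q ⟫ (λ e → g (a ∷ e))
  go []            = sym (ℤₚ.*-zeroʳ c)
  go ((d , e) ∷ q) = trans (cong+ˡ (c * d * g (a ∷ e)) (go q)) (lem c d (g (a ∷ e)) _)

tens : ∀ {k} → Vec (Poly ℤ) k → Poly (Vec ℤ k)
tens []       = (+ 1 , []) ∷ []
tens (p ∷ ps) = p ⊠ tens ps

∇poly : ℕ → ℤ → Poly ℤ
∇poly zero    a = (+ 1 , a) ∷ []
∇poly (suc f) a = ∇poly f a ++ negP (∇poly f (a - + 1))

⟪∇poly⟫ : ∀ f a h → ⟪ ∇poly f a ⟫ h ≡ ∇^ f h a
⟪∇poly⟫ zero    a h = trans (ℤₚ.+-identityʳ _) (ℤₚ.*-identityˡ (h a))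
⟪∇poly⟫ (suc f) a h = trans (⟪⟫-++ (∇poly f a) (negP (∇poly f (a - + 1))) h)
  (cong₂ _+_ (⟪∇poly⟫ f a h) (trans (⟪⟫-neg (∇poly f (a - + 1)) h) (cong -_ (⟪∇poly⟫ f (a - + 1) h))))

∇polys : ∀ {k} → Vec (ℕ × ℤ) k → Vec (Poly ℤ) k
∇polys = V.map (λ { (f , a) → ∇poly f a })

spect-tens : ∀ {k} (ss : Vec (ℕ × ℤ) k) g → spect (toList ss) g ≡ ⟪ tens (∇polys ss) ⟫ (λ e → g (toList e))
spect-tens []             g = sym (trans (ℤₚ.+-identityʳ _) (ℤₚ.*-identityˡ (g [])))
spect-tens ((f , a) ∷ ss) g = sym (trans (⟪⊠⟫ (∇poly f a) (tens (∇polys ss)) (λ e → g (toList e)))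
  (trans (⟪∇poly⟫ f a _) (∇^-ext f a (λ y → sym (spect-tens ss (λ ys → g (y ∷ ys)))))))
  where
  ∇^-ext : ∀ f a {h h′ : ℤ → ℤ} → (∀ y → h y ≡ h′ y) → ∇^ f h a ≡ ∇^ f h′ a
  ∇^-ext zero    a e = e a
  ∇^-ext (suc f) a e = cong₂ _-_ (∇^-ext f a e) (∇^-ext f (a - + 1) e)

module _ where
  private
    module Fr (k : ℕ) = CommutativeRing (Mul.Free.ring (ℤ^ k))
    module Pr (k : ℕ) = Pairs (Mul.Free.ring (ℤ^ k))
  open Mul.Free using (mk; at)

  -- Spectators apply their differences one inside the other, which gives a nested tensor; the
  -- change of variables needs the same operator as a product in the ring.
  tens-∏ : ∀ {k} (ps : Vec (Poly ℤ) k) → Fr._≈_ k (tens ps) (Pr.∏ᵢ k (λ i → mapP (atF i) (lookup ps i)) (allFin k))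
  tens-∏ {zero}  []       = Fr.refl 0
  tens-∏ {suc k} (p ∷ ps) = begin
    p ⊠ tens ps
      ≈⟨ head ⟩
    mapP (atF zero) p · lift (tens ps)
      ≈⟨ *-congˡ {mapP (atF zero) p} (liftᶜ (tens-∏ ps)) ⟩
    mapP (atF zero) p · lift (Pr.∏ᵢ k (λ i → mapP (atF i) (lookup ps i)) (allFin k))
      ≈⟨ *-congˡ {mapP (atF zero) p} (lift-∏ (allFin k)) ⟩
    mapP (atF zero) p · ∏ᵢ (λ i → mapP (atF (suc i)) (lookup ps i)) (allFin k)
      ≈⟨ *-congˡ {mapP (atF zero) p} (∏ᵢ-map (λ i → mapP (atF i) (lookup (p ∷ ps) i)) suc (allFin k)) ⟨
    ∏ᵢ (λ i → mapP (atF i) (lookup (p ∷ ps) i)) (zero ∷ map suc (allFin k))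
      ≡⟨ cong (∏ᵢ (λ i → mapP (atF i) (lookup (p ∷ ps) i))) (allFin-suc k) ⟨
    ∏ᵢ (λ i → mapP (atF i) (lookup (p ∷ ps) i)) (allFin (suc k)) ∎
    where
    open Fr (suc k) using (_≈_; setoid; reflexive; *-cong; *-congˡ)
    open Pr (suc k)
    open Mul (ℤ^ suc k) using (_·_; ⟪⟫-·)
    open import Relation.Binary.Reasoning.Setoid setoid
    module Lf = MapP (ℤ^ k) (ℤ^ suc k) (+ 0 ∷_) (λ _ _ → refl) refl
    head : p ⊠ tens ps ≈ mapP (atF zero) p · lift (tens ps)
    head = mk λ g → trans (⟪⊠⟫ p (tens ps) g) (sym (trans (⟪⟫-· (mapP (atF zero) p) (lift (tens ps)) g) (trans (⟪⟫-mapP (atF zero) p _)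
      (⟪⟫-cong p (λ a → trans (⟪⟫-mapP (+ 0 ∷_) (tens ps) _) (⟪⟫-cong (tens ps) (λ e → cong g (cong₂ _∷_ (ℤₚ.+-identityʳ a) (Vₚ.zipWith-identityˡ ℤₚ.+-identityˡ e)))))))))
    liftᶜ : ∀ {p q} → Fr._≈_ k p q → lift p ≈ lift q
    liftᶜ {p} {q} e = mk λ g → trans (⟪⟫-mapP (+ 0 ∷_) p g) (trans (at e _) (sym (⟪⟫-mapP (+ 0 ∷_) q g)))
    lift-∏ : ∀ is → lift (Pr.∏ᵢ k (λ i → mapP (atF i) (lookup ps i)) is) ≈ ∏ᵢ (λ i → mapP (atF (suc i)) (lookup ps i)) is
    lift-∏ []       = Lf.mapP-one
    lift-∏ (i ∷ is) = Fr.trans (suc k) (Lf.mapP-· (mapP (atF i) (lookup ps i)) _) (*-cong (reflexive (mapP-∘ (+ 0 ∷_) (atF i) (lookup ps i))) (lift-∏ is))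

-- γR a k is the coefficient of z^a in (1+z)^k; γL is its analogue for z = −x/(1+x), so that multiplication
-- by x acts on the first argument as E⁻¹ − 1 acts on the second.
γR γL : ℤ → ℤ → ℤ
γR (+ j)    k = bin j k
γR -[1+ _ ] k = + 0
γL (+ zero)  k = + 1
γL (+ suc _) k = + 0
γL -[1+ j ]  k = sgn (suc j) * bin (suc j) (k + + suc j)

-- Pascal's rule, read as x⁻¹ = E - 1. The value 0 at negative a is what keeps it true at a = 0.
γR-rel : ∀ a k → γR (a + - + 1) k ≡ γR a (k + + 1) - γR a k
γR-rel (+ zero)  k = refl
γR-rel (+ suc j) k = sym (Δ-bin j k)
γR-rel -[1+ _ ]  k = refl

γL-rel : ∀ a k → γL (a + + 1) k ≡ γL a (k + - + 1) - γL a k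
γL-rel (+ zero)  k = refl
γL-rel (+ suc j) k = refl
γL-rel -[1+ zero ]  k = sym (begin
  - + 1 * bin 1 (k + - + 1 + + 1) - - + 1 * bin 1 (k + + 1)
    ≡⟨ cong (λ t → - + 1 * bin 1 t - - + 1 * bin 1 (k + + 1)) (lem₁ k) ⟩
  - + 1 * bin 1 k - - + 1 * bin 1 (k + + 1)
    ≡⟨ lem₂ (bin 1 k) (bin 1 (k + + 1)) ⟩
  Δ (bin 1) k
    ≡⟨ Δ-bin 0 k ⟩
  + 1 ∎)
  where
  open ≡-Reasoning
  lem₁ : ∀ k → k + - + 1 + + 1 ≡ k
  lem₁ = solve-∀
  lem₂ : ∀ x y → - + 1 * x - - + 1 * y ≡ y - x
  lem₂ = solve-∀
γL-rel -[1+ suc j ] k = sym (begin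
  s * bin (suc (suc j)) (k + - + 1 + + suc (suc j)) - s * bin (suc (suc j)) (k + + suc (suc j))
    ≡⟨ cong₂ (λ t t′ → s * bin (suc (suc j)) t - s * bin (suc (suc j)) t′) (lem₁ k (+ suc j)) (lem₃ k (+ suc j)) ⟩
  s * bin (suc (suc j)) m - s * bin (suc (suc j)) (m + + 1)
    ≡⟨ lem₂ (sgn (suc j)) (bin (suc (suc j)) m) (bin (suc (suc j)) (m + + 1)) ⟩
  sgn (suc j) * Δ (bin (suc (suc j))) m
    ≡⟨ cong (sgn (suc j) *_) (Δ-bin (suc j) m) ⟩
  sgn (suc j) * bin (suc j) m ∎)
  where
  open ≡-Reasoning
  s = sgn (suc (suc j))
  m = k + + suc j
  lem₁ : ∀ k x → k + - + 1 + (+ 1 + x) ≡ k + x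
  lem₁ = solve-∀
  lem₃ : ∀ k x → k + (+ 1 + x) ≡ k + x + + 1
  lem₃ = solve-∀
  lem₂ : ∀ s x y → - + 1 * s * x - - + 1 * s * y ≡ s * (y - x)
  lem₂ = solve-∀

G : ∀ {k} → (ℤ → ℤ → ℤ) → Vec ℤ k → Vec ℤ k → ℤ
G γ []       []       = + 1
G γ (a ∷ as) (k ∷ ks) = γ a k * G γ as ks

G-rel : ∀ γ s t → (∀ a k → γ (a + s) k ≡ γ a (k + t) - γ a k) →
  ∀ {k} (i : Fin k) as ks → G γ (as ⊞ atF i s) ks ≡ G γ as (ks ⊞ atF i t) - G γ as ks
G-rel γ s t rel zero    (a ∷ as) (k ∷ ks) rewrite ⊞-0 as | ⊞-0 ks | rel a k = lem (γ a (k + t)) (γ a k) (G γ as ks)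
  where
  lem : ∀ x y z → (x - y) * z ≡ x * z - y * z
  lem = solve-∀
G-rel γ s t rel (suc i) (a ∷ as) (k ∷ ks) rewrite ℤₚ.+-identityʳ a | ℤₚ.+-identityʳ k =
  trans (cong (γ a k *_) (G-rel γ s t rel i as ks)) (lem (γ a k) (G γ as (ks ⊞ atF i t)) (G γ as ks))
  where
  lem : ∀ x y z → x * (y - z) ≡ x * y - x * z
  lem = solve-∀

isZero : ℤ → ℤ
isZero a = if a == + 0 then + 1 else + 0

-- With second argument 0 here, and -1 in `γL-zero`, only the exponent 0 is detected: at these
-- points the kernel extracts constant terms.
γR-zero : ∀ a → γR a (+ 0) ≡ isZero a
γR-zero (+ zero)  = refl
γR-zero (+ suc j) = refl
γR-zero -[1+ j ]  = refl

bin-pred : ∀ j → bin (suc j) (+ j) ≡ + 0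
bin-pred j = vanish (suc j) j (ℕₚ.n<1+n j)
  where
  vanish : ∀ j n → n ℕ.< j → bin j (+ n) ≡ + 0
  vanish (suc j) zero    _         = refl
  vanish (suc j) (suc n) (ℕ.s≤s p) = cong₂ _+_ (vanish (suc j) n (ℕₚ.m≤n⇒m≤1+n p)) (vanish j n p)

γL-zero : ∀ a → γL a (- + 1) ≡ isZero a
γL-zero (+ zero)  = refl
γL-zero (+ suc j) = refl
γL-zero -[1+ j ]  = trans (cong (sgn (suc j) *_) (bin-pred j)) (ℤₚ.*-zeroʳ (sgn (suc j)))

δ : ∀ {k} → Vec ℤ k → ℤ
δ e = if isZeroVec e then + 1 else + 0

constantTerm-δ : ∀ {k} (p : Laurent k) → constantTerm p ≡ ⟪ p ⟫ δ
constantTerm-δ []            = refl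
constantTerm-δ ((c , e) ∷ p) with isZeroVec e
... | true  = cong₂ _+_ (sym (ℤₚ.*-identityʳ c)) (constantTerm-δ p)
... | false = trans (constantTerm-δ p) (sym (trans (cong+ʳ (⟪ p ⟫ δ) (ℤₚ.*-zeroʳ c)) (ℤₚ.+-identityˡ _)))

δ-∷ : ∀ {k} a (e : Vec ℤ k) → δ (a ∷ e) ≡ isZero a * δ e
δ-∷ a e with a == + 0
... | true  = sym (ℤₚ.*-identityˡ (δ e))
... | false = refl

G-δ : ∀ γ k₀ → (∀ a → γ a k₀ ≡ isZero a) → ∀ {k} (as : Vec ℤ k) → G γ as (replicate _ k₀) ≡ δ as
G-δ γ k₀ h []       = refl
G-δ γ k₀ h (a ∷ as) = trans (cong₂ _*_ (h a) (G-δ γ k₀ h as)) (sym (δ-∷ a as))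

δ-split : ∀ m {k} (e : Vec ℤ (m ℕ.+ k)) → δ e ≡ δ (takeV m e) * δ (dropV m e)
δ-split zero    e       = sym (ℤₚ.*-identityˡ (δ e))
δ-split (suc m) (a ∷ e) = trans (δ-∷ a e) (trans (cong (isZero a *_) (δ-split m e))
  (trans (sym (ℤₚ.*-assoc (isZero a) (δ (takeV m e)) (δ (dropV m e)))) (cong (_* δ (dropV m e)) (sym (δ-∷ a (takeV m e))))))

⟪⊗⟫ : ∀ {k} (p q : Laurent k) g → ⟪ p ⊗ q ⟫ g ≡ ⟪ p ⟫ (λ e → ⟪ q ⟫ (λ f → g (e ⊞ f)))
⟪⊗⟫ []            q g = refl
⟪⊗⟫ {k} ((c , e) ∷ p) q g = trans (⟪⟫-++ (map _ q) (p ⊗ q) g) (cong₂ _+_ (go _ (λ _ _ → refl) q) (⟪⊗⟫ p q g))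
  where
  lem : ∀ c d x y → c * d * x + c * y ≡ c * (d * x + y)
  lem = solve-∀
  go : ∀ (F : ℤ × Vec ℤ k → ℤ × Vec ℤ k) → (∀ b f → F (b , f) ≡ (c * b , e ⊞ f)) → ∀ q → ⟪ map F q ⟫ g ≡ c * ⟪ q ⟫ (λ f → g (e ⊞ f))
  go F eq []            = sym (ℤₚ.*-zeroʳ c)
  go F eq ((b , f) ∷ q) rewrite eq b f = trans (cong+ˡ (c * b * g (e ⊞ f)) (go F eq q)) (lem c b (g (e ⊞ f)) _)

⟪⊝⟫ : ∀ {k} (p q : Laurent k) g → ⟪ p ⊝ q ⟫ g ≡ ⟪ p ⟫ g - ⟪ q ⟫ g
⟪⊝⟫ p q g = trans (⟪⟫-++ p (map _ q) g) (cong+ˡ (⟪ p ⟫ g) (trans (go _ (λ _ _ → refl) q) (⟪⟫-neg q g)))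
  where
  go : ∀ F → (∀ b f → F (b , f) ≡ (- b , f)) → ∀ q → ⟪ map F q ⟫ g ≡ ⟪ negP q ⟫ g
  go F eq []            = refl
  go F eq ((b , f) ∷ q) rewrite eq b f = cong+ˡ (- b * g f) (go F eq q)

filter-↑ : ∀ u v → filter (λ i → u ℕ.≤? toℕ i) (allFin (u ℕ.+ v)) ≡ map (u ↑ʳ_) (allFin v)
filter-↑ u v = begin
  filter P? (allFin (u ℕ.+ v))                                  ≡⟨ cong (filter P?) (allFin-+ u v) ⟩
  filter P? (map (_↑ˡ v) (allFin u) ++ map (u ↑ʳ_) (allFin v))   ≡⟨ Lₚ.filter-++ P? (map (_↑ˡ v) (allFin u)) _ ⟩
  filter P? (map (_↑ˡ v) (allFin u)) ++ filter P? (map (u ↑ʳ_) (allFin v))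
    ≡⟨ cong₂ _++_ (Lₚ.filter-none P? (Allₚ.map⁺ (All.universal (λ i p → ℕₚ.<⇒≱ (subst (ℕ._< u) (sym (Finₚ.toℕ-↑ˡ i v)) (Finₚ.toℕ<n i)) p) (allFin u))))
                  (Lₚ.filter-all P? (Allₚ.map⁺ (All.universal (λ j → subst (u ℕ.≤_) (sym (Finₚ.toℕ-↑ʳ u j)) (ℕₚ.m≤m+n u (toℕ j))) (allFin v)))) ⟩
  map (u ↑ʳ_) (allFin v) ∎
  where
  open ≡-Reasoning
  P? = λ (i : Fin (u ℕ.+ v)) → u ℕ.≤? toℕ i

module PairsLt (R : CommutativeRing 0ℓ 0ℓ) where
  open CommutativeRing R using (Carrier; _≈_; *-congˡ; *-cong; reflexive; setoid)
    renaming (_*_ to _⊛_; refl to ≈-refl; sym to ≈-sym; trans to ≈-trans)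
  open Pairs R

  ∏-concatMap : ∀ {I J : Set} (f : J → Carrier) (h : I → List J) is → ∏ᵢ f (concatMap h is) ≈ ∏ᵢ (λ i → ∏ᵢ f (h i)) is
  ∏-concatMap f h []       = ≈-refl
  ∏-concatMap f h (i ∷ is) = ≈-trans (∏ᵢ-++ f (h i) (concatMap h is)) (*-congˡ (∏-concatMap f h is))

  filter-suc : ∀ {k} (i : Fin k) (is : List (Fin k)) → filter (Fin.suc i <?_) (map Fin.suc is) ≡ map Fin.suc (filter (i <?_) is)
  filter-suc i []       = refl
  filter-suc i (j ∷ is) with does (i <?  j)
  ... | true  = cong (suc j ∷_) (filter-suc i is)
  ... | false = filter-suc i is

  filter-zero : ∀ {k} (is : List (Fin k)) → filter (Fin.zero {k} <?_) (map Fin.suc is) ≡ map Fin.suc is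
  filter-zero []       = refl
  filter-zero (i ∷ is) = cong (suc i ∷_) (filter-zero is)

  above : ∀ {k} → (Fin k → Fin k → Carrier) → Carrier
  above {k} q = ∏ᵢ (λ i → ∏ᵢ (q i) (filter (i <?_) (allFin k))) (allFin k)

  above-pairs : ∀ k (q : Fin k → Fin k → Carrier) → above q ≈ pairs q (allFin k)
  above-pairs zero    q = ≈-refl
  above-pairs (suc k) q = begin
    ∏ᵢ (λ i → ∏ᵢ (q i) (filter (i <?_) (allFin (suc k)))) (allFin (suc k))
      ≡⟨ cong (λ is → ∏ᵢ (λ i → ∏ᵢ (q i) (filter (i <?_) is)) is) (allFin-suc k) ⟩
    ∏ᵢ (q zero) (filter (Fin.zero {k} <?_) (map Fin.suc (allFin k))) ⊛ ∏ᵢ (λ i → ∏ᵢ (q i) (filter (i <?_) (Fin.zero ∷ map Fin.suc (allFin k)))) (map suc (allFin k))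
      ≈⟨ *-cong (reflexive (cong (∏ᵢ (q zero)) (filter-zero (allFin k)))) (∏ᵢ-map _ suc (allFin k)) ⟩
    ∏ᵢ (q zero) (map suc (allFin k)) ⊛ ∏ᵢ (λ i → ∏ᵢ (q (suc i)) (filter (Fin.suc i <?_) (map Fin.suc (allFin k)))) (allFin k)
      ≈⟨ *-congˡ (∏ᵢ-cong (λ i → ≈-trans (reflexive (cong (∏ᵢ (q (suc i))) (filter-suc i (allFin k)))) (∏ᵢ-map (q (suc i)) suc (filter (i <?_) (allFin k)))) (allFin k)) ⟩
    ∏ᵢ (q zero) (map suc (allFin k)) ⊛ above (λ i j → q (suc i) (suc j))
      ≈⟨ *-congˡ (≈-trans (above-pairs k _) (≈-sym (pairs-map q suc (allFin k)))) ⟩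
    pairs q (Fin.zero ∷ map Fin.suc (allFin k))
      ≡⟨ cong (pairs q) (allFin-suc k) ⟨
    pairs q (allFin (suc k)) ∎
    where open import Relation.Binary.Reasoning.Setoid setoid

module ConstantTerm (u v l : ℕ) (s : Vec ℤ (u ℕ.+ v)) (fL : Fin u → ℕ) (fR : Fin v → ℕ)
  (hL : ∀ i → lookup s (i ↑ˡ v) ≡ -[1+ fL i ]) (hR : ∀ j → lookup s (u ↑ʳ j) ≡ + suc (fR j)) where

  open import Defs using (x)

  E : Exponents
  E = (ℤ^ u ×ᴱ ℤ^ v) ×ᴱ (ℤ^ u ×ᴱ ℤ^ v)
  open Exponents E using (A; _∙_; ε; assoc; idˡ)

  -- Exponents of x translate the arguments a, exponents of E the arguments k. In the annihilator
  -- quotient of this single function both kinds of variables live together and satisfy `relL` and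
  -- `relR`.
  Γ : A → ℤ
  Γ ((xl , xr) , (kl , kr)) = G γL xl kl * G γR xr kr

  open Mul E
  open Annihilator Γ using (_≈_; mk; at; ring)
  module Q = CommutativeRing ring
  open Vandermonde ring using (VW; _^_)
  open Pairs ring
  open Convert ring
  open PairsLt ring

  ιx : Vec ℤ (u ℕ.+ v) → A
  ιx e = (takeV u e , dropV u e) , (0v , 0v)

  ιk : Vec ℤ (v ℕ.+ u) → A
  ιk e = (0v , 0v) , (dropV v e , takeV v e)

  ι : Laurent (u ℕ.+ v) → Poly A
  ι = mapP ιx

  xL eL : Fin u → ℤ → Poly A
  xL i a = mono (+ 1) ((atF i a , 0v) , (0v , 0v))
  eL i a = mono (+ 1) ((0v , 0v) , (atF i a , 0v))

  xR eR : Fin v → ℤ → Poly A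
  xR j a = mono (+ 1) ((0v , atF j a) , (0v , 0v))
  eR j a = mono (+ 1) ((0v , 0v) , (0v , atF j a))

  private
    pure : ∀ {k} → 0v {k} ⊞ 0v ≡ 0v
    pure = ⊞-0 0v

    powers : (h : ℤ → A) → (∀ a b → h a ∙ h b ≡ h (a + b)) → h (+ 0) ≡ ε → Powers (λ a → mono (+ 1) (h a))
    powers h h-+ h-0 = record { hom = λ a b → Q.reflexive (cong (mono (+ 1)) (h-+ a b)) ; unit = Q.reflexive (cong (mono (+ 1)) h-0) }

  pxL : ∀ i → Powers (xL i)
  pxL i = powers _ (λ a b → cong₂ _,_ (cong₂ _,_ (atF-⊞ i a b) pure) (cong₂ _,_ pure pure)) (cong (λ t → (t , 0v) , (0v , 0v)) (atF-0 i))

  peL : ∀ i → Powers (eL i)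
  peL i = powers _ (λ a b → cong₂ _,_ (cong₂ _,_ pure pure) (cong₂ _,_ (atF-⊞ i a b) pure)) (cong (λ t → (0v , 0v) , (t , 0v)) (atF-0 i))

  pxR : ∀ j → Powers (xR j)
  pxR j = powers _ (λ a b → cong₂ _,_ (cong₂ _,_ pure (atF-⊞ j a b)) (cong₂ _,_ pure pure)) (cong (λ t → (0v , t) , (0v , 0v)) (atF-0 j))

  peR : ∀ j → Powers (eR j)
  peR j = powers _ (λ a b → cong₂ _,_ (cong₂ _,_ pure pure) (cong₂ _,_ pure (atF-⊞ j a b))) (cong (λ t → (0v , 0v) , (0v , t)) (atF-0 j))

  private
    mono-minus-one : ∀ a b (g : A → ℤ) → g a ≡ g b - g ε → ⟪ mono (+ 1) a ⟫ g ≡ ⟪ mono (+ 1) b ++ negP one ⟫ g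
    mono-minus-one a b g eq = trans (⟪⟫-mono a g) (trans eq (lem (g b) (g ε)))
      where
      lem : ∀ x y → x - y ≡ + 1 * x + (- + 1 * y + + 0)
      lem = solve-∀

  relL : ∀ i → xL i (+ 1) ≈ eL i (- + 1) ++ negP one
  relL i = mk λ { ((xl , xr) , (kl , kr)) → mono-minus-one _ _ (λ e → Γ (((xl , xr) , (kl , kr)) ∙ e)) (go xl xr kl kr) }
    where
    lem : ∀ a b c → (a - b) * c ≡ a * c - b * c
    lem = solve-∀
    go : ∀ xl xr kl kr → G γL (xl ⊞ atF i (+ 1)) (kl ⊞ 0v) * G γR (xr ⊞ 0v) (kr ⊞ 0v) ≡
      G γL (xl ⊞ 0v) (kl ⊞ atF i (- + 1)) * G γR (xr ⊞ 0v) (kr ⊞ 0v) - G γL (xl ⊞ 0v) (kl ⊞ 0v) * G γR (xr ⊞ 0v) (kr ⊞ 0v)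
    go xl xr kl kr rewrite ⊞-0 xl | ⊞-0 kl = trans (cong (_* G γR (xr ⊞ 0v) (kr ⊞ 0v)) (G-rel γL (+ 1) (- + 1) γL-rel i xl kl))
      (lem (G γL xl (kl ⊞ atF i (- + 1))) (G γL xl kl) (G γR (xr ⊞ 0v) (kr ⊞ 0v)))

  relR : ∀ j → xR j (- + 1) ≈ eR j (+ 1) ++ negP one
  relR j = mk λ { ((xl , xr) , (kl , kr)) → mono-minus-one _ _ (λ e → Γ (((xl , xr) , (kl , kr)) ∙ e)) (go xl xr kl kr) }
    where
    lem : ∀ a b c → c * (a - b) ≡ c * a - c * b
    lem = solve-∀
    go : ∀ xl xr kl kr → G γL (xl ⊞ 0v) (kl ⊞ 0v) * G γR (xr ⊞ atF j (- + 1)) (kr ⊞ 0v) ≡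
      G γL (xl ⊞ 0v) (kl ⊞ 0v) * G γR (xr ⊞ 0v) (kr ⊞ atF j (+ 1)) - G γL (xl ⊞ 0v) (kl ⊞ 0v) * G γR (xr ⊞ 0v) (kr ⊞ 0v)
    go xl xr kl kr rewrite ⊞-0 xr | ⊞-0 kr = trans (cong (G γL (xl ⊞ 0v) (kl ⊞ 0v) *_) (G-rel γR (- + 1) (+ 1) γR-rel j xr kr))
      (lem (G γR xr (kr ⊞ atF j (+ 1))) (G γR xr kr) (G γL (xl ⊞ 0v) (kl ⊞ 0v)))

  ι-⊗ : ∀ p q → ι (p ⊗ q) ≈ ι p · ι q
  ι-⊗ p q = mk λ d → trans (⟪⟫-mapP ιx (p ⊗ q) _) (trans (⟪⊗⟫ p q _)
    (sym (trans (⟪⟫-· (ι p) (ι q) _) (trans (⟪⟫-mapP ιx p _) (⟪⟫-cong p (λ e → trans (⟪⟫-mapP ιx q _) (⟪⟫-cong q (λ f → cong (λ t → Γ (d ∙ t)) (additive e f)))))))))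
    where
    additive : ∀ e f → ιx e ∙ ιx f ≡ ιx (e ⊞ f)
    additive e f = cong₂ _,_ (cong₂ _,_ (sym (takeV-⊞ u e f)) (sym (dropV-⊞ u e f))) (cong₂ _,_ pure pure)

  ι-⊕ : ∀ p q → ι (p ⊕ q) ≈ ι p ++ ι q
  ι-⊕ p q = mk λ d → trans (⟪⟫-mapP ιx (p ++ q) _) (trans (⟪⟫-++ p q _) (sym (trans (⟪⟫-++ (ι p) (ι q) _) (cong₂ _+_ (⟪⟫-mapP ιx p _) (⟪⟫-mapP ιx q _)))))

  ι-⊝ : ∀ p q → ι (p ⊝ q) ≈ ι p ++ negP (ι q)
  ι-⊝ p q = mk λ d → trans (⟪⟫-mapP ιx (p ⊝ q) _) (trans (⟪⊝⟫ p q _)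
    (sym (trans (⟪⟫-++ (ι p) (negP (ι q)) _) (cong₂ _+_ (⟪⟫-mapP ιx p _) (trans (⟪⟫-neg (ι q) _) (cong -_ (⟪⟫-mapP ιx q _)))))))

  ι-1 : ι (constL (+ 1)) ≈ one
  ι-1 = Q.reflexive (cong (mono (+ 1)) (cong (_, (0v , 0v)) (cong₂ _,_ (takeV-0v u) (dropV-0v u))))

  ι-^ : ∀ p k → ι (p ^L k) ≈ ι p ^ k
  ι-^ p zero    = ι-1
  ι-^ p (suc k) = Q.trans (ι-⊗ p (p ^L k)) (Q.*-congˡ {ι p} (ι-^ p k))

  ι-prodL : ∀ {I : Set} (f : I → Laurent (u ℕ.+ v)) is → ι (prodL (map f is)) ≈ ∏ᵢ (λ i → ι (f i)) is
  ι-prodL f []       = ι-1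
  ι-prodL f (i ∷ is) = Q.trans (ι-⊗ (f i) (prodL (map f is))) (Q.*-congˡ {ι (f i)} (ι-prodL f is))

  ι-left : ∀ i a → ι (xpow (i ↑ˡ v) a) ≡ xL i a
  ι-left i a = cong (mono (+ 1)) (cong (_, (0v , 0v)) (cong₂ _,_ (takeV-↑ˡ u i a) (dropV-↑ˡ u i a)))

  ι-right : ∀ j a → ι (xpow (u ↑ʳ j) a) ≡ xR j a
  ι-right j a = cong (mono (+ 1)) (cong (_, (0v , 0v)) (cong₂ _,_ (takeV-↑ʳ u j a) (dropV-↑ʳ u j a)))

  n : ℕ
  n = u ℕ.+ v

  F₁ F₂ F₃ : Laurent n
  F₁ = prodL (map (λ i → xpow i (- (+ n) - lookup s i)) (allFin n))
  F₂ = prodL (map (λ i → xpow i (+ 2 - + l) ⊗ ((constL (+ 1) ⊕ x i) ^L l)) (filter (λ i → u ℕ.≤? toℕ i) (allFin n)))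
  F₃ = prodL (map (λ { (i , j) → (x j ⊝ x i) ⊗ (constL (+ 1) ⊕ x i ⊕ (x i ⊗ x j)) }) (pairsLt n))

  ∏-split : ∀ (f : Fin n → Poly A) → ∏ᵢ f (allFin n) ≈ ∏ᵢ (λ i → f (i ↑ˡ v)) (allFin u) · ∏ᵢ (λ j → f (u ↑ʳ j)) (allFin v)
  ∏-split f = Q.trans (Q.reflexive (cong (∏ᵢ f) (allFin-+ u v))) (Q.trans (∏ᵢ-++ f (map (_↑ˡ v) (allFin u)) (map (u ↑ʳ_) (allFin v)))
    (Q.*-cong (∏ᵢ-map f (_↑ˡ v) (allFin u)) (∏ᵢ-map f (u ↑ʳ_) (allFin v))))

  aL : Fin u → ℤ
  aL i = - (+ n) - lookup s (i ↑ˡ v)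

  aR : Fin v → ℤ
  aR j = - (+ n) - lookup s (u ↑ʳ j)

  ιF₁ : ι F₁ ≈ ∏ᵢ (λ i → xL i (aL i)) (allFin u) · ∏ᵢ (λ j → xR j (aR j)) (allFin v)
  ιF₁ = Q.trans (ι-prodL _ (allFin n)) (Q.trans (∏-split (λ i → ι (xpow i (- (+ n) - lookup s i))))
    (Q.*-cong (∏ᵢ-cong (λ i → Q.reflexive (ι-left i (aL i))) (allFin u)) (∏ᵢ-cong (λ j → Q.reflexive (ι-right j (aR j))) (allFin v))))

  ιF₂ : ι F₂ ≈ ∏ᵢ (λ j → xR j (+ 2 - + l) · ((one ++ xR j (+ 1)) ^ l)) (allFin v)
  ιF₂ = Q.trans (Q.reflexive (cong (λ is → ι (prodL (map f is))) (filter-↑ u v))) (Q.trans (ι-prodL f (map (u ↑ʳ_) (allFin v)))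
    (Q.trans (∏ᵢ-map (λ i → ι (f i)) (u ↑ʳ_) (allFin v)) (∏ᵢ-cong (λ j →
      Q.trans (ι-⊗ (xpow (u ↑ʳ j) (+ 2 - + l)) ((constL (+ 1) ⊕ x (u ↑ʳ j)) ^L l))
        (Q.*-cong (Q.reflexive (ι-right j (+ 2 - + l))) (Q.trans (ι-^ (constL (+ 1) ⊕ x (u ↑ʳ j)) l)
          (^-cong l (Q.trans (ι-⊕ (constL (+ 1)) (x (u ↑ʳ j))) (Q.+-cong ι-1 (Q.reflexive (ι-right j (+ 1))))))))) (allFin v))))
    where
    f : Fin n → Laurent n
    f i = xpow i (+ 2 - + l) ⊗ ((constL (+ 1) ⊕ x i) ^L l)

  X : Fin n → Poly A
  X i = ι (x i)

  ιF₃ : ι F₃ ≈ pairs (λ i j → x-pair (X i) (X j)) (allFin n)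
  ιF₃ = Q.trans (go _ (λ _ _ → refl) (pairsLt n)) (Q.trans (∏-concatMap _ (λ i → map (i ,_) (filter (i <?_) (allFin n))) (allFin n))
    (Q.trans (∏ᵢ-cong (λ i → ∏ᵢ-map _ (i ,_) (filter (i <?_) (allFin n))) (allFin n)) (above-pairs n _)))
    where
    factor : Fin n → Fin n → Laurent n
    factor i j = (x j ⊝ x i) ⊗ (constL (+ 1) ⊕ x i ⊕ (x i ⊗ x j))
    factor≈ : ∀ i j → ι (factor i j) ≈ x-pair (X i) (X j)
    factor≈ i j = Q.trans (ι-⊗ (x j ⊝ x i) (constL (+ 1) ⊕ x i ⊕ (x i ⊗ x j))) (Q.*-cong (ι-⊝ (x j) (x i))
      (Q.trans (ι-⊕ (constL (+ 1) ⊕ x i) (x i ⊗ x j)) (Q.+-cong (Q.trans (ι-⊕ (constL (+ 1)) (x i)) (Q.+-congʳ {ι (x i)} ι-1)) (ι-⊗ (x i) (x j)))))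
    go : ∀ (h : Fin n × Fin n → Laurent n) → (∀ i j → h (i , j) ≡ factor i j) → ∀ ps →
      ι (prodL (map h ps)) ≈ ∏ᵢ (λ p → x-pair (X (proj₁ p)) (X (proj₂ p))) ps
    go h eq ps = Q.trans (ι-prodL h ps) (∏ᵢ-cong (λ { (i , j) → Q.trans (Q.reflexive (cong ι (eq i j))) (factor≈ i j) }) ps)

  N₀ : ℕ
  N₀ = length (allFin u) ℕ.+ length (allFin v) ∸ 1

  N₀≡ : N₀ ≡ n ∸ 1
  N₀≡ = cong (_∸ 1) (cong₂ ℕ._+_ (Lₚ.length-tabulate {n = u} id) (Lₚ.length-tabulate {n = v} id))

  -- An index is demanded because truncated subtraction gives N₀ = 0 for n = 0 as well; the equation
  -- is used only for positions attached to an index.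
  n≡suc : Fin n → + n ≡ + suc N₀
  n≡suc i = cong +_ (trans (inhabited i) (cong suc (sym N₀≡)))
    where
    inhabited : ∀ {k} → Fin k → k ≡ suc (k ∸ 1)
    inhabited {suc k} _ = refl

  aL≡ : ∀ i → aL i ≡ - + N₀ + + fL i
  aL≡ i = trans (cong₂ (λ a b → - a - b) (n≡suc (i ↑ˡ v)) (hL i)) (lem (+ N₀) (+ fL i))
    where
    lem : ∀ N f → - (+ 1 + N) - - (+ 1 + f) ≡ - N + f
    lem = solve-∀

  aR≡ : ∀ j → aR j ≡ - + suc N₀ - + suc (fR j)
  aR≡ j = cong₂ (λ a b → - a - b) (n≡suc (u ↑ʳ j)) (hR j)

  ιF₃-split : ι F₃ ≈ pairs (λ a b → x-pair ([ (λ i → xL i (+ 1)) , (λ j → xR j (+ 1)) ] a) ([ (λ i → xL i (+ 1)) , (λ j → xR j (+ 1)) ] b))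
    (map inj₁ (allFin u) ++ map inj₂ (allFin v))
  ιF₃-split = Q.trans ιF₃ (Q.trans (Q.reflexive (cong (pairs _) J-list)) (Q.trans (pairs-map _ J (map inj₁ (allFin u) ++ map inj₂ (allFin v)))
    (pairs-cong (λ a b → Q.reflexive (cong₂ x-pair (X-J a) (X-J b))) (map inj₁ (allFin u) ++ map inj₂ (allFin v)))))
    where
    J : Fin u ⊎ Fin v → Fin n
    J = [ _↑ˡ v , u ↑ʳ_ ]
    X-J : ∀ a → X (J a) ≡ [ (λ i → xL i (+ 1)) , (λ j → xR j (+ 1)) ] a
    X-J (inj₁ i) = ι-left i (+ 1)
    X-J (inj₂ j) = ι-right j (+ 1)
    J-list : allFin n ≡ map J (map inj₁ (allFin u) ++ map inj₂ (allFin v))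
    J-list = trans (allFin-+ u v) (sym (trans (Lₚ.map-++ J (map inj₁ (allFin u)) _) (cong₂ _++_ (sym (Lₚ.map-∘ (allFin u))) (sym (Lₚ.map-∘ (allFin v))))))

  monos : Poly A
  monos = ∏ᵢ (λ i → xL i (- + N₀) · eL i (+ 1 - + N₀)) (allFin u) · ∏ᵢ (λ j → xR j (+ N₀)) (allFin v)

  signs : Poly A
  signs = ∏ᵢ (λ i → fL i ^±) (allFin u)

  zlist : List (Poly A)
  zlist = map (λ j → eR j (+ 1) ++ negP one) (allFin v) ++ map (λ i → eL i (+ 1) ++ negP one) (allFin u)

  nabs : Poly A
  nabs = ∏ᵢ (λ j → nab (eR j) (fR j) (+ l + + fR j)) (allFin v) · ∏ᵢ (λ i → nab (eL i) (fL i) (- + suc N₀)) (allFin u)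

  ι-poly : ι (theoremPoly n l u s) ≈ monos · (signs · (nabs · VW zlist))
  ι-poly = Q.trans (ι-⊗ F₁ (F₂ ⊗ F₃)) (Q.trans (Q.*-cong ιF₁ (Q.trans (ι-⊗ F₂ F₃) (Q.*-cong ιF₂ ιF₃-split)))
    (convert xL eL xR eR pxL peL pxR peR relL relR (allFin u) (allFin v) l aL aR fL fR aL≡ aR≡))

  m₀ d₀ : A
  -- `m₀` is the total exponent of `monos`; `d₀` is the base point at which `Γ` extracts the
  -- constant term.
  m₀ = (replicate _ (- + N₀) , replicate _ (+ N₀)) , (replicate _ (+ 1 - + N₀) , 0v)
  d₀ = (0v , 0v) , (replicate _ (- + 1) , 0v)

  Σᴬ : {I : Set} → (I → A) → List I → A
  Σᴬ h []       = ε
  Σᴬ h (i ∷ is) = h i ∙ Σᴬ h is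

  ∏-mono : ∀ {I : Set} (h : I → A) is → ∏ᵢ (λ i → mono (+ 1) (h i)) is ≈ mono (+ 1) (Σᴬ h is)
  ∏-mono h []       = Q.refl
  ∏-mono h (i ∷ is) = Q.*-congˡ {mono (+ 1) (h i)} (∏-mono h is)

  Σᵛ : ∀ {k} {I : Set} → (I → Vec ℤ k) → List I → Vec ℤ k
  Σᵛ h []       = 0v
  Σᵛ h (i ∷ is) = h i ⊞ Σᵛ h is

  Σᵛ-atF : ∀ k a → Σᵛ (λ (i : Fin k) → atF i a) (allFin k) ≡ replicate k a
  Σᵛ-atF zero    a = refl
  Σᵛ-atF (suc k) a = trans (cong (Σᵛ (λ i → atF i a)) (allFin-suc k)) (trans (cong (atF zero a ⊞_) (shifted (allFin k)))
    (cong₂ _∷_ (ℤₚ.+-identityʳ a) (trans (Vₚ.zipWith-identityˡ ℤₚ.+-identityˡ _) (Σᵛ-atF k a))))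
    where
    shifted : ∀ is → Σᵛ (λ i → atF i a) (map suc is) ≡ + 0 ∷ Σᵛ (λ i → atF i a) is
    shifted []       = refl
    shifted (i ∷ is) = cong (atF (suc i) a ⊞_) (shifted is)

  Σᵛ-0 : ∀ {k} {I : Set} (is : List I) → Σᵛ {k} (λ _ → 0v) is ≡ 0v
  Σᵛ-0 []       = refl
  Σᵛ-0 (i ∷ is) = trans (cong (0v ⊞_) (Σᵛ-0 is)) pure

  Σᴬ-blocks : ∀ {I : Set} (a : I → Vec ℤ u) (b : I → Vec ℤ v) (c : I → Vec ℤ u) (d : I → Vec ℤ v) is →
    Σᴬ (λ i → (a i , b i) , (c i , d i)) is ≡ ((Σᵛ a is , Σᵛ b is) , (Σᵛ c is , Σᵛ d is))
  Σᴬ-blocks a b c d []       = refl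
  Σᴬ-blocks a b c d (i ∷ is) = cong (((a i , b i) , (c i , d i)) ∙_) (Σᴬ-blocks a b c d is)

  monos≈ : monos ≈ mono (+ 1) m₀
  monos≈ = Q.trans (Q.*-cong
      (Q.trans (∏ᵢ-cong (λ i → Q.reflexive (cong (mono (+ 1)) (cong₂ _,_ (cong₂ _,_ (⊞-0 (atF i (- + N₀))) pure) (cong₂ _,_ (Vₚ.zipWith-identityˡ ℤₚ.+-identityˡ (atF i (+ 1 - + N₀))) pure)))) (allFin u))
        (Q.trans (∏-mono (λ i → (atF i (- + N₀) , 0v) , (atF i (+ 1 - + N₀) , 0v)) (allFin u))
          (Q.reflexive (cong (mono (+ 1)) (trans (Σᴬ-blocks _ _ _ _ (allFin u)) (cong₂ _,_ (cong₂ _,_ (Σᵛ-atF u (- + N₀)) (Σᵛ-0 (allFin u))) (cong₂ _,_ (Σᵛ-atF u (+ 1 - + N₀)) (Σᵛ-0 (allFin u)))))))))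
      (Q.trans (∏-mono (λ j → (0v , atF j (+ N₀)) , (0v , 0v)) (allFin v))
        (Q.reflexive (cong (mono (+ 1)) (trans (Σᴬ-blocks _ _ _ _ (allFin v)) (cong₂ _,_ (cong₂ _,_ (Σᵛ-0 (allFin v)) (Σᵛ-atF v (+ N₀))) (cong₂ _,_ (Σᵛ-0 (allFin v)) (Σᵛ-0 (allFin v)))))))))
    (Q.reflexive (cong (mono (+ 1)) (cong₂ _,_ (cong₂ _,_ (⊞-0 _) (Vₚ.zipWith-identityˡ ℤₚ.+-identityˡ _)) (cong₂ _,_ (⊞-0 _) pure))))

  sgns : List (Fin u) → ℤ
  sgns []       = + 1
  sgns (i ∷ is) = sgn (fL i) * sgns is

  mono-· : ∀ c d → mono c ε · mono d ε ≈ mono (c * d) ε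
  mono-· c d = Q.reflexive (cong (mono (c * d)) (idˡ ε))

  signs≈ : signs ≈ mono (sgns (allFin u)) ε
  signs≈ = go (allFin u)
    where
    power : ∀ f → f ^± ≈ mono (sgn f) ε
    power zero    = Q.refl
    power (suc f) = Q.trans (Q.*-congˡ {negP one} (power f)) (mono-· (- + 1) (sgn f))
    go : ∀ is → ∏ᵢ (λ i → fL i ^±) is ≈ mono (sgns is) ε
    go []       = Q.refl
    go (i ∷ is) = Q.trans (Q.*-cong (power (fL i)) (go is)) (mono-· (sgn (fL i)) (sgns is))

  ssR : Vec (ℕ × ℤ) v
  ssR = V.tabulate (λ j → fR j , + l + + fR j)

  ssL : Vec (ℕ × ℤ) u
  ssL = V.tabulate (λ i → fL i , - + suc N₀)

  ss : Vec (ℕ × ℤ) (v ℕ.+ u)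
  ss = ssR V.++ ssL

  ιk-⊞ : ∀ e f → ιk (e ⊞ f) ≡ ιk e ∙ ιk f
  ιk-⊞ e f = cong₂ _,_ (cong₂ _,_ (sym pure) (sym pure)) (cong₂ _,_ (dropV-⊞ v e f) (takeV-⊞ v e f))

  ιk-0 : ιk 0v ≡ ε
  ιk-0 = cong ((0v , 0v) ,_) (cong₂ _,_ (dropV-0v v) (takeV-0v v))

  module Ιk = MapP (ℤ^ (v ℕ.+ u)) E ιk ιk-⊞ ιk-0

  free : ∀ {p q} → Free._≈_ p q → p ≈ q
  free e = mk λ d → Free.at e _

  ιk-right : ∀ j a → ιk (atF (j ↑ˡ u) a) ≡ ((0v , 0v) , (0v , atF j a))
  ιk-right j a = cong ((0v , 0v) ,_) (cong₂ _,_ (dropV-↑ˡ v j a) (takeV-↑ˡ v j a))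

  ιk-left : ∀ i a → ιk (atF (v ↑ʳ i) a) ≡ ((0v , 0v) , (atF i a , 0v))
  ιk-left i a = cong ((0v , 0v) ,_) (cong₂ _,_ (dropV-↑ʳ v i a) (takeV-↑ʳ v i a))

  zlist≡ : map (mapP ιk) (zs (v ℕ.+ u)) ≡ zlist
  zlist≡ = begin
    map (mapP ιk) (zs (v ℕ.+ u))
      ≡⟨ cong (map (mapP ιk)) (zs-allFin (v ℕ.+ u)) ⟩
    map (mapP ιk) (map zF (allFin (v ℕ.+ u)))
      ≡⟨ Lₚ.map-∘ (allFin (v ℕ.+ u)) ⟨
    map (mapP ιk ∘ zF) (allFin (v ℕ.+ u))
      ≡⟨ cong (map (mapP ιk ∘ zF)) (allFin-+ v u) ⟩
    map (mapP ιk ∘ zF) (map (_↑ˡ u) (allFin v) ++ map (v ↑ʳ_) (allFin u))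
      ≡⟨ Lₚ.map-++ (mapP ιk ∘ zF) (map (_↑ˡ u) (allFin v)) _ ⟩
    map (mapP ιk ∘ zF) (map (_↑ˡ u) (allFin v)) ++ map (mapP ιk ∘ zF) (map (v ↑ʳ_) (allFin u))
      ≡⟨ cong₂ _++_ (trans (sym (Lₚ.map-∘ (allFin v))) (Lₚ.map-cong (λ j → cong₂ (λ a b → (+ 1 , a) ∷ (- + 1 , b) ∷ []) (ιk-right j (+ 1)) ιk-0) (allFin v)))
                    (trans (sym (Lₚ.map-∘ (allFin u))) (Lₚ.map-cong (λ i → cong₂ (λ a b → (+ 1 , a) ∷ (- + 1 , b) ∷ []) (ιk-left i (+ 1)) ιk-0) (allFin u))) ⟩
    zlist ∎
    where
    open ≡-Reasoning
    zF : Fin (v ℕ.+ u) → Poly (Vec ℤ (v ℕ.+ u))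
    zF i = (+ 1 , atF i (+ 1)) ∷ (- + 1 , 0v) ∷ []

  mapP-++ : ∀ {B C : Set} (h : B → C) p q → mapP h (p ++ q) ≡ mapP h p ++ mapP h q
  mapP-++ h []            q = refl
  mapP-++ h ((c , e) ∷ p) q = cong ((c , h e) ∷_) (mapP-++ h p q)

  mapP-negP : ∀ {B C : Set} (h : B → C) p → mapP h (negP p) ≡ negP (mapP h p)
  mapP-negP h []            = refl
  mapP-negP h ((c , e) ∷ p) = cong ((- c , h e) ∷_) (mapP-negP h p)

  nab-∇poly : ∀ (h h′ : ℤ → A) → (∀ a → h a ≡ h′ a) → ∀ f a → mapP h (∇poly f a) ≡ nab (λ a → mono (+ 1) (h′ a)) f a
  nab-∇poly h h′ eq zero    a = cong (mono (+ 1)) (eq a)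
  nab-∇poly h h′ eq (suc f) a = trans (mapP-++ h (∇poly f a) (negP (∇poly f (a - + 1))))
    (cong₂ _++_ (nab-∇poly h h′ eq f a) (trans (mapP-negP h (∇poly f (a - + 1))) (cong negP (nab-∇poly h h′ eq f (a - + 1)))))

  nabs≈ : mapP ιk (tens (∇polys ss)) ≈ nabs
  nabs≈ = Q.trans (mk λ d → trans (⟪⟫-mapP ιk (tens (∇polys ss)) _) (trans (Mul.Free.at (tens-∏ (∇polys ss)) _) (sym (⟪⟫-mapP ιk (P₀.∏ᵢ F₀ (allFin (v ℕ.+ u))) _))))
    (Q.trans (ιk-∏ (allFin (v ℕ.+ u)))
    (Q.trans (Q.reflexive (cong (∏ᵢ F) (allFin-+ v u)))
    (Q.trans (∏ᵢ-++ F (map (_↑ˡ u) (allFin v)) (map (v ↑ʳ_) (allFin u)))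
    (Q.*-cong (Q.trans (∏ᵢ-map F (_↑ˡ u) (allFin v)) (∏ᵢ-cong (λ j → Q.reflexive (right j)) (allFin v)))
              (Q.trans (∏ᵢ-map F (v ↑ʳ_) (allFin u)) (∏ᵢ-cong (λ i → Q.reflexive (left i)) (allFin u)))))))
    where
    module P₀ = Pairs (Mul.Free.ring (ℤ^ (v ℕ.+ u)))
    F₀ : Fin (v ℕ.+ u) → Poly (Vec ℤ (v ℕ.+ u))
    F₀ i = mapP (atF i) (lookup (∇polys ss) i)
    F : Fin (v ℕ.+ u) → Poly A
    F i = mapP ιk (F₀ i)
    ιk-∏ : ∀ is → mapP ιk (P₀.∏ᵢ F₀ is) ≈ ∏ᵢ F is
    ιk-∏ []       = free Ιk.mapP-one
    ιk-∏ (i ∷ is) = Q.trans (free (Ιk.mapP-· (F₀ i) (P₀.∏ᵢ F₀ is))) (Q.*-congˡ {F i} (ιk-∏ is))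
    entry : Fin (v ℕ.+ u) → ℕ × ℤ → Poly A
    entry i (f , a) = mapP ιk (mapP (atF i) (∇poly f a))
    F≡ : ∀ i → F i ≡ entry i (lookup ss i)
    F≡ i = cong (λ p → mapP ιk (mapP (atF i) p)) (Vₚ.lookup-map i _ ss)
    right : ∀ j → F (j ↑ˡ u) ≡ nab (eR j) (fR j) (+ l + + fR j)
    right j = trans (F≡ (j ↑ˡ u)) (trans (cong (entry (j ↑ˡ u)) (trans (Vₚ.lookup-++ˡ ssR ssL j) (Vₚ.lookup∘tabulate _ j)))
      (trans (mapP-∘ ιk (atF (j ↑ˡ u)) (∇poly (fR j) (+ l + + fR j))) (nab-∇poly _ _ (ιk-right j) (fR j) (+ l + + fR j))))
    left : ∀ i → F (v ↑ʳ i) ≡ nab (eL i) (fL i) (- + suc N₀)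
    left i = trans (F≡ (v ↑ʳ i)) (trans (cong (entry (v ↑ʳ i)) (trans (Vₚ.lookup-++ʳ ssR ssL i) (Vₚ.lookup∘tabulate _ i)))
      (trans (mapP-∘ ιk (atF (v ↑ʳ i)) (∇poly (fL i) (- + suc N₀))) (nab-∇poly _ _ (ιk-left i) (fL i) (- + suc N₀))))

  op : Poly (Vec ℤ (v ℕ.+ u))
  op = Mul._·_ (ℤ^ (v ℕ.+ u)) (tens (∇polys ss)) (VWz (v ℕ.+ u))

  op≈ : mapP ιk op ≈ nabs · VW zlist
  op≈ = Q.trans (free (Ιk.mapP-· (tens (∇polys ss)) (VWz (v ℕ.+ u)))) (Q.*-cong nabs≈
    (Q.trans (free (Ιk.h-VW (zs (v ℕ.+ u)))) (Q.reflexive (cong VW zlist≡))))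

  signN : ℕ → ℤ
  signN zero    = + 1
  signN (suc k) = sgn N₀ * signN k

  bs-split : ∀ m {k} (e : Vec ℤ (m ℕ.+ k)) → bs N₀ e ≡ bs N₀ (takeV m e) * bs N₀ (dropV m e)
  bs-split zero    e       = sym (ℤₚ.*-identityˡ (bs N₀ e))
  bs-split (suc m) (a ∷ e) = trans (cong (bin N₀ a *_) (bs-split m e)) (sym (ℤₚ.*-assoc (bin N₀ a) _ _))

  G-left : ∀ {k} (ks : Vec ℤ k) → G γL (0v ⊞ replicate _ (- + N₀) ⊞ 0v) (replicate _ (- + 1) ⊞ replicate _ (+ 1 - + N₀) ⊞ ks) ≡ signN k * bs N₀ ks
  G-left []       = refl
  G-left {suc m} (k ∷ ks) = trans (cong₂ _*_ (value N₀ k) (G-left ks)) (lem (sgn N₀) (bin N₀ k) (signN m) (bs N₀ ks))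
    where
    lem : ∀ a b c d → a * b * (c * d) ≡ a * c * (b * d)
    lem = solve-∀
    lem₁ : ∀ a → + 0 + - a + + 0 ≡ - a
    lem₁ = solve-∀
    lem₂ : ∀ a k → - + 1 + (+ 1 - a) + k + a ≡ k
    lem₂ = solve-∀
    value : ∀ N k → γL (+ 0 + - + N + + 0) (- + 1 + (+ 1 - + N) + k) ≡ sgn N * bin N k
    value zero    k = refl
    value (suc N) k = trans (cong (λ t → γL t (- + 1 + (+ 1 - + suc N) + k)) (lem₁ (+ suc N))) (cong (λ t → sgn (suc N) * bin (suc N) t) (lem₂ (+ suc N) k))

  G-right : ∀ {k} (ks : Vec ℤ k) → G γR (0v ⊞ replicate _ (+ N₀) ⊞ 0v) (0v ⊞ 0v ⊞ ks) ≡ bs N₀ ks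
  G-right []       = refl
  G-right (k ∷ ks) = cong₂ _*_ (cong₂ γR (lem (+ N₀)) (ℤₚ.+-identityˡ k)) (G-right ks)
    where
    lem : ∀ a → + 0 + a + + 0 ≡ a
    lem = solve-∀

  -- On the left the second argument is -1 + (1 - N₀) + k, and the value of `γL` at -N₀ adds N₀
  -- again, leaving (-1)^N₀ binom(k, N₀). On the right `γR` at N₀ is binom(k, N₀) as it stands.
  Γ-bs : ∀ e → Γ ((d₀ ∙ m₀) ∙ ιk e) ≡ signN u * bs N₀ e
  Γ-bs e = trans (cong₂ _*_ (G-left (dropV v e)) (G-right (takeV v e))) (trans (lem (signN u) (bs N₀ (dropV v e)) (bs N₀ (takeV v e))) (cong (signN u *_) (sym (bs-split v e))))
    where
    lem : ∀ a b c → a * b * c ≡ a * (c * b)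
    lem = solve-∀

  Γ-δ : ∀ e → δ e ≡ Γ (d₀ ∙ ιx e)
  Γ-δ e = sym (trans (cong₂ _*_
      (trans (cong₂ (G γL) (Vₚ.zipWith-identityˡ ℤₚ.+-identityˡ (takeV u e)) (⊞-0 (replicate _ (- + 1)))) (G-δ γL (- + 1) γL-zero (takeV u e)))
      (trans (cong₂ (G γR) (Vₚ.zipWith-identityˡ ℤₚ.+-identityˡ (dropV u e)) pure) (G-δ γR (+ 0) γR-zero (dropV u e))))
    (sym (δ-split u e)))

  -- `Γ` at `d₀` is `δ` as long as only exponents of x occur. Rewriting in the quotient leaves `m₀`
  -- and exponents of E, on which `Γ` is the product of binomials.
  constantTerm-formula : constantTerm (theoremPoly n l u s) ≡ sgns (allFin u) * signN u * spect (toList ss) (triangles N₀ (v ℕ.+ u))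
  constantTerm-formula = begin
    constantTerm (theoremPoly n l u s)
      ≡⟨ constantTerm-δ (theoremPoly n l u s) ⟩
    ⟪ theoremPoly n l u s ⟫ δ
      ≡⟨ ⟪⟫-cong (theoremPoly n l u s) Γ-δ ⟩
    ⟪ theoremPoly n l u s ⟫ (λ e → Γ (d₀ ∙ ιx e))
      ≡⟨ ⟪⟫-mapP ιx (theoremPoly n l u s) (λ e → Γ (d₀ ∙ e)) ⟨
    ⟪ ι (theoremPoly n l u s) ⟫ (λ e → Γ (d₀ ∙ e))
      ≡⟨ at (Q.trans ι-poly (Q.*-cong monos≈ (Q.*-cong signs≈ (Q.sym op≈)))) d₀ ⟩
    ⟪ mono (+ 1) m₀ · (mono c ε · mapP ιk op) ⟫ (λ e → Γ (d₀ ∙ e))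
      ≡⟨ ⟪⟫-mono· m₀ (mono c ε · mapP ιk op) _ ⟩
    ⟪ mono c ε · mapP ιk op ⟫ (λ e → Γ (d₀ ∙ (m₀ ∙ e)))
      ≡⟨ trans (⟪⟫-· (mono c ε) (mapP ιk op) _) (ℤₚ.+-identityʳ _) ⟩
    c * ⟪ mapP ιk op ⟫ (λ e → Γ (d₀ ∙ (m₀ ∙ (ε ∙ e))))
      ≡⟨ cong (c *_) (trans (⟪⟫-mapP ιk op _) (⟪⟫-cong op (λ e → trans (cong Γ (trans (cong (λ t → d₀ ∙ (m₀ ∙ t)) (idˡ (ιk e))) (sym (assoc d₀ m₀ (ιk e))))) (Γ-bs e)))) ⟩
    c * ⟪ op ⟫ (λ e → signN u * bs N₀ e)
      ≡⟨ cong (c *_) (⟪⟫-* op (signN u) (bs N₀)) ⟩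
    c * (signN u * ⟪ op ⟫ (bs N₀))
      ≡⟨ ℤₚ.*-assoc c (signN u) _ ⟨
    c * signN u * ⟪ op ⟫ (bs N₀)
      ≡⟨ cong (c * signN u *_) (trans (Mul.⟪⟫-· (ℤ^ (v ℕ.+ u)) (tens (∇polys ss)) (VWz (v ℕ.+ u)) (bs N₀))
           (trans (⟪⟫-cong (tens (∇polys ss)) (λ e → sym (triangles-toList N₀ e))) (sym (spect-tens ss (triangles N₀ (v ℕ.+ u)))))) ⟩
    c * signN u * spect (toList ss) (triangles N₀ (v ℕ.+ u)) ∎
    where
    open ≡-Reasoning
    c = sgns (allFin u)

-- The columns frozen by the recursion and the entries of s are both strictly ordered, so comparing
-- members suffices to identify the two lists.
sorted-unique : ∀ {A : Set} (_≺_ : A → A → Set) → (∀ {a b} → a ≺ b → b ≺ a → ⊥) →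
  ∀ xs ys → AllPairs _≺_ xs → AllPairs _≺_ ys → (∀ {a} → a ∈ xs → a ∈ ys) → (∀ {a} → a ∈ ys → a ∈ xs) → xs ≡ ys
sorted-unique _≺_ asym []       []       _ _ _ _ = refl
sorted-unique _≺_ asym []       (y ∷ ys) _ _ f g with g (here refl)
... | ()
sorted-unique _≺_ asym (x ∷ xs) []       _ _ f g with f (here refl)
... | ()
sorted-unique _≺_ asym (x ∷ xs) (y ∷ ys) (px ∷ pxs) (py ∷ pys) f g = cong₂ _∷_ x≡y
  (sorted-unique _≺_ asym xs ys pxs pys
    (λ m → strip (f (there m)) (λ e → irrefl (subst (x ≺_) (trans e (sym x≡y)) (All.lookup px m))))
    (λ m → strip (g (there m)) (λ e → irrefl (subst (y ≺_) (trans e x≡y) (All.lookup py m)))))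
  where
  irrefl : ∀ {a} → a ≺ a → ⊥
  irrefl r = asym r r
  head : x ∈ y ∷ ys → y ∈ x ∷ xs → x ≡ y
  head (here e)  _         = e
  head (there m) (here e)  = sym e
  head (there m) (there k) = ⊥-elim (asym (All.lookup px k) (All.lookup py m))
  x≡y : x ≡ y
  x≡y = head (f (here refl)) (g (here refl))
  strip : ∀ {a b bs} → a ∈ b ∷ bs → (a ≡ b → ⊥) → a ∈ bs
  strip (here e)  ne = ⊥-elim (ne e)
  strip (there m) ne = m

sgn-+ : ∀ a b → sgn (a ℕ.+ b) ≡ sgn a * sgn b
sgn-+ zero    b = sym (ℤₚ.*-identityˡ (sgn b))
sgn-+ (suc a) b = trans (cong (- + 1 *_) (sgn-+ a b)) (sym (ℤₚ.*-assoc (- + 1) (sgn a) (sgn b)))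

sgn-² : ∀ a → sgn a * sgn a ≡ + 1
sgn-² zero    = refl
sgn-² (suc a) = trans (lem (sgn a)) (sgn-² a)
  where
  lem : ∀ x → - + 1 * x * (- + 1 * x) ≡ x * x
  lem = solve-∀

-- Rotating a left column gives the sign of n - 1 - f, whereas the constant term supplies the signs
-- of f and of n - 1 separately.
sgn-∸ : ∀ N f → f ℕ.≤ N → sgn (N ∸ f) ≡ sgn f * sgn N
sgn-∸ N f f≤N = sym (trans (cong (λ t → sgn f * sgn t) (sym (ℕₚ.m+[n∸m]≡n f≤N))) (trans (cong (sgn f *_) (sgn-+ f (N ∸ f)))
  (trans (sym (ℤₚ.*-assoc (sgn f) (sgn f) (sgn (N ∸ f)))) (trans (cong (_* sgn (N ∸ f)) (sgn-² f)) (ℤₚ.*-identityˡ _)))))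

module Select (χ : ℕ → Bool) where
  one? : ℕ → List ℕ
  one? m = if χ m then m ∷ [] else []

  up down : ℕ → List ℕ
  up zero      = []
  up (suc m)   = up m ++ one? m
  down zero    = []
  down (suc m) = one? m ++ down m

  ∈-one? : ∀ {a} m → a ∈ one? m → a ≡ m × T (χ m)
  ∈-one? m a∈ with χ m
  ∈-one? m (here e) | true = e , _

  one?-∈ : ∀ m → T (χ m) → m ∈ one? m
  one?-∈ m t with χ m
  ... | true = here refl

  ∈-up : ∀ {a} n → a ∈ up n → a ℕ.< n × T (χ a)
  ∈-up (suc n) a∈ with ∈-++⁻ (up n) a∈
  ... | inj₁ a∈′ with ∈-up n a∈′
  ...   | a<n , t = ℕₚ.m≤n⇒m≤1+n a<n , t
  ∈-up (suc n) a∈ | inj₂ a∈′ with ∈-one? n a∈′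
  ... | refl , t = ℕₚ.≤-refl , t

  ∈-down : ∀ {a} n → a ∈ down n → a ℕ.< n × T (χ a)
  ∈-down (suc n) a∈ with ∈-++⁻ (one? n) a∈
  ... | inj₂ a∈′ with ∈-down n a∈′
  ...   | a<n , t = ℕₚ.m≤n⇒m≤1+n a<n , t
  ∈-down (suc n) a∈ | inj₁ a∈′ with ∈-one? n a∈′
  ... | refl , t = ℕₚ.≤-refl , t

  up-∈ : ∀ {a} n → a ℕ.< n → T (χ a) → a ∈ up n
  up-∈ {a} (suc n) a<n t with ℕₚ.m≤n⇒m<n∨m≡n (ℕₚ.≤-pred a<n)
  ... | inj₁ a<n′ = ∈-++⁺ˡ (up-∈ n a<n′ t)
  ... | inj₂ refl = ∈-++⁺ʳ (up n) (one?-∈ n t)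

  down-∈ : ∀ {a} n → a ℕ.< n → T (χ a) → a ∈ down n
  down-∈ {a} (suc n) a<n t with ℕₚ.m≤n⇒m<n∨m≡n (ℕₚ.≤-pred a<n)
  ... | inj₁ a<n′ = ∈-++⁺ʳ (one? n) (down-∈ n a<n′ t)
  ... | inj₂ refl = ∈-++⁺ˡ (one?-∈ n t)

  one?-pairs : ∀ (_≺_ : ℕ → ℕ → Set) m → AllPairs _≺_ (one? m)
  one?-pairs _≺_ m with χ m
  ... | true  = [] ∷ []
  ... | false = []

  up-sorted : ∀ n → AllPairs ℕ._<_ (up n)
  up-sorted zero    = []
  up-sorted (suc n) = AllPairsₚ.++⁺ (up-sorted n) (one?-pairs ℕ._<_ n)
    (All.tabulate (λ a∈ → All.tabulate (λ b∈ → subst (_ ℕ.<_) (sym (proj₁ (∈-one? n b∈))) (proj₁ (∈-up n a∈)))))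

  down-sorted : ∀ n → AllPairs ℕ._>_ (down n)
  down-sorted zero    = []
  down-sorted (suc n) = AllPairsₚ.++⁺ (one?-pairs ℕ._>_ n) (down-sorted n)
    (All.tabulate (λ a∈ → All.tabulate (λ b∈ → subst (_ ℕ.<_) (sym (proj₁ (∈-one? n a∈))) (proj₁ (∈-down n b∈)))))

  module _ {k} (n : ℕ) (f : Fin k → ℕ) (f< : ∀ i → f i ℕ.< n) (sound : ∀ i → T (χ (f i))) (complete : ∀ m → T (χ m) → ∃ λ i → m ≡ f i) where

    up-tabulate : (∀ {i j} → i Fin.< j → f i ℕ.< f j) → up n ≡ tabulate f
    up-tabulate mono = sorted-unique ℕ._<_ ℕₚ.<-asym (up n) (tabulate f) (up-sorted n) (AllPairsₚ.tabulate⁺-< mono)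
      (λ a∈ → let (i , e) = complete _ (proj₂ (∈-up n a∈)) in subst (_∈ tabulate f) (sym e) (∈-tabulate⁺ i))
      (λ a∈ → let (i , e) = ∈-tabulate⁻ a∈ in subst (_∈ up n) (sym e) (up-∈ n (f< i) (sound i)))

    down-tabulate : (∀ {i j} → i Fin.< j → f i ℕ.> f j) → down n ≡ tabulate f
    down-tabulate anti = sorted-unique ℕ._>_ ℕₚ.<-asym (down n) (tabulate f) (down-sorted n) (AllPairsₚ.tabulate⁺-< anti)
      (λ a∈ → let (i , e) = complete _ (proj₂ (∈-down n a∈)) in subst (_∈ tabulate f) (sym e) (∈-tabulate⁺ i))
      (λ a∈ → let (i , e) = ∈-tabulate⁻ a∈ in subst (_∈ down n) (sym e) (down-∈ n (f< i) (sound i)))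

prodN : (ℕ → ℤ) → List ℕ → ℤ
prodN g []       = + 1
prodN g (a ∷ as) = g a * prodN g as

module Frozen (l : ℕ) (1≤l : 1 ℕ.≤ l) (tgt : ℤ → Bool) where
  open Count l 1≤l tgt
  module Rt = Select (λ m → tgt (+ (l ℕ.+ m)))
  module Lt = Select (λ m → tgt (- + m))

  bumpBy : ℕ → Spectators → Spectators
  bumpBy m = map (λ { (f , x) → m ℕ.+ f , x })

  bumpBy-bump : ∀ m ss → bumpBy m (bump ss) ≡ bumpBy (suc m) ss
  bumpBy-bump m []             = refl
  bumpBy-bump m ((f , x) ∷ ss) = cong₂ _∷_ (cong (_, x) (ℕₚ.+-suc m f)) (bumpBy-bump m ss)

  -- A column frozen with j rows to come is bumped j more times. The position of a rotated left
  -- column depends only on m + k, which every step preserves, so all of them end at the same place.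
  final-split : ∀ m k As Bs → final m k (As ++ Bs) ≡
    (map (λ j → j , + (l ℕ.+ j)) (Rt.up m) ++ bumpBy m As) ++ (bumpBy m Bs ++ map (λ j → j , - + (m ℕ.+ k)) (Lt.down m))
  final-split zero    k As Bs = cong₂ _++_ (sym (bump0 As)) (sym (trans (Lₚ.++-identityʳ _) (bump0 Bs)))
    where
    bump0 : ∀ ss → bumpBy 0 ss ≡ ss
    bump0 []       = refl
    bump0 (_ ∷ ss) = cong (_ ∷_) (bump0 ss)
  final-split (suc m) k As Bs = begin
    final m (suc k) (freezeR dR cR (freezeL dL cL (bump (As ++ Bs))))
      ≡⟨ cong (final m (suc k)) (frozen dR dL) ⟩
    final m (suc k) ((R₁ ++ bump As) ++ (bump Bs ++ L₁))
      ≡⟨ final-split m (suc k) (R₁ ++ bump As) (bump Bs ++ L₁) ⟩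
    (rights m ++ bumpBy m (R₁ ++ bump As)) ++ (bumpBy m (bump Bs ++ L₁) ++ lefts (m ℕ.+ suc k) m)
      ≡⟨ cong₂ _++_ right left ⟩
    (rights (suc m) ++ bumpBy (suc m) As) ++ (bumpBy (suc m) Bs ++ lefts (suc m ℕ.+ k) (suc m)) ∎
    where
    open ≡-Reasoning
    dR dL : Bool
    dR = tgt (+ (l ℕ.+ m))
    dL = tgt (- + m)
    cL cR : ℤ
    cL = - + m - + suc k
    cR = + (l ℕ.+ m)
    R₁ L₁ : Spectators
    R₁ = if dR then (0 , cR) ∷ [] else []
    L₁ = if dL then (0 , cL) ∷ [] else []
    rights : ℕ → Spectators
    rights m = map (λ j → j , + (l ℕ.+ j)) (Rt.up m)
    lefts : ℕ → ℕ → Spectators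
    lefts c m = map (λ j → j , - + c) (Lt.down m)
    frozen : ∀ dR dL → freezeR dR cR (freezeL dL cL (bump (As ++ Bs))) ≡
      ((if dR then (0 , cR) ∷ [] else []) ++ bump As) ++ (bump Bs ++ (if dL then (0 , cL) ∷ [] else []))
    frozen true  true  = cong ((0 , cR) ∷_) (trans (cong (_++ (0 , cL) ∷ []) (Lₚ.map-++ _ As Bs)) (Lₚ.++-assoc (bump As) (bump Bs) _))
    frozen true  false = cong ((0 , cR) ∷_) (trans (Lₚ.map-++ _ As Bs) (cong (bump As ++_) (sym (Lₚ.++-identityʳ _))))
    frozen false true  = trans (cong (_++ (0 , cL) ∷ []) (Lₚ.map-++ _ As Bs)) (Lₚ.++-assoc (bump As) (bump Bs) _)
    frozen false false = trans (Lₚ.map-++ _ As Bs) (cong (bump As ++_) (sym (Lₚ.++-identityʳ _)))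
    R₁-bump : bumpBy m R₁ ≡ map (λ j → j , + (l ℕ.+ j)) (Rt.one? m)
    R₁-bump with tgt (+ (l ℕ.+ m))
    ... | true  = cong (λ t → (t , cR) ∷ []) (ℕₚ.+-identityʳ m)
    ... | false = refl
    c≡ : cL ≡ - + (suc m ℕ.+ k)
    c≡ = lem (+ m) (+ k)
      where
      lem : ∀ a b → - a - (+ 1 + b) ≡ - (+ 1 + a + b)
      lem = solve-∀
    L₁-bump : bumpBy m L₁ ≡ map (λ j → j , - + (suc m ℕ.+ k)) (Lt.one? m)
    L₁-bump with tgt (- + m)
    ... | true  = cong₂ (λ t x → (t , x) ∷ []) (ℕₚ.+-identityʳ m) c≡
    ... | false = refl
    right : rights m ++ bumpBy m (R₁ ++ bump As) ≡ rights (suc m) ++ bumpBy (suc m) As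
    right = begin
      rights m ++ bumpBy m (R₁ ++ bump As)              ≡⟨ cong (rights m ++_) (Lₚ.map-++ _ R₁ (bump As)) ⟩
      rights m ++ (bumpBy m R₁ ++ bumpBy m (bump As))   ≡⟨ cong₂ (λ a b → rights m ++ (a ++ b)) R₁-bump (bumpBy-bump m As) ⟩
      rights m ++ (map _ (Rt.one? m) ++ bumpBy (suc m) As)  ≡⟨ Lₚ.++-assoc (rights m) _ _ ⟨
      (rights m ++ map _ (Rt.one? m)) ++ bumpBy (suc m) As  ≡⟨ cong (_++ bumpBy (suc m) As) (Lₚ.map-++ _ (Rt.up m) (Rt.one? m)) ⟨
      rights (suc m) ++ bumpBy (suc m) As               ∎
    left : bumpBy m (bump Bs ++ L₁) ++ lefts (m ℕ.+ suc k) m ≡ bumpBy (suc m) Bs ++ lefts (suc m ℕ.+ k) (suc m)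
    left = begin
      bumpBy m (bump Bs ++ L₁) ++ lefts (m ℕ.+ suc k) m
        ≡⟨ cong₂ _++_ (Lₚ.map-++ _ (bump Bs) L₁) (cong (λ c → lefts c m) (ℕₚ.+-suc m k)) ⟩
      (bumpBy m (bump Bs) ++ bumpBy m L₁) ++ lefts (suc m ℕ.+ k) m
        ≡⟨ cong₂ (λ a b → (a ++ b) ++ lefts (suc m ℕ.+ k) m) (bumpBy-bump m Bs) L₁-bump ⟩
      (bumpBy (suc m) Bs ++ map _ (Lt.one? m)) ++ lefts (suc m ℕ.+ k) m
        ≡⟨ Lₚ.++-assoc (bumpBy (suc m) Bs) _ _ ⟩
      bumpBy (suc m) Bs ++ (map _ (Lt.one? m) ++ lefts (suc m ℕ.+ k) m)
        ≡⟨ cong (bumpBy (suc m) Bs ++_) (Lₚ.map-++ _ (Lt.one? m) (Lt.down m)) ⟨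
      bumpBy (suc m) Bs ++ lefts (suc m ℕ.+ k) (suc m) ∎

  rotationSign-prod : ∀ m k → rotationSign m k ≡ prodN (λ j → sgn (m ℕ.+ k ∸ suc j)) (Lt.down m)
  rotationSign-prod zero    k = refl
  rotationSign-prod (suc m) k = trans (cong ((if tgt (- + m) then sgn k else + 1) *_)
      (trans (rotationSign-prod m (suc k)) (cong (λ t → prodN (λ j → sgn (t ∸ suc j)) (Lt.down m)) (ℕₚ.+-suc m k)))) step
    where
    step : (if tgt (- + m) then sgn k else + 1) * prodN (λ j → sgn (suc m ℕ.+ k ∸ suc j)) (Lt.down m) ≡ prodN (λ j → sgn (suc m ℕ.+ k ∸ suc j)) (Lt.down (suc m))
    step with tgt (- + m)
    ... | true  = cong (λ t → sgn t * prodN (λ j → sgn (suc m ℕ.+ k ∸ suc j)) (Lt.down m)) (sym (ℕₚ.m+n∸m≡n m k))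
    ... | false = ℤₚ.*-identityˡ _

lookup-∈ : ∀ {k} (s : Vec ℤ k) i → lookup s i ∈ toList s
lookup-∈ (a ∷ s) zero    = here refl
lookup-∈ (a ∷ s) (suc i) = there (lookup-∈ s i)

∈-lookup : ∀ {k} (s : Vec ℤ k) {a} → a ∈ toList s → ∃ λ i → a ≡ lookup s i
∈-lookup (a ∷ s) (here e)  = zero , e
∈-lookup (a ∷ s) (there m) with ∈-lookup s m
... | i , e = suc i , e

toList-tabulate : ∀ {B : Set} {k} (f : Fin k → B) → toList (V.tabulate f) ≡ tabulate f
toList-tabulate {k = zero}  f = refl
toList-tabulate {k = suc k} f = cong (f zero ∷_) (toList-tabulate (f ∘ suc))

≤-1⇒neg : ∀ a → a ℤ.≤ - + 1 → ∃ λ f → a ≡ -[1+ f ]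
≤-1⇒neg -[1+ f ] _ = f , refl

1≤⇒pos : ∀ a → + 1 ℤ.≤ a → ∃ λ f → a ≡ + suc f
1≤⇒pos (+ suc f) _ = f , refl
1≤⇒pos (+ zero) (ℤ.+≤+ ())

-- Equating the count with the constant term

module Main (u v l : ℕ) (1≤l : 1 ℕ.≤ l) (s : Vec ℤ (u ℕ.+ v))
  (increasing : ∀ i j → toℕ i ℕ.< toℕ j → lookup s i ℤ.< lookup s j)
  (negative : ∀ i → toℕ i ℕ.< u → lookup s i ℤ.≤ - (+ 1))
  (positive : ∀ i → u ℕ.≤ toℕ i → + 1 ℤ.≤ lookup s i)
  (bounds : All (λ a → (- (+ suc (u ℕ.+ v)) + + 1 ℤ.≤ a) × (a ℤ.≤ + suc (u ℕ.+ v) - + 1)) (+ 0 ∷ toList s)) where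

  n : ℕ
  n = u ℕ.+ v

  S : List ℤ
  S = + 0 ∷ toList s

  neg-at : ∀ i → ∃ λ f → lookup s (i ↑ˡ v) ≡ -[1+ f ]
  neg-at i = ≤-1⇒neg _ (negative (i ↑ˡ v) (subst (ℕ._< u) (sym (Finₚ.toℕ-↑ˡ i v)) (Finₚ.toℕ<n i)))

  pos-at : ∀ j → ∃ λ f → lookup s (u ↑ʳ j) ≡ + suc f
  pos-at j = 1≤⇒pos _ (positive (u ↑ʳ j) (subst (u ℕ.≤_) (sym (Finₚ.toℕ-↑ʳ u j)) (ℕₚ.m≤m+n u (toℕ j))))

  fL : Fin u → ℕ
  fL i = proj₁ (neg-at i)

  fR : Fin v → ℕ
  fR j = proj₁ (pos-at j)

  bound : ∀ i → (- (+ suc n) + + 1 ℤ.≤ lookup s i) × (lookup s i ℤ.≤ + suc n - + 1)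
  bound i = All.lookup bounds (there (lookup-∈ s i))

  fL<n : ∀ i → fL i ℕ.< n
  fL<n i = ℤₚ.drop‿+≤+ (≡.subst₂ ℤ._≤_ refl (lem (+ n)) (ℤₚ.neg-mono-≤ (subst (- (+ suc n) + + 1 ℤ.≤_) (proj₂ (neg-at i)) (proj₁ (bound (i ↑ˡ v))))))
    where
    lem : ∀ a → - (- (+ 1 + a) + + 1) ≡ a
    lem = solve-∀

  fR<n : ∀ j → fR j ℕ.< n
  fR<n j = ℤₚ.drop‿+≤+ (≡.subst₂ ℤ._≤_ (proj₂ (pos-at j)) (lem (+ n)) (proj₂ (bound (u ↑ʳ j))))
    where
    lem : ∀ a → + 1 + a - + 1 ≡ a
    lem = solve-∀

  data Index : Fin n → Set where
    isLeft  : ∀ i → Index (i ↑ˡ v)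
    isRight : ∀ j → Index (u ↑ʳ j)

  index-view : ∀ i → Index i
  index-view i with Fin.splitAt u i | Finₚ.join-splitAt u v i
  ... | inj₁ i′ | refl = isLeft i′
  ... | inj₂ j  | refl = isRight j

  S-bound : ∀ {a} → a ∈ S → a ≡ + 0 ⊎ (∃ λ j → j ℕ.< n × a ≡ -[1+ j ]) ⊎ (∃ λ j → j ℕ.< n × a ≡ + suc j)
  S-bound (here e) = inj₁ e
  S-bound (there m) with ∈-lookup s m
  ... | i , e with index-view i
  ...   | isLeft i′ = inj₂ (inj₁ (fL i′ , fL<n i′ , trans e (proj₂ (neg-at i′))))
  ...   | isRight j = inj₂ (inj₂ (fR j , fR<n j , trans e (proj₂ (pos-at j))))

  left-complete : ∀ m → -[1+ m ] ∈ S → ∃ λ i → m ≡ fL i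
  left-complete m (there k) with ∈-lookup s k
  ... | i , e with index-view i
  ...   | isLeft i′ = i′ , ℤₚ.-[1+-injective (trans e (proj₂ (neg-at i′)))
  ...   | isRight j with trans e (proj₂ (pos-at j))
  ...     | ()

  right-complete : ∀ m → + suc m ∈ S → ∃ λ j → m ≡ fR j
  right-complete m (there k) with ∈-lookup s k
  ... | i , e with index-view i
  ...   | isRight j = j , ℕₚ.suc-injective (ℤₚ.+-injective (trans e (proj₂ (pos-at j))))
  ...   | isLeft i′ with trans e (proj₂ (neg-at i′))
  ...     | ()

  fL-anti : ∀ {i j} → i Fin.< j → fL i ℕ.> fL j
  fL-anti {i} {j} i<j = ℤₚ.drop‿-<- (≡.subst₂ ℤ._<_ (proj₂ (neg-at i)) (proj₂ (neg-at j))
    (increasing (i ↑ˡ v) (j ↑ˡ v) (≡.subst₂ ℕ._<_ (sym (Finₚ.toℕ-↑ˡ i v)) (sym (Finₚ.toℕ-↑ˡ j v)) i<j)))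

  fR-mono : ∀ {i j} → i Fin.< j → fR i ℕ.< fR j
  fR-mono {i} {j} i<j = ℕₚ.≤-pred (ℤₚ.drop‿+<+ (≡.subst₂ ℤ._<_ (proj₂ (pos-at i)) (proj₂ (pos-at j))
    (increasing (u ↑ʳ i) (u ↑ʳ j) (≡.subst₂ ℕ._<_ (sym (Finₚ.toℕ-↑ʳ u i)) (sym (Finₚ.toℕ-↑ʳ u j)) (ℕₚ.+-monoʳ-< u i<j)))))

  open Cond n l 1≤l S
  open Count l 1≤l tgt
  open Frozen l 1≤l tgt
  module CT = ConstantTerm u v l s fL fR (λ i → proj₂ (neg-at i)) (λ j → proj₂ (pos-at j))

  up≡ : Rt.up n ≡ tabulate fR
  up≡ = Rt.up-tabulate n fR fR<n
    (λ j → subst T (sym (tgt-right (fR j))) (∈⇒∈ᵇ (+ suc (fR j)) S (there (subst (_∈ toList s) (proj₂ (pos-at j)) (lookup-∈ s (u ↑ʳ j))))))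
    (λ m t → right-complete m (∈ᵇ⇒∈ (+ suc m) S (subst T (tgt-right m) t)))
    fR-mono

  down≡ : Lt.down n ≡ tabulate fL
  down≡ = Lt.down-tabulate n fL fL<n
    (λ i → subst T (sym (tgt-left (fL i))) (∈⇒∈ᵇ -[1+ fL i ] S (there (subst (_∈ toList s) (proj₂ (neg-at i)) (lookup-∈ s (i ↑ˡ v))))))
    (λ m t → left-complete m (∈ᵇ⇒∈ -[1+ m ] S (subst T (tgt-left m) t)))
    fL-anti

  N₀≡ : ∀ i → suc CT.N₀ ≡ n
  N₀≡ i = ℤₚ.+-injective (sym (CT.n≡suc (i ↑ˡ v)))

  final≡ : final n 0 [] ≡ toList CT.ss
  final≡ = begin
    final n 0 []
      ≡⟨ final-split n 0 [] [] ⟩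
    (map (λ j → j , + (l ℕ.+ j)) (Rt.up n) ++ []) ++ map (λ j → j , - + (n ℕ.+ 0)) (Lt.down n)
      ≡⟨ cong₂ _++_ (trans (Lₚ.++-identityʳ _) (trans (cong (map _) up≡) (Lₚ.map-tabulate fR _)))
           (trans (cong (map _) down≡) (trans (Lₚ.map-tabulate fL _) (Lₚ.tabulate-cong (λ i → cong (λ t → fL i , - + t) (trans (ℕₚ.+-identityʳ n) (sym (N₀≡ i))))))) ⟩
    tabulate (λ j → fR j , + (l ℕ.+ fR j)) ++ tabulate (λ i → fL i , - + suc CT.N₀)
      ≡⟨ cong₂ _++_ (toList-tabulate (λ j → fR j , + (l ℕ.+ fR j))) (toList-tabulate (λ i → fL i , - + suc CT.N₀)) ⟨
    toList CT.ssR ++ toList CT.ssL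
      ≡⟨ Vₚ.toList-++ CT.ssR CT.ssL ⟨
    toList CT.ss ∎
    where open ≡-Reasoning

  rotationSign≡ : rotationSign n 0 ≡ CT.sgns (allFin u) * CT.signN u
  rotationSign≡ = trans (rotationSign-prod n 0) (trans (cong (prodN _) (trans down≡ (sym (Lₚ.map-tabulate id fL))))
    (trans (go (allFin u)) (cong (λ k → CT.sgns (allFin u) * CT.signN k) (Lₚ.length-tabulate {n = u} id))))
    where
    lem : ∀ a b c d → a * b * (c * d) ≡ a * c * (b * d)
    lem = solve-∀
    factor : ∀ i → sgn (n ℕ.+ 0 ∸ suc (fL i)) ≡ sgn (fL i) * sgn CT.N₀
    factor i = trans (cong (λ t → sgn (t ∸ suc (fL i))) (trans (ℕₚ.+-identityʳ n) (sym (N₀≡ i))))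
      (sgn-∸ CT.N₀ (fL i) (ℕₚ.≤-pred (subst (fL i ℕ.<_) (sym (N₀≡ i)) (fL<n i))))
    go : ∀ is → prodN (λ j → sgn (n ℕ.+ 0 ∸ suc j)) (map fL is) ≡ CT.sgns is * CT.signN (length is)
    go []       = refl
    go (i ∷ is) = trans (cong₂ _*_ (factor i) (go is)) (lem (sgn (fL i)) (sgn CT.N₀) (CT.sgns is) (CT.signN (length is)))

  count : ℕ
  count = sumArr {l} n (λ A → indicator (IsASTrapezoidᵇ A ∧ sameSet (𝒮 A) S))

  bijection : Fin count ↔ TrapezoidsWith n l S
  bijection = card-Array n (λ A → T (IsASTrapezoidᵇ A ∧ sameSet (𝒮 A) S)) _ (λ A → card-T _)

  count≡ : constantTerm (theoremPoly n l u s) ≡ + count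
  count≡ = sym (begin
    + count
      ≡⟨ cong +_ (sumArr-cong n (λ A → indicator-cong (cond⇒valid A (here refl) S-bound) (valid⇒cond A (here refl) S-bound))) ⟩
    + sumArr {l} n (λ A → indicator (Valid.valid l 1≤l tgt tgt-central (L.replicate (width n) false) A))
      ≡⟨ Valid.completions-valid l 1≤l tgt tgt-central n _ (Lₚ.length-replicate (width n)) ⟩
    completions n (L.replicate (width n) false)
      ≡⟨ completions-total n ⟩
    rotationSign n 0 * spect (final n 0 []) (triangles (ℕ.pred n) n)
      ≡⟨ cong₂ _*_ rotationSign≡ (cong₂ spect final≡ (cong₂ triangles (sym CT.N₀≡) (ℕₚ.+-comm u v))) ⟩
    CT.sgns (allFin u) * CT.signN u * spect (toList CT.ss) (triangles CT.N₀ (v ℕ.+ u))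
      ≡⟨ CT.constantTerm-formula ⟨
    constantTerm (theoremPoly n l u s) ∎)
    where open ≡-Reasoning

theorem1p3 : (n l u : ℕ) → 1 ≤ l → u ≤ n → (s : Vec ℤ n) →
    (∀ (i j : Fin n) → toℕ i < toℕ j → lookup s i ℤ.< lookup s j) →
    (∀ (i : Fin n) → toℕ i < u → lookup s i ℤ.≤ - (+ 1)) →
    (∀ (i : Fin n) → u ≤ toℕ i → + 1 ℤ.≤ lookup s i) →
    CentredCatalan (suc n) (+ 0 ∷ toList s) →
    Σ ℕ (λ w → (Fin w ↔ TrapezoidsWith n l (+ 0 ∷ toList s)) ×
    (constantTerm (theoremPoly n l u s) ≡ + w))
theorem1p3 n l u 1≤l u≤n with n ∸ u | ℕₚ.m+[n∸m]≡n u≤n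
... | v | refl = λ s inc neg pos (_ , _ , bounds , _) → let open Main u v l 1≤l s inc neg pos bounds in count , bijection , count≡
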